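{- Given GKAT expressions $e_1,e_2\in\mathrm{Exp}$, the following algorithm decides whether $[\![e_1]\!]=[\![e_2]\!]$ in time $O(n\cdot\alpha(n))$ for $|\mathrm{At}|$ constant, where $\alpha$ denotes the inverse Ackermann function and $n=|e_1|+|e_2|$: (1) convert $e_1$ and $e_2$ to their Thompson automata $\mathcal{X}_1=\mathcal{X}_{e_1}^\iota$ and $\mathcal{X}_2=\mathcal{X}_{e_2}^\iota$, with start states $\iota_1,\iota_2$; (2) normalize the automata, obtaining $\hat{\mathcal{X}}_1$ and $\hat{\mathcal{X}}_2$; (3) check bisimilarity of the start states $\iota_1$ and $\iota_2$ using the Hopcroft–Karp algorithm; (4) return true if $\iota_1\sim\iota_2$, otherwise return false.
   Context: Syntax. Fix disjoint nonempty sets $\Sigma$ (actions) and $T=\{t_1,\dots,t_n\}$ (primitive tests), $T$ finite. Boolean expressions $b,c\in\mathrm{BExp}$ are generated by $0 \mid 1 \mid t\in T \mid b\cdot c \mid b+c \mid \overline{b}$. GKAT expressions $e,f\in\mathrm{Exp}$ are generated by $p\in\Sigma \mid b\in\mathrm{BExp} \mid e\cdot f \mid e+_b f \mid e^{(b)}$; $|e|$ is the size of $e$. $\equiv_{BA}$ denotes Boolean equivalence, $b\le c$ iff $b+c\equiv_{BA}c$. $\mathrm{At}$ is the finite set of atoms (minimal nonzero elements) of the free Boolean algebra $\mathrm{BExp}/{\equiv_{BA}}$ on $T$. Below, Greek letters applied as in $\delta(x)(\alpha)$ denote atoms. Language model. Guarded strings: $\mathrm{GS}=\mathrm{At}\cdot(\Sigma\cdot\mathrm{At})^*$.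 Fusion product: $x\alpha\diamond\beta y = x\alpha y$ if $\alpha=\beta$, undefined otherwise; for $L,K\subseteq\mathrm{GS}$, $L\diamond K=\{x\diamond y : x\in L,y\in K, x\diamond y\text{ defined}\}$; $L^0=\mathrm{At}$, $L^{n+1}=L^n\diamond L$. For $B\subseteq\mathrm{At}$, $\overline{B}=\mathrm{At}\setminus B$, $L+_BK=(B\diamond L)\cup(\overline{B}\diamond K)$, $L^{(B)}=\bigcup_{n\ge0}(B\diamond L)^n\diamond\overline{B}$. Then $[\![-]\!]:\mathrm{Exp}\to 2^{\mathrm{GS}}$ is: $[\![p]\!]=\{\alpha p\beta:\alpha,\beta\in\mathrm{At}\}$, $[\![b]\!]=\{\alpha\in\mathrm{At}:\alpha\le b\}$, $[\![e\cdot f]\!]=[\![e]\!]\diamond[\![f]\!]$, $[\![e+_bf]\!]=[\![e]\!]+_{[\![b]\!]}[\![f]\!]$, $[\![e^{(b)}]\!]=[\![e]\!]^{([\![b]\!])}$. Automata. Let $GX=(2+\Sigma\times X)^{\mathrm{At}}$ with $2=\{0,1\}$. A $G$-coalgebra is a pair $\mathcal{X}=\langle X,\delta^{\mathcal{X}}\rangle$ with $\delta^{\mathcal{X}}:X\to GX$; a $G$-automaton is a $G$-coalgebra with a designated start state. Thompson construction. For $\langle X,\delta\rangle$, $Y\subseteq X$, $h\in GX$, the uniform continuation $\delta[Y,h]:X\to GX$ is $\delta[Y,h](x)(\alpha)=h(\alpha)$ if $x\in Y$ and $\delta(x)(\alpha)=1$, and $\delta[Y,h](x)(\alpha)=\delta(x)(\alpha)$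 otherwise. $\delta_1+\delta_2$ denotes the coproduct structure on the disjoint union $X+Y$. For each $e\in\mathrm{Exp}$ define a $G$-coalgebra $\mathcal{X}_e=\langle X_e,\delta_e\rangle$ and an initial pseudostate $\iota_e\in GX_e$ by recursion: - $e=b$: $X_b=\emptyset$, $\iota_b(\alpha)=1$ if $\alpha\le b$, else $0$. - $e=p$: $X_p=\{*\}$, $\delta_p(*)(\alpha)=1$ for all $\alpha$, $\iota_p(\alpha)=(p,*)$. - $e=f+_bg$: $X_e=X_f+X_g$, $\delta_e=\delta_f+\delta_g$, $\iota_e(\alpha)=\iota_f(\alpha)$ if $\alpha\le b$, $\iota_g(\alpha)$ if $\alpha\le\overline{b}$. - $e=f\cdot g$: $X_e=X_f+X_g$, $\delta_e=(\delta_f+\delta_g)[X_f,\iota_g]$, $\iota_e(\alpha)=\iota_f(\alpha)$ if $\iota_f(\alpha)\ne1$, $\iota_g(\alpha)$ if $\iota_f(\alpha)=1$. - $e=f^{(b)}$: $X_e=X_f$, $\iota_e(\alpha)=1$ if $\alpha\le\overline{b}$; $0$ if $\alpha\le b$ and $\iota_f(\alpha)=1$; $\iota_f(\alpha)$ if $\alpha\le b$ and $\iota_f(\alpha)\ne1$; $\delta_e=\delta_f[X_f,\iota_e]$. The Thompson automaton is $\mathcal{X}_e^\iota=\langle\{\iota\}+X_e,\delta_e^\iota,\iota\rangle$ with $\delta_e^\iota(x)=\delta_e(x)$ for $x\in X_e$ and $\delta_e^\iota(\iota)=\iota_e$. Normalization. A state is accepting if $\delta(s)(\alpha)=1$ for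 some $\alpha$, live if an accepting state is reachable from it, dead otherwise. The normalization $\hat{\mathcal{X}}$ of $\mathcal{X}$ has the same states and $\hat\delta(s)(\alpha)=0$ if $\delta(s)(\alpha)=(p,t)$ with $t$ dead, $\hat\delta(s)(\alpha)=\delta(s)(\alpha)$ otherwise. Bisimilarity. A bisimulation between $\mathcal{X}$ and $\mathcal{Y}$ is $R\subseteq X\times Y$ such that $x\mathrel{R}y$ implies, for all $\alpha\in\mathrm{At}$: if $\delta^{\mathcal{X}}(x)(\alpha)\in2$ then $\delta^{\mathcal{Y}}(y)(\alpha)=\delta^{\mathcal{X}}(x)(\alpha)$; if $\delta^{\mathcal{X}}(x)(\alpha)=(p,x')$ then $\delta^{\mathcal{Y}}(y)(\alpha)=(p,y')$ with $x'\mathrel{R}y'$ for some $y'$. $x\sim y$ means some bisimulation relates $x,y$. Hopcroft–Karp on finite normal automata $\mathcal{X},\mathcal{Y}$ with disjoint states: initialize a queue with the pair of start states and a union-find forest of singletons on $X\uplus Y$. While the queue is nonempty, pop $(x,y)$ and find representatives $r_x,r_y$; if $r_x=r_y$ continue; otherwise for each atom $\alpha$: if $\delta^{\mathcal{X}}(x)(\alpha)$ and $\delta^{\mathcal{Y}}(y)(\alpha)$ are equal elements of $2$, continue; if they are $(p,x')$ and $(p,y')$ with the same $p$, push $(x',y')$; in any other case return false. Then union $r_x,r_y$. When the queue is empty return true. -}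

module Defs where

open import Algebra.Lattice.Bundles using (BooleanAlgebra)
import Algebra.Lattice.Properties.BooleanAlgebra as BooleanAlgebraProperties
open import Data.Bool using (Bool; true; false; not; _∧_; _∨_; if_then_else_)
import Data.Bool.Properties as Bool
open import Data.Empty using (⊥; ⊥-elim)
open import Data.Fin using (Fin; zero; suc; toℕ)
open import Data.List using (List; []; _∷_; _++_; map)
open import Data.Maybe using (Maybe; just; nothing)
import Data.Maybe as Maybe
open import Data.Nat using (ℕ; zero; suc; _+_; _≤_; _<_; z≤n; s≤s; _≟_; _≤?_; _≡ᵇ_)
import Data.Nat.Properties as ℕ
open import Data.Nat.GeneralisedArithmetic using (iterate)
open import Data.Product using (Σ; ∃; ∃-syntax; _×_; _,_; proj₁; proj₂; map₂)
open import Data.Sum using (_⊎_; inj₁; inj₂; [_,_]′)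
import Data.Sum as Sum
open import Data.Unit using (⊤; tt)
open import Data.Vec using (Vec; []; _∷_; lookup)
import Data.Vec.Properties as Vec
open import Function using (_∘_; const; _↔_; _⇔_; Inverse)
open import Level using (0ℓ)
open import Relation.Binary using (DecidableEquality; Rel; tri<; tri≈; tri>)
open import Relation.Binary.Construct.Closure.ReflexiveTransitive using (Star)
open import Relation.Binary.PropositionalEquality
  using (_≡_; refl; sym; trans; cong; cong₂; subst)
import Relation.Binary.Reasoning.Setoid as SetoidReasoning
open import Relation.Nullary using (¬_; Dec; yes; no; does)
open import Relation.Nullary.Decidable using (map′)
import Relation.Unary as Unary
open import Relation.Unary using (Pred; _∪_; ∁; ⋃)

------------------------------------------------------------------------
-- Inverse Ackermann function

ackermann : ℕ → ℕ → ℕ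
ackermann zero    j = suc j
ackermann (suc k) j = iterate (ackermann k) j (suc j)

-- The least k with n ≤ ackermann k 1.  The fuel n is enough because
-- k ≤ ackermann k 1.
searchAckermann : (fuel k n : ℕ) → ℕ
searchAckermann zero       k n = k
searchAckermann (suc fuel) k n with n ≤? ackermann k 1
... | yes _ = k
... | no  _ = searchAckermann fuel (suc k) n

inverseAckermann : ℕ → ℕ
inverseAckermann n = searchAckermann n 0 n

module _ where
  private
    inflate : ∀ k j → j < ackermann k j
    iterate-inflate : ∀ k i j → j + i ≤ iterate (ackermann k) j i

    iterate-inflate k zero    j = ℕ.≤-reflexive (ℕ.+-identityʳ j)
    iterate-inflate k (suc i) j =
      ℕ.≤-trans (ℕ.≤-reflexive (ℕ.+-suc j i))
        (ℕ.≤-trans (ℕ.+-monoˡ-≤ i (inflate k j)) (iterate-inflate k i (ackermann k j)))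

    inflate zero    j = ℕ.≤-refl
    inflate (suc k) j =
      ℕ.≤-trans (ℕ.≤-trans (ℕ.m≤n+m (suc j) j) ℕ.≤-refl) (iterate-inflate k (suc j) j)

    column : ∀ k → suc k ≤ ackermann k 1
    column zero    = s≤s z≤n
    column (suc k) = ℕ.≤-trans (s≤s (column k)) (inflate k (ackermann k 1))

    search-bound : ∀ fuel k n → n ≤ fuel + k →
                   n ≤ ackermann (searchAckermann fuel k n) 1
    search-bound zero k n h = ℕ.≤-trans h (ℕ.≤-trans (ℕ.n≤1+n k) (column k))
    search-bound (suc fuel) k n h with n ≤? ackermann k 1
    ... | yes p = p
    ... | no  _ = search-bound fuel (suc k) n (ℕ.≤-trans h (ℕ.≤-reflexive (sym (ℕ.+-suc fuel k))))

    search-least : ∀ fuel k n → (∀ j → n ≤ ackermann j 1 → k ≤ j) →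
                   ∀ j → n ≤ ackermann j 1 → searchAckermann fuel k n ≤ j
    search-least zero k n h = h
    search-least (suc fuel) k n h with n ≤? ackermann k 1
    ... | yes _ = h
    ... | no ¬p = search-least fuel (suc k) n λ j q →
      ℕ.≤∧≢⇒< (h j q) λ { refl → ¬p q }

  inverseAckermann-bound : ∀ n → n ≤ ackermann (inverseAckermann n) 1
  inverseAckermann-bound n = search-bound n 0 n (ℕ.≤-reflexive (sym (ℕ.+-identityʳ n)))

  inverseAckermann-least : ∀ n k → n ≤ ackermann k 1 → inverseAckermann n ≤ k
  inverseAckermann-least n = search-least n 0 n (λ _ _ → z≤n)

------------------------------------------------------------------------
-- Tests over T = {t₁,…,tₖ}, and the free Boolean algebra BExp / ≈ᵇ

infix  9 ¬ᵇ_
infixr 8 _·ᵇ_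
infixr 7 _+ᵇ_

data BExp (k : ℕ) : Set where
  0ᵇ 1ᵇ     : BExp k
  prim      : Fin k → BExp k
  _·ᵇ_ _+ᵇ_ : BExp k → BExp k → BExp k
  ¬ᵇ_       : BExp k → BExp k

infix 4 _≈ᵇ_ _≤ᵇ_

data _≈ᵇ_ {k : ℕ} : BExp k → BExp k → Set where
  ≈-refl   : ∀ {b} → b ≈ᵇ b
  ≈-sym    : ∀ {b c} → b ≈ᵇ c → c ≈ᵇ b
  ≈-trans  : ∀ {b c d} → b ≈ᵇ c → c ≈ᵇ d → b ≈ᵇ d
  +-cong   : ∀ {b b′ c c′} → b ≈ᵇ b′ → c ≈ᵇ c′ → b +ᵇ c ≈ᵇ b′ +ᵇ c′
  ·-cong   : ∀ {b b′ c c′} → b ≈ᵇ b′ → c ≈ᵇ c′ → b ·ᵇ c ≈ᵇ b′ ·ᵇ c′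
  ¬-cong   : ∀ {b b′} → b ≈ᵇ b′ → ¬ᵇ b ≈ᵇ ¬ᵇ b′
  +-comm   : ∀ b c → b +ᵇ c ≈ᵇ c +ᵇ b
  +-assoc  : ∀ b c d → (b +ᵇ c) +ᵇ d ≈ᵇ b +ᵇ (c +ᵇ d)
  ·-comm   : ∀ b c → b ·ᵇ c ≈ᵇ c ·ᵇ b
  ·-assoc  : ∀ b c d → (b ·ᵇ c) ·ᵇ d ≈ᵇ b ·ᵇ (c ·ᵇ d)
  +-absorb : ∀ b c → b +ᵇ (b ·ᵇ c) ≈ᵇ b
  ·-absorb : ∀ b c → b ·ᵇ (b +ᵇ c) ≈ᵇ b
  +-distˡ  : ∀ b c d → b +ᵇ (c ·ᵇ d) ≈ᵇ (b +ᵇ c) ·ᵇ (b +ᵇ d)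
  ·-distˡ  : ∀ b c d → b ·ᵇ (c +ᵇ d) ≈ᵇ (b ·ᵇ c) +ᵇ (b ·ᵇ d)
  +-compl  : ∀ b → b +ᵇ ¬ᵇ b ≈ᵇ 1ᵇ
  ·-compl  : ∀ b → b ·ᵇ ¬ᵇ b ≈ᵇ 0ᵇ

_≤ᵇ_ : ∀ {k} → BExp k → BExp k → Set
b ≤ᵇ c = b +ᵇ c ≈ᵇ c

freeBooleanAlgebra : ℕ → BooleanAlgebra 0ℓ 0ℓ
freeBooleanAlgebra k = record
  { Carrier = BExp k ; _≈_ = _≈ᵇ_
  ; _∨_ = _+ᵇ_ ; _∧_ = _·ᵇ_ ; ¬_ = ¬ᵇ_ ; ⊤ = 1ᵇ ; ⊥ = 0ᵇ
  ; isBooleanAlgebra = record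
    { isDistributiveLattice = record
      { isLattice = record
        { isEquivalence = record { refl = ≈-refl ; sym = ≈-sym ; trans = ≈-trans }
        ; ∨-comm = +-comm ; ∨-assoc = +-assoc ; ∨-cong = +-cong
        ; ∧-comm = ·-comm ; ∧-assoc = ·-assoc ; ∧-cong = ·-cong
        ; absorptive = +-absorb , ·-absorb
        }
      ; ∨-distrib-∧ = +-distˡ ,
          λ b c d → ≈-trans (+-comm (c ·ᵇ d) b)
            (≈-trans (+-distˡ b c d) (·-cong (+-comm b c) (+-comm b d)))
      ; ∧-distrib-∨ = ·-distˡ ,
          λ b c d → ≈-trans (·-comm (c +ᵇ d) b)
            (≈-trans (·-distˡ b c d) (+-cong (·-comm b c) (·-comm b d)))
      }
    ; ∨-complement = (λ b → ≈-trans (+-comm (¬ᵇ b) b) (+-compl b)) , +-compl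
    ; ∧-complement = (λ b → ≈-trans (·-comm (¬ᵇ b) b) (·-compl b)) , ·-compl
    ; ¬-cong = ¬-cong
    }
  }

IsAtom : ∀ {k} → BExp k → Set
IsAtom a = ¬ (a ≈ᵇ 0ᵇ) × (∀ b → b ≤ᵇ a → b ≈ᵇ 0ᵇ ⊎ b ≈ᵇ a)

-- An atom is represented by its sequence of signs: α stands for the
-- product ⌜ α ⌝ of literals.  By ⌜⌝-isAtom, ⌜⌝-surjective and
-- ⌜⌝-injective below, these products are representatives of the minimal
-- nonzero elements of BExp / ≈ᵇ, one for each.
At : ℕ → Set
At k = Vec Bool k

literal : ∀ {k} → BExp k → Bool → BExp k
literal b true  = b
literal b false = ¬ᵇ b

literals : ∀ {k j} → (Fin j → BExp k) → Vec Bool j → BExp k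
literals f []      = 1ᵇ
literals f (s ∷ α) = literal (f zero) s ·ᵇ literals (f ∘ suc) α

⌜_⌝ : ∀ {k} → At k → BExp k
⌜ α ⌝ = literals prim α

_≟ᵃ_ : ∀ {k} → DecidableEquality (At k)
_≟ᵃ_ = Vec.≡-dec Bool._≟_

atoms : ∀ k → List (At k)
atoms zero    = [] ∷ []
atoms (suc k) = map (true ∷_) (atoms k) ++ map (false ∷_) (atoms k)

module _ {k : ℕ} where
  open BooleanAlgebraProperties (freeBooleanAlgebra k)
    using (∧-zeroʳ; ∧-identityʳ; ∨-identityˡ; ∨-identityʳ; ∧-zeroˡ)
  open BooleanAlgebra (freeBooleanAlgebra k) using (setoid; ∧-distribʳ-∨)
  open SetoidReasoning setoid

  eval : At k → BExp k → Bool
  eval α 0ᵇ       = false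
  eval α 1ᵇ       = true
  eval α (prim i) = lookup α i
  eval α (b ·ᵇ c) = eval α b ∧ eval α c
  eval α (b +ᵇ c) = eval α b ∨ eval α c
  eval α (¬ᵇ b)   = not (eval α b)

  eval-sound : ∀ {b c} → b ≈ᵇ c → ∀ α → eval α b ≡ eval α c
  eval-sound ≈-refl          α = refl
  eval-sound (≈-sym p)       α = sym (eval-sound p α)
  eval-sound (≈-trans p q)   α = trans (eval-sound p α) (eval-sound q α)
  eval-sound (+-cong p q)    α = cong₂ _∨_ (eval-sound p α) (eval-sound q α)
  eval-sound (·-cong p q)    α = cong₂ _∧_ (eval-sound p α) (eval-sound q α)
  eval-sound (¬-cong p)      α = cong not (eval-sound p α)
  eval-sound (+-comm b c)    α = Bool.∨-comm (eval α b) _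
  eval-sound (+-assoc b c d) α = Bool.∨-assoc (eval α b) _ _
  eval-sound (·-comm b c)    α = Bool.∧-comm (eval α b) _
  eval-sound (·-assoc b c d) α = Bool.∧-assoc (eval α b) _ _
  eval-sound (+-absorb b c)  α = Bool.∨-abs-∧ (eval α b) _
  eval-sound (·-absorb b c)  α = Bool.∧-abs-∨ (eval α b) _
  eval-sound (+-distˡ b c d) α = Bool.∨-distribˡ-∧ (eval α b) _ _
  eval-sound (·-distˡ b c d) α = Bool.∧-distribˡ-∨ (eval α b) _ _
  eval-sound (+-compl b)     α = Bool.∨-inverseʳ (eval α b)
  eval-sound (·-compl b)     α = Bool.∧-inverseʳ (eval α b)

  private
    eval-literals : ∀ {j} (f : Fin j → BExp k) (α : At k) (β : Vec Bool j) →
                    (∀ i → eval α (f i) ≡ lookup β i) → eval α (literals f β) ≡ true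
    eval-literals f α []          h = refl
    eval-literals f α (true  ∷ β) h rewrite h zero = eval-literals (f ∘ suc) α β (h ∘ suc)
    eval-literals f α (false ∷ β) h rewrite h zero = eval-literals (f ∘ suc) α β (h ∘ suc)

    eval-literals⁻¹ : ∀ {j} (f : Fin j → BExp k) (α : At k) (β : Vec Bool j) →
                      eval α (literals f β) ≡ true → ∀ i → eval α (f i) ≡ lookup β i
    eval-literals⁻¹ f α (true  ∷ β) h zero with true ← eval α (f zero) = refl
    eval-literals⁻¹ f α (false ∷ β) h zero with false ← eval α (f zero) = refl
    eval-literals⁻¹ f α (true  ∷ β) h (suc i) with true ← eval α (f zero) =
      eval-literals⁻¹ (f ∘ suc) α β h i
    eval-literals⁻¹ f α (false ∷ β) h (suc i) with false ← eval α (f zero) =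
      eval-literals⁻¹ (f ∘ suc) α β h i

    literals-below : ∀ {j} (f : Fin j → BExp k) (β : Vec Bool j) i →
                     literals f β ·ᵇ literal (f i) (lookup β i) ≈ᵇ literals f β
    literals-below f (s ∷ β) zero = begin
      (l ·ᵇ r) ·ᵇ l   ≈⟨ ·-cong (·-comm l r) ≈-refl ⟩
      (r ·ᵇ l) ·ᵇ l   ≈⟨ ·-assoc r l l ⟩
      r ·ᵇ (l ·ᵇ l)   ≈⟨ ·-cong ≈-refl (·-cong ≈-refl (≈-sym (+-absorb l 1ᵇ))) ⟩
      r ·ᵇ (l ·ᵇ (l +ᵇ l ·ᵇ 1ᵇ)) ≈⟨ ·-cong ≈-refl (·-absorb l _) ⟩
      r ·ᵇ l          ≈⟨ ·-comm r l ⟩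
      l ·ᵇ r          ∎
      where l = literal (f zero) s
            r = literals (f ∘ suc) β
    literals-below f (s ∷ β) (suc i) =
      ≈-trans (·-assoc _ _ _) (·-cong ≈-refl (literals-below (f ∘ suc) β i))

    Decides : BExp k → Bool → BExp k → Set
    Decides a true  b = a ·ᵇ b ≈ᵇ a
    Decides a false b = a ·ᵇ b ≈ᵇ 0ᵇ

    decides-¬ : ∀ a v b → Decides a v b → Decides a (not v) (¬ᵇ b)
    decides-¬ a true b h = begin
      a ·ᵇ ¬ᵇ b          ≈⟨ ·-cong (≈-sym h) ≈-refl ⟩
      (a ·ᵇ b) ·ᵇ ¬ᵇ b   ≈⟨ ·-assoc a b _ ⟩
      a ·ᵇ (b ·ᵇ ¬ᵇ b)   ≈⟨ ·-cong ≈-refl (·-compl b) ⟩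
      a ·ᵇ 0ᵇ            ≈⟨ ∧-zeroʳ a ⟩
      0ᵇ                 ∎
    decides-¬ a false b h = begin
      a ·ᵇ ¬ᵇ b              ≈⟨ ∨-identityˡ _ ⟨
      0ᵇ +ᵇ a ·ᵇ ¬ᵇ b        ≈⟨ +-cong (≈-sym h) ≈-refl ⟩
      a ·ᵇ b +ᵇ a ·ᵇ ¬ᵇ b    ≈⟨ ·-distˡ a b _ ⟨
      a ·ᵇ (b +ᵇ ¬ᵇ b)       ≈⟨ ·-cong ≈-refl (+-compl b) ⟩
      a ·ᵇ 1ᵇ                ≈⟨ ∧-identityʳ a ⟩
      a                      ∎

    decides-· : ∀ a v w b c → Decides a v b → Decides a w c → Decides a (v ∧ w) (b ·ᵇ c)
    decides-· a true true b c h g =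
      ≈-trans (≈-sym (·-assoc a b c)) (≈-trans (·-cong h ≈-refl) g)
    decides-· a true false b c h g =
      ≈-trans (≈-sym (·-assoc a b c)) (≈-trans (·-cong h ≈-refl) g)
    decides-· a false w b c h g =
      ≈-trans (≈-sym (·-assoc a b c)) (≈-trans (·-cong h ≈-refl) (∧-zeroˡ c))

    decides-+ : ∀ a v w b c → Decides a v b → Decides a w c → Decides a (v ∨ w) (b +ᵇ c)
    decides-+ a true true b c h g = begin
      a ·ᵇ (b +ᵇ c)      ≈⟨ ·-distˡ a b c ⟩
      a ·ᵇ b +ᵇ a ·ᵇ c   ≈⟨ +-cong h ≈-refl ⟩
      a +ᵇ a ·ᵇ c        ≈⟨ +-absorb a c ⟩
      a                  ∎
    decides-+ a true false b c h g = begin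
      a ·ᵇ (b +ᵇ c)      ≈⟨ ·-distˡ a b c ⟩
      a ·ᵇ b +ᵇ a ·ᵇ c   ≈⟨ +-cong h g ⟩
      a +ᵇ 0ᵇ            ≈⟨ ∨-identityʳ a ⟩
      a                  ∎
    decides-+ a false true b c h g =
      ≈-trans (·-distˡ a b c) (≈-trans (+-cong h g) (∨-identityˡ a))
    decides-+ a false false b c h g =
      ≈-trans (·-distˡ a b c) (≈-trans (+-cong h g) (∨-identityˡ 0ᵇ))

    decides : ∀ α b → Decides ⌜ α ⌝ (eval α b) b
    decides α 0ᵇ       = ∧-zeroʳ _
    decides α 1ᵇ       = ∧-identityʳ _
    decides α (prim i) with lookup α i | literals-below prim α i
    ... | true  | h = h
    ... | false | h = begin
      ⌜ α ⌝ ·ᵇ prim i                    ≈⟨ ·-cong (≈-sym h) ≈-refl ⟩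
      (⌜ α ⌝ ·ᵇ ¬ᵇ prim i) ·ᵇ prim i     ≈⟨ ·-assoc _ _ _ ⟩
      ⌜ α ⌝ ·ᵇ (¬ᵇ prim i ·ᵇ prim i)     ≈⟨ ·-cong ≈-refl (·-comm _ _) ⟩
      ⌜ α ⌝ ·ᵇ (prim i ·ᵇ ¬ᵇ prim i)     ≈⟨ ·-cong ≈-refl (·-compl _) ⟩
      ⌜ α ⌝ ·ᵇ 0ᵇ                        ≈⟨ ∧-zeroʳ _ ⟩
      0ᵇ                                 ∎
    decides α (b ·ᵇ c) = decides-· _ (eval α b) (eval α c) b c (decides α b) (decides α c)
    decides α (b +ᵇ c) = decides-+ _ (eval α b) (eval α c) b c (decides α b) (decides α c)
    decides α (¬ᵇ b)   = decides-¬ _ (eval α b) b (decides α b)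

    eval-⌜⌝ : ∀ α → eval α ⌜ α ⌝ ≡ true
    eval-⌜⌝ α = eval-literals prim α α (λ _ → refl)

    eval-⌜⌝⁻¹ : ∀ {α β} → eval α ⌜ β ⌝ ≡ true → α ≡ β
    eval-⌜⌝⁻¹ {α} {β} h = ext α β (eval-literals⁻¹ prim α β h)
      where
      ext : ∀ {j} (α β : Vec Bool j) → (∀ i → lookup α i ≡ lookup β i) → α ≡ β
      ext []      []      h = refl
      ext (s ∷ α) (r ∷ β) h = cong₂ _∷_ (h zero) (ext α β (h ∘ suc))

    split : ∀ {j} (f : Fin j → BExp k) x →
            (∀ β → literals f β ·ᵇ x ≈ᵇ 0ᵇ) → x ≈ᵇ 0ᵇ
    split {zero} f x h =
      ≈-trans (≈-trans (≈-sym (∧-identityʳ x)) (·-comm x 1ᵇ)) (h [])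
    split {suc j} f x h = begin
      x                                    ≈⟨ ∧-identityʳ x ⟨
      x ·ᵇ 1ᵇ                              ≈⟨ ·-cong ≈-refl (+-compl (f zero)) ⟨
      x ·ᵇ (f zero +ᵇ ¬ᵇ f zero)           ≈⟨ ·-distˡ x _ _ ⟩
      x ·ᵇ f zero +ᵇ x ·ᵇ ¬ᵇ f zero        ≈⟨ +-cong (part true) (part false) ⟩
      0ᵇ +ᵇ 0ᵇ                             ≈⟨ ∨-identityˡ 0ᵇ ⟩
      0ᵇ                                   ∎
      where
      part : ∀ s → x ·ᵇ literal (f zero) s ≈ᵇ 0ᵇ
      part s = split (f ∘ suc) (x ·ᵇ literal (f zero) s) λ β → begin
        literals (f ∘ suc) β ·ᵇ (x ·ᵇ literal (f zero) s)  ≈⟨ ·-cong ≈-refl (·-comm x _) ⟩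
        literals (f ∘ suc) β ·ᵇ (literal (f zero) s ·ᵇ x)  ≈⟨ ·-assoc _ _ x ⟨
        (literals (f ∘ suc) β ·ᵇ literal (f zero) s) ·ᵇ x  ≈⟨ ·-cong (·-comm _ _) ≈-refl ⟩
        (literal (f zero) s ·ᵇ literals (f ∘ suc) β) ·ᵇ x  ≈⟨ h (s ∷ β) ⟩
        0ᵇ                                                 ∎

    find-atom : ∀ j (P : Vec Bool j → Bool) → (∃ λ α → P α ≡ true) ⊎ (∀ α → P α ≡ false)
    find-atom zero P with P [] in eq
    ... | true  = inj₁ ([] , eq)
    ... | false = inj₂ λ { [] → eq }
    find-atom (suc j) P with find-atom j (P ∘ (true ∷_)) | find-atom j (P ∘ (false ∷_))
    ... | inj₁ (α , h) | _            = inj₁ (_ , h)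
    ... | inj₂ _       | inj₁ (α , h) = inj₁ (_ , h)
    ... | inj₂ h       | inj₂ g       = inj₂ λ { (true ∷ α) → h α ; (false ∷ α) → g α }

  infix 4 _≤at_ _≤at?_

  _≤at_ : At k → BExp k → Set
  α ≤at b = ⌜ α ⌝ ≤ᵇ b

  eval⇒≤at : ∀ α b → eval α b ≡ true → α ≤at b
  eval⇒≤at α b h = begin
    ⌜ α ⌝ +ᵇ b            ≈⟨ +-cong (≈-sym (subst (λ v → Decides ⌜ α ⌝ v b) h (decides α b))) ≈-refl ⟩
    ⌜ α ⌝ ·ᵇ b +ᵇ b       ≈⟨ +-comm _ _ ⟩
    b +ᵇ ⌜ α ⌝ ·ᵇ b       ≈⟨ +-cong ≈-refl (·-comm _ _) ⟩
    b +ᵇ b ·ᵇ ⌜ α ⌝       ≈⟨ +-absorb b _ ⟩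
    b                     ∎

  ≤at⇒eval : ∀ α b → α ≤at b → eval α b ≡ true
  ≤at⇒eval α b h = trans (sym (eval-sound h α)) (cong (_∨ eval α b) (eval-⌜⌝ α))

  _≤at?_ : ∀ α b → Dec (α ≤at b)
  α ≤at? b = map′ (eval⇒≤at α b) (≤at⇒eval α b) (eval α b Bool.≟ true)

  ⌜⌝-isAtom : ∀ α → IsAtom ⌜ α ⌝
  ⌜⌝-isAtom α = nonzero , minimal
    where
    nonzero : ¬ (⌜ α ⌝ ≈ᵇ 0ᵇ)
    nonzero h with () ← trans (sym (eval-⌜⌝ α)) (eval-sound h α)

    minimal : ∀ b → b ≤ᵇ ⌜ α ⌝ → b ≈ᵇ 0ᵇ ⊎ b ≈ᵇ ⌜ α ⌝
    minimal b h with eval α b | decides α b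
    ... | v | d = cases v d
      where
      b≈ : b ≈ᵇ ⌜ α ⌝ ·ᵇ b
      b≈ = begin
        b                    ≈⟨ ·-absorb b ⌜ α ⌝ ⟨
        b ·ᵇ (b +ᵇ ⌜ α ⌝)    ≈⟨ ·-cong ≈-refl h ⟩
        b ·ᵇ ⌜ α ⌝           ≈⟨ ·-comm b _ ⟩
        ⌜ α ⌝ ·ᵇ b           ∎
      cases : ∀ v → Decides ⌜ α ⌝ v b → b ≈ᵇ 0ᵇ ⊎ b ≈ᵇ ⌜ α ⌝
      cases true  d = inj₂ (≈-trans b≈ d)
      cases false d = inj₁ (≈-trans b≈ d)

  ⌜⌝-surjective : ∀ a → IsAtom a → ∃[ α ] a ≈ᵇ ⌜ α ⌝
  ⌜⌝-surjective a (nonzero , minimal) with find-atom k (λ α → eval α a)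
  ... | inj₂ h = ⊥-elim (nonzero (split prim a λ α →
                   subst (λ v → Decides ⌜ α ⌝ v a) (h α) (decides α a)))
  ... | inj₁ (α , h) with minimal ⌜ α ⌝ (eval⇒≤at α a h)
  ...   | inj₁ z = ⊥-elim (proj₁ (⌜⌝-isAtom α) z)
  ...   | inj₂ e = α , ≈-sym e

  ⌜⌝-injective : ∀ α β → ⌜ α ⌝ ≈ᵇ ⌜ β ⌝ → α ≡ β
  ⌜⌝-injective α β h = eval-⌜⌝⁻¹ (trans (sym (eval-sound h α)) (eval-⌜⌝ α))

sizeᵇ : ∀ {k} → BExp k → ℕ
sizeᵇ 0ᵇ       = 1
sizeᵇ 1ᵇ       = 1
sizeᵇ (prim i) = 1
sizeᵇ (b ·ᵇ c) = suc (sizeᵇ b + sizeᵇ c)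
sizeᵇ (b +ᵇ c) = suc (sizeᵇ b + sizeᵇ c)
sizeᵇ (¬ᵇ b)   = suc (sizeᵇ b)

------------------------------------------------------------------------

-- Testing two actions for equality is a primitive of the algorithm.
record Actions : Set₁ where
  infix 4 _≟ₚ_
  field
    Act       : Set
    _≟ₚ_      : DecidableEquality Act
    inhabited : Act

module GKAT (𝒜 : Actions) (k : ℕ) where

  open Actions 𝒜

  infixr 8 _·_
  infixr 7 _+[_]_
  infix  9 _^⟨_⟩

  data Exp : Set where
    act    : Act → Exp
    test   : BExp k → Exp
    _·_    : Exp → Exp → Exp
    _+[_]_ : Exp → BExp k → Exp → Exp
    _^⟨_⟩  : Exp → BExp k → Exp

  size : Exp → ℕ
  size (act p)      = 1
  size (test b)     = sizeᵇ b
  size (e · f)      = suc (size e + size f)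
  size (e +[ b ] f) = suc (size e + sizeᵇ b + size f)
  size (e ^⟨ b ⟩)   = suc (size e + sizeᵇ b)

  ----------------------------------------------------------------------
  -- Language model

  data GS : Set where
    atom  : At k → GS
    _,_▷_ : At k → Act → GS → GS

  first : GS → At k
  first (atom α)      = α
  first (α , p ▷ w) = α

  _⋄_ : GS → GS → Maybe GS
  atom α      ⋄ y = if does (α ≟ᵃ first y) then just y else nothing
  (α , p ▷ x) ⋄ y = Maybe.map (α , p ▷_) (x ⋄ y)

  Lang : Set₁
  Lang = Pred GS 0ℓ

  data Atomic (B : Pred (At k) 0ℓ) : Lang where
    atomic : ∀ {α} → B α → Atomic B (atom α)

  infixr 8 _⋄ᴸ_

  _⋄ᴸ_ : Lang → Lang → Lang
  (L ⋄ᴸ K) w = ∃[ x ] ∃[ y ] L x × K y × x ⋄ y ≡ just w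

  power : Lang → ℕ → Lang
  power L zero    = Atomic Unary.U
  power L (suc n) = power L n ⋄ᴸ L

  guardedUnion : Pred (At k) 0ℓ → Lang → Lang → Lang
  guardedUnion B L K = (Atomic B ⋄ᴸ L) ∪ (Atomic (∁ B) ⋄ᴸ K)

  guardedIteration : Pred (At k) 0ℓ → Lang → Lang
  guardedIteration B L = ⋃[ n ∶ ℕ ] (power (Atomic B ⋄ᴸ L) n ⋄ᴸ Atomic (∁ B))

  data AnyAction (p : Act) : Lang where
    anyAction : ∀ α β → AnyAction p (α , p ▷ atom β)

  ⟦_⟧ᵇ : BExp k → Pred (At k) 0ℓ
  ⟦ b ⟧ᵇ α = α ≤at b

  ⟦_⟧ : Exp → Lang
  ⟦ act p ⟧      = AnyAction p
  ⟦ test b ⟧     = Atomic ⟦ b ⟧ᵇ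
  ⟦ e · f ⟧      = ⟦ e ⟧ ⋄ᴸ ⟦ f ⟧
  ⟦ e +[ b ] f ⟧ = guardedUnion ⟦ b ⟧ᵇ ⟦ e ⟧ ⟦ f ⟧
  ⟦ e ^⟨ b ⟩ ⟧   = guardedIteration ⟦ b ⟧ᵇ ⟦ e ⟧

  ----------------------------------------------------------------------
  -- Automata

  Out : Set → Set
  Out X = Bool ⊎ (Act × X)

  pattern accept   = inj₁ true
  pattern reject   = inj₁ false
  pattern step p x = inj₂ (p , x)

  mapOut : ∀ {X Y : Set} → (X → Y) → Out X → Out Y
  mapOut f = Sum.map₂ (map₂ f)

  G : Set → Set
  G X = At k → Out X

  record Coalgebra : Set₁ where
    constructor coalgebra
    field
      State : Set
      δ     : State → G State

  open Coalgebra

  module _ {X : Set} where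
    uniformContinuation : (X → G X) → (X → Bool) → G X → (X → G X)
    uniformContinuation d Y h x α with Y x | d x α
    ... | true  | accept = h α
    ... | true  | o      = o
    ... | false | o      = o

  _⊞_ : ∀ {X Y : Set} → (X → G X) → (Y → G Y) → (X ⊎ Y → G (X ⊎ Y))
  (d₁ ⊞ d₂) (inj₁ x) α = mapOut inj₁ (d₁ x α)
  (d₁ ⊞ d₂) (inj₂ y) α = mapOut inj₂ (d₂ y α)

  _⊕_ : Coalgebra → Coalgebra → Coalgebra
  𝒳 ⊕ 𝒴 = coalgebra (State 𝒳 ⊎ State 𝒴) (δ 𝒳 ⊞ δ 𝒴)

  ----------------------------------------------------------------------
  -- Thompson construction

  States : Exp → Set
  States (act p)      = ⊤
  States (test b)     = ⊥
  States (e · f)      = States e ⊎ States f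
  States (e +[ b ] f) = States e ⊎ States f
  States (e ^⟨ b ⟩)   = States e

  -- the sequential and looping clauses for initial pseudostates
  _orElse_ : ∀ {X : Set} → Out X → Out X → Out X
  accept orElse o′ = o′
  o      orElse o′ = o

  initial : (e : Exp) → G (States e)
  initial (act p)      α = step p tt
  initial (test b)     α = inj₁ (does (α ≤at? b))
  initial (e · f)      α = mapOut inj₁ (initial e α) orElse mapOut inj₂ (initial f α)
  initial (e +[ b ] f) α = if does (α ≤at? b) then mapOut inj₁ (initial e α)
                                              else mapOut inj₂ (initial f α)
  initial (e ^⟨ b ⟩)   α = if does (α ≤at? b) then initial e α orElse reject
                                              else accept

  transition : (e : Exp) → States e → G (States e)
  transition (act p)      = λ _ _ → accept
  transition (test b)     = λ ()
  transition (e · f)      = uniformContinuation (transition e ⊞ transition f)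
                              [ const true , const false ]′ (mapOut inj₂ ∘ initial f)
  transition (e +[ b ] f) = transition e ⊞ transition f
  transition (e ^⟨ b ⟩)   = uniformContinuation (transition e) (const true) (initial (e ^⟨ b ⟩))

  pattern ι   = inj₁ tt
  pattern ⟪_⟫ x = inj₂ x

  Thompson : Exp → Coalgebra
  Thompson e = coalgebra (⊤ ⊎ States e) λ where
    ι       α → mapOut inj₂ (initial e α)
    ⟪ x ⟫   α → mapOut inj₂ (transition e x α)

  ----------------------------------------------------------------------
  -- Normalization and bisimilarity

  module _ (𝒳 : Coalgebra) where
    Accepting : Pred (State 𝒳) 0ℓ
    Accepting s = ∃[ α ] δ 𝒳 s α ≡ accept

    Edge : Rel (State 𝒳) 0ℓ
    Edge s t = ∃[ α ] ∃[ p ] δ 𝒳 s α ≡ step p t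

    Live : Pred (State 𝒳) 0ℓ
    Live s = ∃[ t ] Star Edge s t × Accepting t

    normalization : Unary.Decidable Live → Coalgebra
    normalization live? = coalgebra (State 𝒳) λ s α → prune (δ 𝒳 s α)
      where
      prune : Out (State 𝒳) → Out (State 𝒳)
      prune (inj₁ v)   = inj₁ v
      prune (step p t) = if does (live? t) then step p t else reject

  record IsBisimulation (𝒳 𝒴 : Coalgebra) (R : State 𝒳 → State 𝒴 → Set) : Set where
    field
      output : ∀ {x y} → R x y → ∀ α {v} →
               δ 𝒳 x α ≡ inj₁ v → δ 𝒴 y α ≡ inj₁ v
      next   : ∀ {x y} → R x y → ∀ α {p x′} →
               δ 𝒳 x α ≡ step p x′ → ∃[ y′ ] δ 𝒴 y α ≡ step p y′ × R x′ y′

  Bisimilar : (𝒳 𝒴 : Coalgebra) → State 𝒳 → State 𝒴 → Set₁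
  Bisimilar 𝒳 𝒴 x y =
    Σ (State 𝒳 → State 𝒴 → Set) λ R → IsBisimulation 𝒳 𝒴 R × R x y

  ----------------------------------------------------------------------
  -- Machine model: programs over a random-access store.
  --
  -- The store consists of finitely many arrays (one transition array per
  -- atom) indexed by numbers.  The running time of a program is the number
  -- of executed returns, reads, writes and loop iterations.  What the
  -- programs below compute between two commands is a bounded number of
  -- constructor applications, case distinctions, successors and
  -- comparisons of numbers or of actions, and lookups in an atom, which is
  -- O(1) for |At| constant.  All recursion (over expressions, lists or
  -- numbers) produces commands, so that every recursive call is charged.
  -- Input expressions are syntax trees, inspected one node at a time;
  -- lists and bags in memory are pointers to immutable nodes.

  data Array : Set where
    trans-at : At k → Array
    live preds work queue parent rank : Array

  Value : Array → Set
  Value (trans-at α) = Out ℕ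
  Value live         = Bool
  Value preds        = List ℕ
  Value work         = List ℕ
  Value queue        = ℕ × ℕ
  Value parent       = ℕ
  Value rank         = ℕ

  private
    code : Array → ℕ × Maybe (At k)
    code (trans-at α) = 0 , just α
    code live         = 1 , nothing
    code preds        = 2 , nothing
    code work         = 3 , nothing
    code queue        = 4 , nothing
    code parent       = 5 , nothing
    code rank         = 6 , nothing

    code-injective : ∀ a b → code a ≡ code b → a ≡ b
    code-injective (trans-at α) (trans-at .α) refl = refl
    code-injective live   live   refl = refl
    code-injective preds  preds  refl = refl
    code-injective work   work   refl = refl
    code-injective queue  queue  refl = refl
    code-injective parent parent refl = refl
    code-injective rank   rank   refl = refl

  _≟ₐ_ : DecidableEquality Array
  a ≟ₐ b = map′ (code-injective a b) (cong code) (code a ≟′ code b)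
    where
    open import Data.Product.Properties using (≡-dec)
    import Data.Maybe.Properties as MaybeP
    _≟′_ = ≡-dec _≟_ (MaybeP.≡-dec _≟ᵃ_)

  Store : Set
  Store = (a : Array) → ℕ → Value a

  _[_at_]≔_ : Store → (a : Array) → ℕ → Value a → Store
  (σ [ a at i ]≔ v) b j with a ≟ₐ b
  ... | yes refl = if i ≡ᵇ j then v else σ a j
  ... | no  _    = σ b j

  infixl 1 _>>=_ _>>_

  data Prog : Set → Set₁ where
    return : ∀ {A} → A → Prog A
    _>>=_  : ∀ {A B} → Prog A → (A → Prog B) → Prog B
    read   : (a : Array) → ℕ → Prog (Value a)
    write  : (a : Array) → ℕ → Value a → Prog ⊤
    -- repeat the body on successive results inj₁ until it yields inj₂
    loop   : ∀ {A B} → (A → Prog (A ⊎ B)) → A → Prog B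

  _>>_ : ∀ {A B} → Prog A → Prog B → Prog B
  c >> d = c >>= λ _ → d

  infix 3 ⟨_,_⟩⇓⟨_,_⟩_

  -- ⟨ c , σ ⟩⇓⟨ v , σ′ ⟩ t : program c, started in store σ, terminates with
  -- value v in store σ′ after t steps
  data ⟨_,_⟩⇓⟨_,_⟩_ : ∀ {A} → Prog A → Store → A → Store → ℕ → Set₁ where
    ⇓return : ∀ {A σ} {v : A} → ⟨ return v , σ ⟩⇓⟨ v , σ ⟩ 1
    ⇓bind   : ∀ {A B σ σ′ σ″ v w t u} {c : Prog A} {f : A → Prog B} →
              ⟨ c , σ ⟩⇓⟨ v , σ′ ⟩ t → ⟨ f v , σ′ ⟩⇓⟨ w , σ″ ⟩ u →
              ⟨ c >>= f , σ ⟩⇓⟨ w , σ″ ⟩ (t + u)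
    ⇓read   : ∀ {a i σ} → ⟨ read a i , σ ⟩⇓⟨ σ a i , σ ⟩ 1
    ⇓write  : ∀ {a i v σ} → ⟨ write a i v , σ ⟩⇓⟨ tt , σ [ a at i ]≔ v ⟩ 1
    ⇓exit   : ∀ {A B σ σ′ x v t} {f : A → Prog (A ⊎ B)} →
              ⟨ f x , σ ⟩⇓⟨ inj₂ v , σ′ ⟩ t → ⟨ loop f x , σ ⟩⇓⟨ v , σ′ ⟩ suc t
    ⇓again  : ∀ {A B σ σ′ σ″ x y v t u} {f : A → Prog (A ⊎ B)} →
              ⟨ f x , σ ⟩⇓⟨ inj₁ y , σ′ ⟩ t → ⟨ loop f y , σ′ ⟩⇓⟨ v , σ″ ⟩ u →
              ⟨ loop f x , σ ⟩⇓⟨ v , σ″ ⟩ suc (t + u)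

  ⇓-deterministic : ∀ {A} {c : Prog A} {σ σ₁ σ₂ v₁ v₂ t₁ t₂} →
                    ⟨ c , σ ⟩⇓⟨ v₁ , σ₁ ⟩ t₁ → ⟨ c , σ ⟩⇓⟨ v₂ , σ₂ ⟩ t₂ →
                    (v₁ , σ₁ , t₁) ≡ (v₂ , σ₂ , t₂)
  ⇓-deterministic ⇓return ⇓return = refl
  ⇓-deterministic (⇓bind p q) (⇓bind p′ q′) with ⇓-deterministic p p′
  ... | refl with ⇓-deterministic q q′
  ...   | refl = refl
  ⇓-deterministic ⇓read ⇓read = refl
  ⇓-deterministic ⇓write ⇓write = refl
  ⇓-deterministic (⇓exit p) (⇓exit p′) with ⇓-deterministic p p′
  ... | refl = refl
  ⇓-deterministic (⇓exit p) (⇓again p′ q′) with ⇓-deterministic p p′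
  ... | ()
  ⇓-deterministic (⇓again p q) (⇓exit p′) with ⇓-deterministic p p′
  ... | ()
  ⇓-deterministic (⇓again p q) (⇓again p′ q′) with ⇓-deterministic p p′
  ... | refl with ⇓-deterministic q q′
  ...   | refl = refl

  forEach : ∀ {A : Set} → List A → (A → Prog ⊤) → Prog ⊤
  forEach []       f = return tt
  forEach (x ∷ xs) f = f x >> forEach xs f

  forAtoms : (At k → Prog ⊤) → Prog ⊤
  forAtoms = forEach (atoms k)

  forBelow : ℕ → (ℕ → Prog ⊤) → Prog ⊤
  forBelow zero    f = return tt
  forBelow (suc n) f = f n >> forBelow n f

  ----------------------------------------------------------------------
  -- Step 1: Thompson construction.  States are numbers.  The construction
  -- is pointwise in the atom, so it is run for one atom α at a time.

  evaluate : At k → BExp k → Prog Bool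
  evaluate α 0ᵇ       = return false
  evaluate α 1ᵇ       = return true
  evaluate α (prim i) = return (lookup α i)
  evaluate α (b ·ᵇ c) = do
    v ← evaluate α b
    w ← evaluate α c
    return (v ∧ w)
  evaluate α (b +ᵇ c) = do
    v ← evaluate α b
    w ← evaluate α c
    return (v ∨ w)
  evaluate α (¬ᵇ b) = do
    v ← evaluate α b
    return (not v)

  -- finite collections of states with constant-time union
  data Bag : Set where
    ∅    : Bag
    ⟨_⟩  : ℕ → Bag
    _⊍_  : Bag → Bag → Bag

  redirect : At k → Bag → Out ℕ → Prog ⊤
  redirect α ∅       o = return tt
  redirect α ⟨ x ⟩   o = write (trans-at α) x o
  redirect α (E ⊍ F) o = redirect α E o >> redirect α F o

  -- The uniform continuation at α, given the states E that accept at α and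
  -- the value o of the continuation at α; returns the states that accept
  -- at α afterwards.  If o is accept, nothing changes.
  continue : At k → Bag → Out ℕ → Prog Bag
  continue α E accept = return E
  continue α E o      = redirect α E o >> return ∅

  -- Writes the transitions at α of the states of e, numbered from x on, and
  -- returns the value of the initial pseudostate at α, the states that
  -- accept at α, and the first number not used.
  build : At k → Exp → ℕ → Prog (Out ℕ × Bag × ℕ)
  build α (act p) x = do
    write (trans-at α) x accept
    return (step p x , ⟨ x ⟩ , suc x)
  build α (test b) x = do
    v ← evaluate α b
    return (inj₁ v , ∅ , x)
  build α (e · f) x = do
    (i , E , y) ← build α e x
    (j , F , z) ← build α f y
    E′ ← continue α E j
    return (i orElse j , E′ ⊍ F , z)
  build α (e +[ b ] f) x = do
    (i , E , y) ← build α e x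
    (j , F , z) ← build α f y
    v ← evaluate α b
    return ((if v then i else j) , E ⊍ F , z)
  build α (e ^⟨ b ⟩) x = do
    (i , E , y) ← build α e x
    v ← evaluate α b
    let j = if v then i orElse reject else accept
    E′ ← continue α E j
    return (j , E′ , y)

  -- start state s, followed by the states of e; returns the first number
  -- not used
  buildAutomaton : Exp → ℕ → Prog ℕ
  buildAutomaton e s = go (atoms k) (suc s)
    where
    go : List (At k) → ℕ → Prog ℕ
    go []       y = return y
    go (α ∷ αs) _ = do
      (i , _ , y) ← build α e (suc s)
      write (trans-at α) s i
      go αs y

  -- returns the two start states and the total number of states
  thompson : Exp → Exp → Prog (ℕ × ℕ × ℕ)
  thompson e₁ e₂ = do
    s ← buildAutomaton e₁ 0
    N ← buildAutomaton e₂ s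
    return (0 , s , N)

  ----------------------------------------------------------------------
  -- Step 2: normalization, by backward search from the accepting states

  mark : ℕ → Prog ⊤
  mark x = do
    l ← read live x
    if l then return tt else do
      write live x true
      w ← read work 0
      write work 0 (x ∷ w)

  scan : ℕ → Out ℕ → Prog ⊤
  scan x reject     = return tt
  scan x accept     = mark x
  scan x (step p y) = do
    xs ← read preds y
    write preds y (x ∷ xs)

  propagate : Prog ⊤
  propagate = loop body tt
    where
    body : ⊤ → Prog (⊤ ⊎ ⊤)
    body _ = read work 0 >>= λ where
      []      → return (inj₂ tt)
      (y ∷ w) → do
        write work 0 w
        xs ← read preds y
        forEach xs mark
        return (inj₁ tt)

  cut : At k → ℕ → Out ℕ → Prog ⊤
  cut α x (inj₁ _)   = return tt
  cut α x (step p y) = do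
    l ← read live y
    if l then return tt else write (trans-at α) x reject

  normalize : ℕ → Prog ⊤
  normalize N = do
    write work 0 []
    forBelow N λ x → do
      write live x false
      write preds x []
    forBelow N λ x → forAtoms λ α → read (trans-at α) x >>= scan x
    propagate
    forBelow N λ x → forAtoms λ α → read (trans-at α) x >>= cut α x

  ----------------------------------------------------------------------
  -- Step 3: the Hopcroft–Karp algorithm, using a union-find forest with
  -- union by rank and path compression

  find : ℕ → Prog ℕ
  find x = do
    r ← loop climb x
    loop (compress r) x
    return r
    where
    climb : ℕ → Prog (ℕ ⊎ ℕ)
    climb z = do
      y ← read parent z
      return (if y ≡ᵇ z then inj₂ z else inj₁ y)
    compress : ℕ → ℕ → Prog (ℕ ⊎ ⊤)
    compress r z = if z ≡ᵇ r then return (inj₂ tt) else do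
      y ← read parent z
      write parent z r
      return (inj₁ y)

  -- the arguments are distinct roots
  link : ℕ → ℕ → Prog ⊤
  link r s = do
    i ← read rank r
    j ← read rank s
    attach i j (ℕ.<-cmp i j)
    where
    attach : ∀ i j → _ → Prog ⊤
    attach i j (tri< _ _ _) = write parent r s
    attach i j (tri> _ _ _) = write parent s r
    attach i j (tri≈ _ _ _) = write parent r s >> write rank s (suc j)

  -- The queue is the segment of the queue array from the position head up
  -- to, but excluding, the position tail.  compare returns the new tail, or
  -- nothing if x and y differ at some atom.
  compare : List (At k) → (x y tail : ℕ) → Prog (Maybe ℕ)
  compare []       x y tail = return (just tail)
  compare (α ∷ αs) x y tail = do
    o ← read (trans-at α) x
    o′ ← read (trans-at α) y
    match o o′
    where
    match : Out ℕ → Out ℕ → Prog (Maybe ℕ)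
    match (inj₁ v) (inj₁ w) =
      if does (v Bool.≟ w) then compare αs x y tail else return nothing
    match (step p x′) (step q y′) =
      if does (p ≟ₚ q)
        then (write queue tail (x′ , y′) >> compare αs x y (suc tail))
        else return nothing
    match _ _ = return nothing

  hopcroftKarp : (s₁ s₂ N : ℕ) → Prog Bool
  hopcroftKarp s₁ s₂ N = do
    forBelow N λ x → do
      write parent x x
      write rank x 0
    write queue 0 (s₁ , s₂)
    loop body (0 , 1)
    where
    body : ℕ × ℕ → Prog ((ℕ × ℕ) ⊎ Bool)
    body (head , tail) = if head ≡ᵇ tail then return (inj₂ true) else do
      (x , y) ← read queue head
      r ← find x
      s ← find y
      if r ≡ᵇ s then return (inj₁ (suc head , tail)) else
        (compare (atoms k) x y tail >>= λ where
          nothing      → return (inj₂ false)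
          (just tail′) → do
            link r s
            return (inj₁ (suc head , tail′)))

  decide : Exp → Exp → Prog Bool
  decide e₁ e₂ = do
    (s₁ , s₂ , N) ← thompson e₁ e₂
    normalize N
    hopcroftKarp s₁ s₂ N

  -- the transition arrays hold the structure of 𝒳, with states numbered by
  -- num
  Stores : Store → (𝒳 : Coalgebra) {N : ℕ} → State 𝒳 ↔ Fin N → Set
  Stores σ 𝒳 num = ∀ x α → σ (trans-at α) (number x) ≡ mapOut number (δ 𝒳 x α)
    where
    number : State 𝒳 → ℕ
    number = toℕ ∘ Inverse.to num

  -- A run of decide on e₁ and e₂, with its intermediate results.  By
  -- ⇓-deterministic there is at most one result and one time.
  record Execution (e₁ e₂ : Exp) (σ₀ : Store) : Set₁ where
    𝒳₁ = Thompson e₁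
    𝒳₂ = Thompson e₂
    field
      live₁?      : Unary.Decidable (Live 𝒳₁)
      live₂?      : Unary.Decidable (Live 𝒳₂)
    𝒳̂₁ = normalization 𝒳₁ live₁?
    𝒳̂₂ = normalization 𝒳₂ live₂?
    field
      N           : ℕ
      num         : (State 𝒳₁ ⊎ State 𝒳₂) ↔ Fin N
    s₁ = toℕ (Inverse.to num (inj₁ ι))
    s₂ = toℕ (Inverse.to num (inj₂ ι))
    field
      σ₁ σ₂ σ₃    : Store
      t₁ t₂ t₃    : ℕ
      time        : ℕ
      result      : Bool
      step₁       : ⟨ thompson e₁ e₂ , σ₀ ⟩⇓⟨ (s₁ , s₂ , N) , σ₁ ⟩ t₁
      thompson-ok : Stores σ₁ (𝒳₁ ⊕ 𝒳₂) num
      step₂       : ⟨ normalize N , σ₁ ⟩⇓⟨ tt , σ₂ ⟩ t₂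
      normal-ok   : Stores σ₂ (𝒳̂₁ ⊕ 𝒳̂₂) num
      step₃       : ⟨ hopcroftKarp s₁ s₂ N , σ₂ ⟩⇓⟨ result , σ₃ ⟩ t₃
      bisim-ok    : result ≡ true ⇔ Bisimilar 𝒳̂₁ 𝒳̂₂ ι ι
      decide-runs : ⟨ decide e₁ e₂ , σ₀ ⟩⇓⟨ result , σ₃ ⟩ time

{-# OPTIONS --safe #-}
module Submission where

-- Correctness.  The Thompson automaton of e accepts ⟦ e ⟧ from its start state,
-- and normalization changes no language.  In a normalized automaton every
-- transition leads to a state that accepts some word, so "the two states accept
-- the same words" is a bisimulation; hence the start states are bisimilar if and
-- only if the languages agree.  If Hopcroft–Karp returns true, the classes of the
-- forest are closed under matching transitions and so form a bisimulation; every
-- pair it enqueues lies in every bisimulation that relates the start states, so a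
-- mismatch refutes bisimilarity.
--
-- Time.  Everything but union-find is linear.  In the Thompson construction a
-- state leaves the bag of accepting states when it is redirected.  In the
-- backward search every state enters the work list at most once and pays for its
-- predecessors when it leaves.  There are at most N unions, hence at most
-- 1 + N |At| pairs are enqueued, and Tarjan's potential bounds the amortized cost
-- of each find and each union by O(α(n)).

open import Defs
open import Data.Bool using (Bool; true; false; if_then_else_; T)
import Data.Bool.Properties as Bool
open import Data.Empty using (⊥; ⊥-elim)
open import Data.Fin using (Fin; toℕ; fromℕ<)
import Data.Fin.Properties as Fin
open import Data.List using (List; []; _∷_; map; length)
open import Data.Nat.ListAction using (sum)
open import Data.List.Membership.Propositional using (_∈_)
import Data.List.Membership.Propositional.Properties as ∈
open import Data.List.Relation.Unary.Any using (here; there)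
open import Data.Maybe using (Maybe; just; nothing)
open import Data.Nat using (ℕ; zero; suc; _+_; _*_; _≤_; _<_; z≤n; s≤s; _≟_; _≤?_; _≡ᵇ_)
import Data.Nat.Properties as ℕ
open import Data.Nat.GeneralisedArithmetic using (iterate)
open import Data.Nat.Tactic.RingSolver using (solve-∀; solve)
open import Data.Product using (∃-syntax; Σ-syntax; _×_; _,_; proj₁; proj₂)
open import Data.Sum using (_⊎_; inj₁; inj₂; [_,_]′)
open import Data.Sum.Properties using (inj₁-injective)
import Data.Vec as Vec
open import Data.Unit using (⊤; tt)
open import Data.Sum.Function.Propositional using (_⊎-↔_)
open import Function using (_∘_; const; id; _↔_; _⇔_; mk⇔; Inverse; Equivalence)
open import Function.Construct.Composition using (_↔-∘_)
open import Function.Construct.Symmetry using (↔-sym)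
open import Level using (Level; 0ℓ; _⊔_; Lift; lift)
open import Relation.Binary using (tri<; tri≈; tri>; IsEquivalence)
open import Relation.Binary.Construct.Closure.ReflexiveTransitive using (Star; ε; _◅_)
open import Relation.Binary.PropositionalEquality
  using (_≡_; _≢_; refl; sym; trans; cong; cong₂; subst; subst₂)
open import Relation.Nullary using (¬_; Dec; yes; no; does)
open import Relation.Nullary.Decidable using (map′; dec-true; dec-false; _⊎-dec_; toSum)
open import Relation.Unary using (Decidable; _≐_; ∁)

-- Nothing in the programs bounds their loops, so each loop is run against a measure: for a walk up
-- the forest the rank that is still missing, for the backward search the weight of all states that
-- are queued or unmarked, for Hopcroft-Karp the number of queue positions that can still be
-- reached. Every run is constructed together with a postcondition that also speaks of its time.
--
-- The amortized analysis of union-find needs the ranks, shifted by one, to stay below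
-- `ackermann a 1`. A rank never exceeds the number of unions made so far, and each union uses up a
-- root, so ranks are at most `N` and `a` exceeds `inverseAckermann n` only by a constant.
--
-- `Execution` asks for deciders of liveness. They come out of the run itself: the array left behind
-- by the backward search, once proved correct, decides liveness in both automata.

-- Linear arithmetic: the equation is left to the ring solver, and d is the slack.
by-sum : ∀ {a b l r} d → l ≤ r → a + r + d ≡ b + l → a ≤ b
by-sum {a} {b} {l} {r} d l≤r eq = ℕ.+-cancelʳ-≤ l a b
  (ℕ.≤-trans (ℕ.+-monoʳ-≤ a l≤r) (ℕ.≤-trans (ℕ.m≤m+n (a + r) d) (ℕ.≤-reflexive eq)))

≡ᵇ-yes : ∀ {m n} → m ≡ n → (m ≡ᵇ n) ≡ true
≡ᵇ-yes {m} {n} = dec-true (m ≟ n)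

≡ᵇ-no : ∀ {m n} → m ≢ n → (m ≡ᵇ n) ≡ false
≡ᵇ-no {m} {n} = dec-false (m ≟ n)

scale : ∀ n {a b} → a ≤ b → n * a ≤ n * b
scale n = ℕ.*-monoʳ-≤ n

-- Sums over initial segments

∑ : ℕ → (ℕ → ℕ) → ℕ
∑ zero    f = 0
∑ (suc n) f = f n + ∑ n f

∑-mono : ∀ n {f g} → (∀ i → i < n → f i ≤ g i) → ∑ n f ≤ ∑ n g
∑-mono zero    h = z≤n
∑-mono (suc n) h = ℕ.+-mono-≤ (h n ℕ.≤-refl) (∑-mono n λ i p → h i (ℕ.m≤n⇒m≤1+n p))

∑-cong : ∀ n {f g} → (∀ i → i < n → f i ≡ g i) → ∑ n f ≡ ∑ n g
∑-cong n h = ℕ.≤-antisym (∑-mono n λ i p → ℕ.≤-reflexive (h i p))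
                         (∑-mono n λ i p → ℕ.≤-reflexive (sym (h i p)))

∑-const : ∀ n c → ∑ n (λ _ → c) ≡ n * c
∑-const zero    c = refl
∑-const (suc n) c = cong (c +_) (∑-const n c)

private
  swap-middle : ∀ a b c → (a + b) + c ≡ (a + c) + b
  swap-middle = solve-∀

-- An amortized step changes one cell, so a comparison at `j` carries over to the sum as long as the
-- other cells do not grow. The slacks `d` and `e` on the two sides stand in for subtraction.
∑-update : ∀ n {f g} j {d e} → j < n → (∀ i → i < n → i ≢ j → f i ≤ g i) →
           f j + d ≤ g j + e → ∑ n f + d ≤ ∑ n g + e
∑-update (suc n) {f} {g} j {d} {e} j<n h hj with n ≟ j
... | yes refl = ℕ.≤-trans (ℕ.≤-reflexive (swap-middle (f n) (∑ n f) d))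
    (ℕ.≤-trans (ℕ.+-mono-≤ hj (∑-mono n λ i p → h i (ℕ.m≤n⇒m≤1+n p) (ℕ.<⇒≢ p)))
      (ℕ.≤-reflexive (swap-middle (g n) e (∑ n g))))
... | no n≢j = ℕ.≤-trans (ℕ.≤-reflexive (ℕ.+-assoc (f n) (∑ n f) d))
    (ℕ.≤-trans (ℕ.+-mono-≤ (h n ℕ.≤-refl n≢j)
        (∑-update n j (ℕ.≤∧≢⇒< (ℕ.≤-pred j<n) (n≢j ∘ sym)) (λ i p → h i (ℕ.m≤n⇒m≤1+n p)) hj))
      (ℕ.≤-reflexive (sym (ℕ.+-assoc (g n) (∑ n g) e))))

-- The Ackermann function

private
  iterate-mono : ∀ (f : ℕ → ℕ) → (∀ {i j} → i ≤ j → f i ≤ f j) → (∀ j → j < f j) →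
                 ∀ {m n i j} → m ≤ n → i ≤ j → iterate f i m ≤ iterate f j n
  iterate-mono f mono infl {n = zero}  z≤n i≤j = i≤j
  iterate-mono f mono infl {n = suc n} z≤n i≤j =
    iterate-mono f mono infl {n = n} z≤n (ℕ.≤-trans i≤j (ℕ.<⇒≤ (infl _)))
  iterate-mono f mono infl (s≤s m≤n) i≤j = iterate-mono f mono infl m≤n (mono i≤j)

ackermann-mono : ∀ k {i j} → i ≤ j → ackermann k i ≤ ackermann k j
ackermann-inflationary : ∀ k j → j < ackermann k j

ackermann-mono zero    i≤j = s≤s i≤j
ackermann-mono (suc k) i≤j =
  iterate-mono (ackermann k) (ackermann-mono k) (ackermann-inflationary k) (s≤s i≤j) i≤j

ackermann-inflationary zero    j = ℕ.≤-refl
ackermann-inflationary (suc k) j = ℕ.≤-trans (ackermann-inflationary k j)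
  (iterate-mono (ackermann k) (ackermann-mono k) (ackermann-inflationary k) {n = j} z≤n ℕ.≤-refl)

ackermann-suc : ∀ k → ackermann k 1 < ackermann (suc k) 1
ackermann-suc k = ackermann-inflationary k (ackermann k 1)

iterate-suc : ∀ (f : ℕ → ℕ) x n → iterate f x (suc n) ≡ f (iterate f x n)
iterate-suc f x zero    = refl
iterate-suc f x (suc n) = iterate-suc f (f x) n

-- Tarjan's potential function

above : ℕ → ℕ → ℕ
above x q with x ≤? q
... | yes _ = 0
... | no  _ = 1

above-yes : ∀ {x q} → x ≤ q → above x q ≡ 0
above-yes {x} {q} h with x ≤? q
... | yes _ = refl
... | no ¬h = ⊥-elim (¬h h)

above-no : ∀ {x q} → ¬ x ≤ q → above x q ≡ 1
above-no {x} {q} ¬h with x ≤? q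
... | yes h = ⊥-elim (¬h h)
... | no _  = refl

above≤1 : ∀ x q → above x q ≤ 1
above≤1 x q with x ≤? q
... | yes _ = z≤n
... | no _  = ℕ.≤-refl

above-mono : ∀ {x x′ q q′} → x ≤ x′ → q′ ≤ q → above x q ≤ above x′ q′
above-mono {x} {x′} {q} {q′} h h′ with x ≤? q
... | yes _ = z≤n
... | no ¬p = ℕ.≤-reflexive (sym (above-no λ p → ¬p (ℕ.≤-trans h (ℕ.≤-trans p h′))))

-- The potential of Tarjan's analysis for a node of rank r whose parent has rank
-- q, usually written (a − level) · r − iter.  Defined by counting, it is plainly
-- antitone in q.  Ranks are shifted to start at 1, so no case for rank 0 arises.
φ : ℕ → ℕ → ℕ → ℕ
φ a r q = ∑ a λ k → ∑ r λ i → above (iterate (ackermann k) r (suc i)) q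

-- Complementary to Tarjan's level, but measured against the rank `R` of the root instead of that of
-- the parent; all nodes of one path share `R`, which is why differences of this quantity telescope.
coLevel : ℕ → ℕ → ℕ → ℕ
coLevel a q R = ∑ a λ k → above (ackermann k q) R

-- A root holds the potential `a * r`, so this makes becoming a child free of charge for the node
-- itself.
φ-bound : ∀ a r q → φ a r q ≤ a * r
φ-bound a r q = ℕ.≤-trans
  (∑-mono a λ k _ → ℕ.≤-trans (∑-mono r λ i _ → above≤1 (iterate (ackermann k) r (suc i)) q)
                              (ℕ.≤-reflexive (trans (∑-const r 1) (ℕ.*-identityʳ r))))
  (ℕ.≤-reflexive (∑-const a r))

-- The rank of a node's parent only grows, both when a path is compressed and when a root's rank is
-- raised; hence neither raises the potential of a non-root.
φ-antitone : ∀ a r {q R} → q ≤ R → φ a r R ≤ φ a r q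
φ-antitone a r {q} {R} q≤R =
  ∑-mono a λ k _ → ∑-mono r λ i _ →
    above-mono {iterate (ackermann k) r (suc i)} ℕ.≤-refl q≤R

coLevel-bound : ∀ a q R → coLevel a q R ≤ a
coLevel-bound a q R = ℕ.≤-trans (∑-mono a λ k _ → above≤1 (ackermann k q) R)
  (ℕ.≤-reflexive (trans (∑-const a 1) (ℕ.*-identityʳ a)))

coLevel-mono : ∀ a {r q} R → r ≤ q → coLevel a r R ≤ coLevel a q R
coLevel-mono a R r≤q = ∑-mono a λ k _ → above-mono (ackermann-mono k r≤q) ℕ.≤-refl

-- A discrete intermediate value theorem. In `φ-step` it finds Tarjan's level and then his iteration
-- index.
switch : ∀ {P : ℕ → Set} → Decidable P → ∀ n → P 0 → ¬ P n → ∃[ k ] k < n × P k × ¬ P (suc k)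
switch P? zero    p ¬p = ⊥-elim (¬p p)
switch P? (suc n) p ¬p with P? n
... | yes q = n , ℕ.≤-refl , q , ¬p
... | no ¬q with switch P? n p ¬q
...   | k , k<n , h = k , ℕ.m≤n⇒m≤1+n k<n , h

private
  drop : ∀ {x q R} → ¬ x ≤ q → x ≤ R → above x R + 1 ≤ above x q + 0
  drop ¬p p = ℕ.≤-reflexive
    (trans (cong (_+ 1) (above-yes p)) (sym (trans (ℕ.+-identityʳ _) (above-no ¬p))))

-- A node of rank r, with parent of rank q and root of rank R, pays for its visit:
-- either its potential drops when it is attached to the root, or fewer of the
-- functions A_k stay below R at q than at r.  Along a path the second quantity
-- telescopes.
φ-step : ∀ a {r q R} → 1 ≤ r → r < q → q ≤ R → R < ackermann a 1 →
         φ a r R + 1 + coLevel a r R ≤ φ a r q + coLevel a q R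
φ-step a {r} {q} {R} 1≤r r<q q≤R R<A
  -- The level: at `k = 0` the condition is `r < q`, and at `a` it fails because `ackermann a r`
  -- already exceeds `R`, by `1 ≤ r`.
  with switch (λ k → ackermann k r ≤? q) a r<q
         (λ h → ℕ.<⇒≱ R<A (ℕ.≤-trans (ackermann-mono a 1≤r) (ℕ.≤-trans h q≤R)))
... | k , k<a , Ar≤q , Ar≰q
  -- The iteration index: `ackermann (suc k) r` unfolds to the `suc r`-fold iterate, so failure at
  -- level `suc k` is failure at `i = r`.
  with switch (λ i → iterate (ackermann k) r (suc i) ≤? q) r Ar≤q Ar≰q
...   | i , i<r , Ai≤q , Ai≰q = cases
  where
  φ-drop : ∀ l j → l < a → j < r → ¬ iterate (ackermann l) r (suc j) ≤ q →
           iterate (ackermann l) r (suc j) ≤ R → φ a r R + 1 ≤ φ a r q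
  φ-drop l j l<a j<r ¬p p = ℕ.≤-trans
    (∑-update a l l<a
      (λ k _ _ → ∑-mono r λ i _ → above-mono {iterate (ackermann k) r (suc i)} ℕ.≤-refl q≤R)
      (∑-update r j j<r (λ i _ _ → above-mono {iterate (ackermann l) r (suc i)} ℕ.≤-refl q≤R)
        (drop ¬p p)))
    (ℕ.≤-reflexive (ℕ.+-identityʳ _))

  dropped : φ a r R + 1 ≤ φ a r q → φ a r R + 1 + coLevel a r R ≤ φ a r q + coLevel a q R
  dropped h = ℕ.+-mono-≤ h (coLevel-mono a R (ℕ.<⇒≤ r<q))

  next≤R : ackermann k q ≤ R → iterate (ackermann k) r (suc (suc i)) ≤ R
  next≤R h = ℕ.≤-trans (ℕ.≤-reflexive (iterate-suc (ackermann k) r (suc i)))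
                       (ℕ.≤-trans (ackermann-mono k Ai≤q) h)

  cases : φ a r R + 1 + coLevel a r R ≤ φ a r q + coLevel a q R
  cases with ackermann k q ≤? R
  ... | no Aq≰R = ℕ.≤-trans (ℕ.≤-reflexive (ℕ.+-assoc (φ a r R) 1 _))
        (ℕ.+-mono-≤ (φ-antitone a r q≤R) (ℕ.≤-trans (ℕ.≤-reflexive (ℕ.+-comm 1 _))
          (ℕ.≤-trans (∑-update a k {1} {0} k<a
              (λ l _ _ → above-mono (ackermann-mono l (ℕ.<⇒≤ r<q)) ℕ.≤-refl)
              (ℕ.≤-reflexive (trans (cong (_+ 1) (above-yes (ℕ.≤-trans Ar≤q q≤R)))
                                    (sym (trans (ℕ.+-identityʳ _) (above-no Aq≰R))))))
            (ℕ.≤-reflexive (ℕ.+-identityʳ _)))))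
  -- One more application of `ackermann k` still stays below `R`. The new iterate lies in row `k` of
  -- the potential unless that row is exhausted, `suc i = r`; then it equals `ackermann (suc k) r`,
  -- and the drop occurs at the start of row `suc k`.
  ... | yes Aq≤R with suc i ≟ r
  ...   | no 1+i≢r = dropped (φ-drop k (suc i) k<a (ℕ.≤∧≢⇒< i<r 1+i≢r) Ai≰q (next≤R Aq≤R))
  ...   | yes refl = dropped (φ-drop (suc k) 0 (ℕ.≤∧≢⇒< k<a 1+k≢a) 1≤r Ar≰q (next≤R Aq≤R))
    where
    1+k≢a : suc k ≢ a
    1+k≢a refl = ℕ.<⇒≱ R<A (ℕ.≤-trans (ackermann-mono (suc k) 1≤r) (next≤R Aq≤R))

-- Total-correctness judgements with running time

module Runs (𝒜 : Actions) (k : ℕ) where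

  open GKAT 𝒜 k

  private variable
    ℓ ℓ′ : Level
    A B : Set
    c : Prog A
    σ : Store

  -- The postcondition receives the time along with the final store, so an amortized bound can
  -- relate both to a potential of the store.
  record Ends {A : Set} (c : Prog A) (σ : Store) (Q : A → Store → ℕ → Set ℓ) :
              Set (Level.suc 0ℓ ⊔ ℓ) where
    constructor ends
    field
      {value} : A
      {store} : Store
      {time}  : ℕ
      run     : ⟨ c , σ ⟩⇓⟨ value , store ⟩ time
      post    : Q value store time

  accept≢reject : ∀ {X : Set} → _≢_ {A = Out X} accept reject
  accept≢reject ()

  accept≢step : ∀ {X : Set} {p} {x : X} → _≢_ {A = Out X} accept (step p x)
  accept≢step ()

  reject≢step : ∀ {X : Set} {p} {x : X} → _≢_ {A = Out X} reject (step p x)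
  reject≢step ()

  infixl 1 _then_

  _then_ : ∀ {f : A → Prog B} {P : A → Store → ℕ → Set ℓ} {Q : B → Store → ℕ → Set ℓ′} →
           Ends c σ P → (∀ {v σ′ t} → P v σ′ t → Ends (f v) σ′ λ w σ″ u → Q w σ″ (t + u)) →
           Ends (c >>= f) σ Q
  ends r p then h with h p
  ... | ends r′ q = ends (⇓bind r r′) q

  weaken : ∀ {P : A → Store → ℕ → Set ℓ} {Q : A → Store → ℕ → Set ℓ′} →
           Ends c σ P → (∀ {v σ′ t} → P v σ′ t → Q v σ′ t) → Ends c σ Q
  weaken (ends r p) h = ends r (h p)

  returning : ∀ {v : A} {Q : A → Store → ℕ → Set ℓ} → Q v σ 1 → Ends (return v) σ Q
  returning q = ends ⇓return q

  writing : ∀ {a i v} {Q : ⊤ → Store → ℕ → Set ℓ} → Q tt (σ [ a at i ]≔ v) 1 →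
            Ends (write a i v) σ Q
  writing q = ends ⇓write q

  exiting : ∀ {f : A → Prog (A ⊎ B)} {x v} {Q : B → Store → ℕ → Set ℓ} →
            Ends (f x) σ (λ w σ′ t → w ≡ inj₂ v × Q v σ′ (suc t)) → Ends (loop f x) σ Q
  exiting (ends r (refl , q)) = ends (⇓exit r) q

  repeating : ∀ {f : A → Prog (A ⊎ B)} {x y} {Q : B → Store → ℕ → Set ℓ} →
              Ends (f x) σ (λ w σ′ t → w ≡ inj₁ y ×
                Ends (loop f y) σ′ (λ v σ″ u → Q v σ″ (suc (t + u)))) →
              Ends (loop f x) σ Q
  repeating (ends r (refl , ends r′ q)) = ends (⇓again r r′) q

  written : ∀ (σ : Store) a i v → (σ [ a at i ]≔ v) a i ≡ v
  written σ a i v with a ≟ₐ a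
  ... | no a≢a = ⊥-elim (a≢a refl)
  ... | yes refl with i ≡ᵇ i in eq
  ...   | true  = refl
  ...   | false = ⊥-elim (subst T eq (ℕ.≡⇒≡ᵇ i i refl))

  unwritten : ∀ (σ : Store) a i v b j → (a ≡ b → i ≢ j) → (σ [ a at i ]≔ v) b j ≡ σ b j
  unwritten σ a i v b j h with a ≟ₐ b
  ... | no _ = refl
  ... | yes refl with i ≡ᵇ j in eq
  ...   | false = refl
  ...   | true  = ⊥-elim (h refl (ℕ.≡ᵇ⇒≡ i j (subst T (sym eq) _)))

  -- Indexing the invariant by the elements still to come lets pending obligations be phrased as
  -- membership in that list.
  forEach-ends : ∀ {X : Set} {f : X → Prog ⊤} (I : List X → Store → Set ℓ) d →
    (∀ x xs {σ} → I (x ∷ xs) σ → Ends (f x) σ λ _ σ′ t → I xs σ′ × t ≤ d) →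
    ∀ xs {σ} → I xs σ → Ends (forEach xs f) σ λ _ σ′ t → I [] σ′ × t ≤ suc (length xs * d)
  forEach-ends I d body []       i = returning (i , ℕ.≤-refl)
  forEach-ends I d body (x ∷ xs) i =
    body x xs i then λ (i′ , t≤) →
    weaken (forEach-ends I d body xs i′) λ (i″ , u≤) →
      i″ , ℕ.≤-trans (ℕ.+-mono-≤ t≤ u≤) (ℕ.≤-reflexive (ℕ.+-suc d _))

  -- `forBelow` counts down, so `I n` describes a store in which the indices from `n` on have been
  -- treated and those below `n` have not.
  forBelow-ends : ∀ {f : ℕ → Prog ⊤} (I : ℕ → Store → Set ℓ) d →
    ∀ n → (∀ m {σ} → m < n → I (suc m) σ → Ends (f m) σ λ _ σ′ t → I m σ′ × t ≤ d) →
    ∀ {σ} → I n σ → Ends (forBelow n f) σ λ _ σ′ t → I 0 σ′ × t ≤ suc (n * d)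
  forBelow-ends I d zero    body i = returning (i , ℕ.≤-refl)
  forBelow-ends I d (suc n) body i =
    body n ℕ.≤-refl i then λ (i′ , t≤) →
    weaken (forBelow-ends I d n (λ m m<n → body m (ℕ.m≤n⇒m≤1+n m<n)) i′) λ (i″ , u≤) →
      i″ , ℕ.≤-trans (ℕ.+-mono-≤ t≤ u≤) (ℕ.≤-reflexive (ℕ.+-suc d _))

  atoms-complete : ∀ {j} (α : At j) → α ∈ atoms j
  atoms-complete Vec.[]          = here refl
  atoms-complete (true  Vec.∷ α) = ∈.∈-++⁺ˡ (∈.∈-map⁺ (true Vec.∷_) (atoms-complete α))
  atoms-complete (false Vec.∷ α) = ∈.∈-++⁺ʳ _ (∈.∈-map⁺ (false Vec.∷_) (atoms-complete α))

  read-then : ∀ {a i v} {f : Value a → Prog B} {Q : B → Store → ℕ → Set ℓ} → σ a i ≡ v →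
              Ends (f v) σ (λ w σ′ t → Q w σ′ (suc t)) → Ends (read a i >>= f) σ Q
  read-then refl (ends r q) = ends (⇓bind ⇓read r) q

  write-then : ∀ {a i v} {c : Prog B} {Q : B → Store → ℕ → Set ℓ} →
               Ends c (σ [ a at i ]≔ v) (λ w σ′ t → Q w σ′ (suc t)) →
               Ends (write a i v >> c) σ Q
  write-then (ends r q) = ends (⇓bind ⇓write r) q

  if-true : ∀ {b} {c d : Prog A} {Q : A → Store → ℕ → Set ℓ} → b ≡ true →
            Ends c σ Q → Ends (if b then c else d) σ Q
  if-true refl p = p

  if-false : ∀ {b} {c d : Prog A} {Q : A → Store → ℕ → Set ℓ} → b ≡ false →
             Ends d σ Q → Ends (if b then c else d) σ Q
  if-false refl p = p

  -- For loops in which only the run of the body reveals whether it leaves or repeats.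
  Next : (A → Prog (A ⊎ B)) → (B → Store → ℕ → Set₁) → A ⊎ B → Store → ℕ → Set₁
  Next f Q (inj₁ y) σ t = Ends (loop f y) σ λ v σ′ u → Q v σ′ (suc (t + u))
  Next f Q (inj₂ v) σ t = Q v σ (suc t)

  looping : ∀ {f : A → Prog (A ⊎ B)} {x} {Q : B → Store → ℕ → Set₁} →
            Ends (f x) σ (Next f Q) → Ends (loop f x) σ Q
  looping (ends {value = inj₁ y} r (ends r′ q)) = ends (⇓again r r′) q
  looping (ends {value = inj₂ v} r q)           = ends (⇓exit r) q

-- Thompson construction: numbering of states and bags of accepting states

module ThompsonRun (𝒜 : Actions) (k : ℕ) where

  open GKAT 𝒜 k
  open Coalgebra
  open Runs 𝒜 k

  does-≤at : ∀ (α : At k) b → does (α ≤at? b) ≡ eval α b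
  does-≤at α b with eval α b
  ... | true  = refl
  ... | false = refl

  mapOut-∘ : ∀ {X Y Z : Set} {f : X → Y} {g : Y → Z} {h : X → Z} →
             (∀ x → g (f x) ≡ h x) → ∀ o → mapOut g (mapOut f o) ≡ mapOut h o
  mapOut-∘ eq (inj₁ v)   = refl
  mapOut-∘ eq (step p x) = cong (step p) (eq x)

  mapOut-orElse : ∀ {X Y : Set} (f : X → Y) o o′ →
                  mapOut f (o orElse o′) ≡ mapOut f o orElse mapOut f o′
  mapOut-orElse f accept     o′ = refl
  mapOut-orElse f reject     o′ = refl
  mapOut-orElse f (step p x) o′ = refl

  orElse-accept : ∀ {X : Set} (o : Out X) → o orElse accept ≡ o
  orElse-accept accept     = refl
  orElse-accept reject     = refl
  orElse-accept (step p x) = refl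

  orElse≡accept : ∀ {X : Set} (o o′ : Out X) → o orElse o′ ≡ accept → o ≡ accept × o′ ≡ accept
  orElse≡accept accept o′ eq = refl , eq

  continuation-inside : ∀ {X : Set} (d : X → G X) Y h x α → Y x ≡ true →
                        uniformContinuation d Y h x α ≡ d x α orElse h α
  continuation-inside d Y h x α eq with Y x | d x α
  ... | true | accept   = refl
  ... | true | reject   = refl
  ... | true | step p y = refl

  continuation-outside : ∀ {X : Set} (d : X → G X) Y h x α → Y x ≡ false →
                         uniformContinuation d Y h x α ≡ d x α
  continuation-outside d Y h x α eq with Y x | d x α
  ... | false | o = refl

  count : Exp → ℕ
  count (act p)      = 1
  count (test b)     = 0
  count (e · f)      = count e + count f
  count (e +[ b ] f) = count e + count f
  count (e ^⟨ b ⟩)   = count e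

  sizeᵇ-positive : ∀ (b : BExp k) → 1 ≤ sizeᵇ b
  sizeᵇ-positive 0ᵇ       = ℕ.≤-refl
  sizeᵇ-positive 1ᵇ       = ℕ.≤-refl
  sizeᵇ-positive (prim i) = ℕ.≤-refl
  sizeᵇ-positive (b ·ᵇ c) = s≤s z≤n
  sizeᵇ-positive (b +ᵇ c) = s≤s z≤n
  sizeᵇ-positive (¬ᵇ b)   = s≤s z≤n

  count≤size : ∀ e → count e ≤ size e
  count≤size (act p)      = ℕ.≤-refl
  count≤size (test b)     = z≤n
  count≤size (e · f)      = ℕ.m≤n⇒m≤1+n (ℕ.+-mono-≤ (count≤size e) (count≤size f))
  count≤size (e +[ b ] f) = ℕ.m≤n⇒m≤1+n
    (ℕ.+-mono-≤ (ℕ.≤-trans (count≤size e) (ℕ.m≤m+n (size e) (sizeᵇ b))) (count≤size f))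
  count≤size (e ^⟨ b ⟩)   = ℕ.m≤n⇒m≤1+n (ℕ.≤-trans (count≤size e) (ℕ.m≤m+n (size e) (sizeᵇ b)))

  _⊎-Fin_ : ∀ {X Y : Set} {m n} → X ↔ Fin m → Y ↔ Fin n → (X ⊎ Y) ↔ Fin (m + n)
  f ⊎-Fin g = ↔-sym Fin.+↔⊎ ↔-∘ (f ⊎-↔ g)

  enum : ∀ e → States e ↔ Fin (count e)
  enum (act p)      = ↔-sym Fin.1↔⊤
  enum (test b)     = ↔-sym Fin.0↔⊥
  enum (e · f)      = enum e ⊎-Fin enum f
  enum (e +[ b ] f) = enum e ⊎-Fin enum f
  enum (e ^⟨ b ⟩)   = enum e

  index : ∀ {X : Set} {n} → X ↔ Fin n → X → ℕ
  index f = toℕ ∘ Inverse.to f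

  index-inj₁ : ∀ {X Y : Set} {m n} (f : X ↔ Fin m) (g : Y ↔ Fin n) x →
               index (f ⊎-Fin g) (inj₁ x) ≡ index f x
  index-inj₁ {n = n} f g x = Fin.toℕ-↑ˡ (Inverse.to f x) n

  index-inj₂ : ∀ {X Y : Set} {m n} (f : X ↔ Fin m) (g : Y ↔ Fin n) y →
               index (f ⊎-Fin g) (inj₂ y) ≡ m + index g y
  index-inj₂ {m = m} f g y = Fin.toℕ-↑ʳ m (Inverse.to g y)

  number : ∀ e → ℕ → States e → ℕ
  number e x s = x + index (enum e) s

  number-inj₁ : ∀ e f x s → x + index (enum e ⊎-Fin enum f) (inj₁ s) ≡ number e x s
  number-inj₁ e f x s = cong (x +_) (index-inj₁ (enum e) (enum f) s)

  number-inj₂ : ∀ e f x s → x + index (enum e ⊎-Fin enum f) (inj₂ s) ≡ number f (x + count e) s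
  number-inj₂ e f x s = trans (cong (x +_) (index-inj₂ (enum e) (enum f) s))
                              (sym (ℕ.+-assoc x (count e) _))

  number-lower : ∀ e x s → x ≤ number e x s
  number-lower e x s = ℕ.m≤m+n x _

  number-upper : ∀ e x s → number e x s < x + count e
  number-upper e x s = ℕ.+-monoʳ-< x (Fin.toℕ<n (Inverse.to (enum e) s))

  -- This is the exact time of `redirect`, hence the unit for the empty bag.
  leaves : Bag → ℕ
  leaves ∅       = 1
  leaves ⟨ x ⟩   = 1
  leaves (E ⊍ F) = leaves E + leaves F

  _∈ᴮ_ : ℕ → Bag → Set
  j ∈ᴮ ∅       = ⊥
  j ∈ᴮ ⟨ x ⟩   = j ≡ x
  j ∈ᴮ (E ⊍ F) = j ∈ᴮ E ⊎ j ∈ᴮ F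

  _∈ᴮ?_ : ∀ j E → Dec (j ∈ᴮ E)
  j ∈ᴮ? ∅       = no λ ()
  j ∈ᴮ? ⟨ x ⟩   = j ≟ x
  j ∈ᴮ? (E ⊍ F) = j ∈ᴮ? E ⊎-dec j ∈ᴮ? F

  -- A frame condition: only the array at `α` may change, and there only at indices violating `P`.
  Agree : Store → Store → At k → (ℕ → Set) → Set
  Agree σ σ′ α P = ∀ b j → (b ≡ trans-at α → P j) → σ′ b j ≡ σ b j

  redirect-ends : ∀ α E o {σ} → Ends (redirect α E o) σ λ _ σ′ t →
    t ≡ leaves E × (∀ {j} → j ∈ᴮ E → σ′ (trans-at α) j ≡ o) × Agree σ σ′ α λ j → ¬ j ∈ᴮ E
  redirect-ends α ∅       o = returning (refl , (λ ()) , λ _ _ _ → refl)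
  redirect-ends α ⟨ x ⟩   o {σ} = writing
    (refl , (λ { refl → written σ (trans-at α) x o }) ,
     λ b j h → unwritten σ (trans-at α) x o b j λ { refl refl → h refl refl })
  redirect-ends α (E ⊍ F) o =
    redirect-ends α E o then λ { (refl , onE , offE) →
    weaken (redirect-ends α F o) λ { {σ′ = σ″} (refl , onF , offF) →
      refl ,
      (λ {j} → λ { (inj₂ j∈F) → onF j∈F
                 ; (inj₁ j∈E) → both σ″ j j∈E onE onF offF }) ,
      λ b j h → trans (offF b j λ eq j∈F → h eq (inj₂ j∈F)) (offE b j λ eq j∈E → h eq (inj₁ j∈E)) } }
    where
    -- An index may lie in both halves; the second pass then writes the same value again.
    both : ∀ {σ′} σ″ j → j ∈ᴮ E → (∀ {j} → j ∈ᴮ E → σ′ (trans-at α) j ≡ o) →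
           (∀ {j} → j ∈ᴮ F → σ″ (trans-at α) j ≡ o) → Agree σ′ σ″ α (λ j → ¬ j ∈ᴮ F) →
           σ″ (trans-at α) j ≡ o
    both σ″ j j∈E onE onF offF with j ∈ᴮ? F
    ... | yes j∈F = onF j∈F
    ... | no j∉F  = trans (offF (trans-at α) j λ _ → j∉F) (onE j∈E)

  record Bagged (lo hi : ℕ) (α : At k) (σ : Store) (E : Bag) : Set where
    field
      bag-sound    : ∀ {j} → j ∈ᴮ E → lo ≤ j × j < hi × σ (trans-at α) j ≡ accept
      bag-complete : ∀ {j} → lo ≤ j → j < hi → σ (trans-at α) j ≡ accept → j ∈ᴮ E
  open Bagged

  Outside : ℕ → ℕ → ℕ → Set
  Outside lo hi j = j < lo ⊎ hi ≤ j

  outside⇒∉ : ∀ {lo hi α σ E j} → Bagged lo hi α σ E → Outside lo hi j → ¬ j ∈ᴮ E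
  outside⇒∉ bag (inj₁ j<lo) j∈E = ℕ.<⇒≱ j<lo (proj₁ (bag-sound bag j∈E))
  outside⇒∉ bag (inj₂ hi≤j) j∈E = ℕ.<⇒≱ (proj₁ (proj₂ (bag-sound bag j∈E))) hi≤j

  Bagged-transfer : ∀ {lo hi α σ σ′ E} →
    (∀ j → lo ≤ j → j < hi → σ′ (trans-at α) j ≡ σ (trans-at α) j) →
    Bagged lo hi α σ E → Bagged lo hi α σ′ E
  Bagged-transfer same bag = record
    { bag-sound = λ j∈E → let l , h , eq = bag-sound bag j∈E in l , h , trans (same _ l h) eq
    ; bag-complete = λ l h eq → bag-complete bag l h (trans (sym (same _ l h)) eq)
    }

  Bagged-⊍ : ∀ {lo mid hi α σ E F} → lo ≤ mid → mid ≤ hi →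
    Bagged lo mid α σ E → Bagged mid hi α σ F → Bagged lo hi α σ (E ⊍ F)
  Bagged-⊍ {mid = mid} lo≤mid mid≤hi bagE bagF = record
    { bag-sound = λ where
        (inj₁ j∈E) → let l , h , eq = bag-sound bagE j∈E in l , ℕ.≤-trans h mid≤hi , eq
        (inj₂ j∈F) → let l , h , eq = bag-sound bagF j∈F in ℕ.≤-trans lo≤mid l , h , eq
    ; bag-complete = λ {j} l h eq → cases l h eq (suc j ≤? mid)
    }
    where
    cases : ∀ {j} → _ → _ → _ → Dec (j < mid) → _
    cases l h eq (yes j<mid) = inj₁ (bag-complete bagE l j<mid eq)
    cases l h eq (no  j≮mid) = inj₂ (bag-complete bagF (ℕ.≮⇒≥ j≮mid) h eq)

  -- The leaves of `E` pay for redirecting them. The remaining `2` covers the final `return` and the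
  -- leaf of the empty bag that replaces `E`.
  Continued : ℕ → ℕ → At k → Out ℕ → Store → Bag → Store → Bag → ℕ → Set
  Continued lo hi α o σ E σ′ E′ t =
    t + leaves E′ ≤ leaves E + 2 ×
    (∀ j → lo ≤ j → j < hi → σ′ (trans-at α) j ≡ σ (trans-at α) j orElse o) ×
    Agree σ σ′ α (Outside lo hi) × Bagged lo hi α σ′ E′

  redirected : ∀ {lo hi α σ E} o → o ≢ accept → Bagged lo hi α σ E →
    Ends (redirect α E o >> return ∅) σ λ E′ σ′ t → Continued lo hi α o σ E σ′ E′ t
  redirected {lo} {hi} {α} {σ} {E} o o≢ bag =
    redirect-ends α E o then λ { {σ′ = σ′} (refl , on , off) →
    let
      new : ∀ j → lo ≤ j → j < hi → σ′ (trans-at α) j ≡ σ (trans-at α) j orElse o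
      new j l h = at j l h σ′ on off
    in returning
      ( ℕ.≤-reflexive (ℕ.+-assoc (leaves E) 1 1) , new
      , (λ b j out → off b j λ eq → outside⇒∉ bag (out eq))
      , record
        { bag-sound = λ ()
        -- As `o` is not `accept`, no state of the range accepts after the redirection, and the
        -- empty bag is complete.
        ; bag-complete = λ {j} l h eq →
            o≢ (proj₂ (orElse≡accept (σ (trans-at α) j) o (trans (sym (new j l h)) eq)))
        }) }
    where
    at : ∀ j → lo ≤ j → j < hi → ∀ σ′ → (∀ {j} → j ∈ᴮ E → σ′ (trans-at α) j ≡ o) →
         Agree σ σ′ α (λ j → ¬ j ∈ᴮ E) → σ′ (trans-at α) j ≡ σ (trans-at α) j orElse o
    at j l h σ′ on off with σ (trans-at α) j in eq
    ... | accept   = on (bag-complete bag l h eq)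
    ... | reject   = trans (off _ j λ _ j∈E →
                       accept≢reject (trans (sym (proj₂ (proj₂ (bag-sound bag j∈E)))) eq)) eq
    ... | step p y = trans (off _ j λ _ j∈E →
                       accept≢step (trans (sym (proj₂ (proj₂ (bag-sound bag j∈E)))) eq)) eq

  continue-ends : ∀ {lo hi α σ E} o → Bagged lo hi α σ E →
    Ends (continue α E o) σ λ E′ σ′ t → Continued lo hi α o σ E σ′ E′ t
  continue-ends {E = E} accept bag = returning
    ( by-sum 1 ℕ.≤-refl (arith (leaves E))
    , (λ _ _ _ → sym (orElse-accept _)) , (λ _ _ _ → refl) , bag)
    where
    arith : ∀ l → 1 + l + 0 + 1 ≡ l + 2 + 0
    arith = solve-∀
  continue-ends reject     bag = redirected reject (λ ()) bag
  continue-ends (step p y) bag = redirected (step p y) (λ ()) bag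

  evaluate-ends : ∀ α b {σ} → Ends (evaluate α b) σ λ v σ′ t →
                  v ≡ eval α b × σ′ ≡ σ × t ≡ sizeᵇ b
  evaluate-ends α 0ᵇ       = returning (refl , refl , refl)
  evaluate-ends α 1ᵇ       = returning (refl , refl , refl)
  evaluate-ends α (prim i) = returning (refl , refl , refl)
  evaluate-ends α (b ·ᵇ c) =
    evaluate-ends α b then λ { (refl , refl , refl) →
    evaluate-ends α c then λ { (refl , refl , refl) →
    returning (refl , refl , trans (cong (sizeᵇ b +_) (ℕ.+-comm (sizeᵇ c) 1)) (ℕ.+-suc (sizeᵇ b) _)) } }
  evaluate-ends α (b +ᵇ c) =
    evaluate-ends α b then λ { (refl , refl , refl) →
    evaluate-ends α c then λ { (refl , refl , refl) →
    returning (refl , refl , trans (cong (sizeᵇ b +_) (ℕ.+-comm (sizeᵇ c) 1)) (ℕ.+-suc (sizeᵇ b) _)) } }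
  evaluate-ends α (¬ᵇ b) =
    evaluate-ends α b then λ { (refl , refl , refl) →
    returning (refl , refl , ℕ.+-comm (sizeᵇ b) 1) }

  -- The leaves of the resulting bag are time saved up for the redirection that
  -- may empty it later.
  record Built (α : At k) (e : Exp) (x : ℕ) (σ : Store)
               (r : Out ℕ × Bag × ℕ) (σ′ : Store) (t : ℕ) : Set where
    field
      next   : proj₂ (proj₂ r) ≡ x + count e
      pseudo : proj₁ r ≡ mapOut (number e x) (initial e α)
      states : ∀ s → σ′ (trans-at α) (number e x s) ≡ mapOut (number e x) (transition e s α)
      bag    : Bagged x (x + count e) α σ′ (proj₁ (proj₂ r))
      frame  : Agree σ σ′ α (Outside x (x + count e))
      cost   : t + leaves (proj₁ (proj₂ r)) ≤ 3 * size e
  open Built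

  inside-last : ∀ {x j} → x ≤ j → j < x + 1 → j ≡ x
  inside-last {x} l h = ℕ.≤-antisym (ℕ.≤-pred (ℕ.≤-trans h (ℕ.≤-reflexive (ℕ.+-comm x 1)))) l

  cost-test : ∀ s → 1 ≤ s → s + 1 + 1 ≤ 3 * s
  cost-test s 1≤s = by-sum 0 (ℕ.+-mono-≤ 1≤s 1≤s) (solve (s ∷ []))

  -- Tight: the three units allotted to the node are its own `return` and the `2` of `Continued`. An
  -- action uses up its three units as well, by a write, a `return` and one leaf.
  cost-seq : ∀ t₁ t₂ t₃ lE lF lE′ a b → t₁ + lE ≤ 3 * a → t₂ + lF ≤ 3 * b → t₃ + lE′ ≤ lE + 2 →
             t₁ + (t₂ + (t₃ + 1)) + (lE′ + lF) ≤ 3 * suc (a + b)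
  cost-seq t₁ t₂ t₃ lE lF lE′ a b h₁ h₂ h₃ = by-sum 0 (ℕ.+-mono-≤ h₁ (ℕ.+-mono-≤ h₂ h₃))
    (solve (t₁ ∷ t₂ ∷ t₃ ∷ lE ∷ lF ∷ lE′ ∷ a ∷ b ∷ []))

  cost-if : ∀ t₁ t₂ lE lF a b c → t₁ + lE ≤ 3 * a → t₂ + lF ≤ 3 * b →
            t₁ + (t₂ + (c + 1)) + (lE + lF) ≤ 3 * suc (a + c + b)
  cost-if t₁ t₂ lE lF a b c h₁ h₂ = by-sum (2 + 2 * c) (ℕ.+-mono-≤ h₁ h₂)
    (solve (t₁ ∷ t₂ ∷ lE ∷ lF ∷ a ∷ b ∷ c ∷ []))

  cost-loop : ∀ t₁ t₃ lE lE′ a c → t₁ + lE ≤ 3 * a → t₃ + lE′ ≤ lE + 2 →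
              t₁ + (c + (t₃ + 1)) + lE′ ≤ 3 * suc (a + c)
  cost-loop t₁ t₃ lE lE′ a c h₁ h₂ = by-sum (2 * c) (ℕ.+-mono-≤ h₁ h₂)
    (solve (t₁ ∷ t₃ ∷ lE ∷ lE′ ∷ a ∷ c ∷ []))

  if-cong : ∀ {X : Set} {b b′ : Bool} {x y : X} → b ≡ b′ → (if b then x else y) ≡ (if b′ then x else y)
  if-cong refl = refl

  mapOut-if : ∀ {X Y : Set} (f : X → Y) b {o o′} →
              mapOut f (if b then o else o′) ≡ (if b then mapOut f o else mapOut f o′)
  mapOut-if f true  = refl
  mapOut-if f false = refl

  module _ (α : At k) where

    pseudo-seq : ∀ e f x → mapOut (number (e · f) x) (initial (e · f) α) ≡
                 mapOut (number e x) (initial e α) orElse mapOut (number f (x + count e)) (initial f α)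
    pseudo-seq e f x = trans (mapOut-orElse _ (mapOut inj₁ (initial e α)) _)
      (cong₂ _orElse_ (mapOut-∘ (number-inj₁ e f x) (initial e α))
                      (mapOut-∘ (number-inj₂ e f x) (initial f α)))

    pseudo-if : ∀ e b f x → mapOut (number (e +[ b ] f) x) (initial (e +[ b ] f) α) ≡
      (if eval α b then mapOut (number e x) (initial e α)
                   else mapOut (number f (x + count e)) (initial f α))
    pseudo-if e b f x = trans (cong (mapOut _) (if-cong (does-≤at α b))) (trans (mapOut-if _ (eval α b))
      (cong₂ (if eval α b then_else_) (mapOut-∘ (number-inj₁ e f x) (initial e α))
                                      (mapOut-∘ (number-inj₂ e f x) (initial f α))))

    pseudo-loop : ∀ e b x → mapOut (number (e ^⟨ b ⟩) x) (initial (e ^⟨ b ⟩) α) ≡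
      (if eval α b then mapOut (number e x) (initial e α) orElse reject else accept)
    pseudo-loop e b x = trans (cong (mapOut _) (if-cong (does-≤at α b))) (trans (mapOut-if _ (eval α b))
      (cong (if eval α b then_else accept) (mapOut-orElse _ (initial e α) reject)))

    transition-seq₁ : ∀ e f s → transition (e · f) (inj₁ s) α ≡
                      mapOut inj₁ (transition e s α) orElse mapOut inj₂ (initial f α)
    transition-seq₁ e f s = continuation-inside (transition e ⊞ transition f)
      [ const true , const false ]′ (mapOut inj₂ ∘ initial f) (inj₁ s) α refl

    transition-seq₂ : ∀ e f s → transition (e · f) (inj₂ s) α ≡ mapOut inj₂ (transition f s α)
    transition-seq₂ e f s = continuation-outside (transition e ⊞ transition f)
      [ const true , const false ]′ (mapOut inj₂ ∘ initial f) (inj₂ s) α refl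

    transition-loop : ∀ e b s → transition (e ^⟨ b ⟩) s α ≡
                      transition e s α orElse initial (e ^⟨ b ⟩) α
    transition-loop e b s = continuation-inside (transition e) (const true) (initial (e ^⟨ b ⟩)) s α refl

    states-seq₁ : ∀ e f x s → mapOut (number (e · f) x) (transition (e · f) (inj₁ s) α) ≡
      mapOut (number e x) (transition e s α) orElse mapOut (number f (x + count e)) (initial f α)
    states-seq₁ e f x s =
      trans (cong (mapOut (number (e · f) x)) (transition-seq₁ e f s))
      (trans (mapOut-orElse (number (e · f) x) (mapOut inj₁ (transition e s α)) _)
        (cong₂ _orElse_ (mapOut-∘ (number-inj₁ e f x) (transition e s α))
                        (mapOut-∘ (number-inj₂ e f x) (initial f α))))

    states-seq₂ : ∀ e f x s → mapOut (number (e · f) x) (transition (e · f) (inj₂ s) α) ≡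
                  mapOut (number f (x + count e)) (transition f s α)
    states-seq₂ e f x s = trans (cong (mapOut (number (e · f) x)) (transition-seq₂ e f s))
                                (mapOut-∘ (number-inj₂ e f x) (transition f s α))

    states-loop : ∀ e b x s → mapOut (number (e ^⟨ b ⟩) x) (transition (e ^⟨ b ⟩) s α) ≡
      mapOut (number e x) (transition e s α) orElse mapOut (number e x) (initial (e ^⟨ b ⟩) α)
    states-loop e b x s =
      trans (cong (mapOut (number e x)) (transition-loop e b s))
            (mapOut-orElse (number e x) (transition e s α) (initial (e ^⟨ b ⟩) α))

-- Thompson construction: the numbered automaton in memory

module BuildRun (𝒜 : Actions) (k : ℕ) where

  open GKAT 𝒜 k
  open Coalgebra
  open Runs 𝒜 k
  open ThompsonRun 𝒜 k
  open Bagged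
  open Built

  states-act : ∀ (σ : Store) α x → (σ [ trans-at α at x ]≔ accept) (trans-at α) (x + 0) ≡ accept
  states-act σ α x rewrite ℕ.+-identityʳ x = written σ (trans-at α) x accept

  not-outside : ∀ x → ¬ Outside x (x + 1) x
  not-outside x (inj₁ x<x) = ℕ.<-irrefl refl x<x
  not-outside x (inj₂ h)   = ℕ.m+1+n≰m x h

  agree-trans : ∀ {σ σ′ σ″ α} {P Q R : ℕ → Set} → (∀ {j} → R j → P j) → (∀ {j} → R j → Q j) →
                Agree σ σ′ α P → Agree σ′ σ″ α Q → Agree σ σ″ α R
  agree-trans p q f g b j h = trans (g b j (q ∘ h)) (f b j (p ∘ h))

  module Adjacent (x c d : ℕ) where
    z≡ : (x + c) + d ≡ x + (c + d)
    z≡ = ℕ.+-assoc x c d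

    outside₁ : ∀ {j} → Outside x (x + (c + d)) j → Outside x (x + c) j
    outside₁ (inj₁ h) = inj₁ h
    outside₁ (inj₂ h) = inj₂ (ℕ.≤-trans (ℕ.+-monoʳ-≤ x (ℕ.m≤m+n c d)) h)

    outside₂ : ∀ {j} → Outside x (x + (c + d)) j → Outside (x + c) (x + c + d) j
    outside₂ (inj₁ h) = inj₁ (ℕ.≤-trans h (ℕ.m≤m+n x c))
    outside₂ (inj₂ h) = inj₂ (ℕ.≤-trans (ℕ.≤-reflexive z≡) h)

    mid≤hi : x + c ≤ x + (c + d)
    mid≤hi = ℕ.+-monoʳ-≤ x (ℕ.m≤m+n c d)

    bagged : ∀ {α σ E F} → Bagged x (x + c) α σ E → Bagged (x + c) (x + c + d) α σ F →
             Bagged x (x + (c + d)) α σ (E ⊍ F)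
    bagged {α} {σ} {E} {F} bE bF = subst (λ z → Bagged x z α σ (E ⊍ F)) z≡
      (Bagged-⊍ (ℕ.m≤m+n x c) (ℕ.m≤m+n (x + c) d) bE bF)

  build-ends : ∀ α e x {σ} → Ends (build α e x) σ (Built α e x σ)
  build-ends α (act p) x {σ} =
    writing {Q = λ _ σ′ t → σ′ ≡ (σ [ trans-at α at x ]≔ accept) × t ≡ 1} (refl , refl) then
      λ { (refl , refl) → returning record
    { next   = ℕ.+-comm 1 x
    ; pseudo = cong (step p) (sym (ℕ.+-identityʳ x))
    ; states = λ _ → states-act σ α x
    ; bag    = record
      { bag-sound    = λ { refl → ℕ.≤-refl , ℕ.m<m+n x ℕ.≤-refl , written σ (trans-at α) x accept }
      ; bag-complete = λ l h _ → inside-last l h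
      }
    ; frame  = λ b j out → unwritten σ (trans-at α) x accept b j λ { refl refl → not-outside x (out refl) }
    ; cost   = ℕ.≤-refl
    } }
  build-ends α (test b) x =
    evaluate-ends α b then λ { (refl , refl , refl) → returning record
    { next   = sym (ℕ.+-identityʳ x)
    ; pseudo = cong inj₁ (sym (does-≤at α b))
    ; states = λ ()
    ; bag    = record
      { bag-sound    = λ ()
      ; bag-complete = λ {j} l h _ → ℕ.<⇒≱ h (ℕ.≤-trans (ℕ.≤-reflexive (ℕ.+-identityʳ x)) l)
      }
    ; frame  = λ _ _ _ → refl
    ; cost   = cost-test (sizeᵇ b) (sizeᵇ-positive b)
    } }
  build-ends α (e · f) x {σ} =
    build-ends α e x then λ { {i , E , y} {σ₁} {t₁}
      record { next = refl ; pseudo = refl ; states = st₁ ; bag = bag₁ ; frame = fr₁ ; cost = c₁ } →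
    build-ends α f y then λ { {j , F , z} {σ₂} {t₂}
      record { next = refl ; pseudo = refl ; states = st₂ ; bag = bag₂ ; frame = fr₂ ; cost = c₂ } →
    let
      below : ∀ j → j < y → Outside y z j
      below j h = inj₁ h
    in
    -- The states of `f` are numbered above those of `e`, so building `f` has left the bag of `e`
    -- valid, and the continuation in turn leaves the states of `f` alone.
    continue-ends j (Bagged-transfer (λ j _ h → fr₂ _ j λ _ → below j h) bag₁) then
      λ { {E′} {σ₃} {t₃} (c₃ , new , fr₃ , bag₃) →
    returning record
    { next   = z≡
    ; pseudo = sym (pseudo-seq α e f x)
    ; states = λ where
        (inj₁ s) → trans (cong (σ₃ (trans-at α)) (number-inj₁ e f x s))
          (trans (new _ (number-lower e x s) (number-upper e x s))
          (trans (cong (_orElse j) (trans (fr₂ _ _ λ _ → below _ (number-upper e x s)) (st₁ s)))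
                 (sym (states-seq₁ α e f x s))))
        (inj₂ s) → trans (cong (σ₃ (trans-at α)) (number-inj₂ e f x s))
          (trans (fr₃ _ _ λ _ → inj₂ (number-lower f y s))
          (trans (st₂ s) (sym (states-seq₂ α e f x s))))
    ; bag    = bagged bag₃ (Bagged-transfer (λ j l _ → fr₃ _ j λ _ → inj₂ l) bag₂)
    ; frame  = agree-trans {σ} {σ₂} {σ₃} id outside₁ (agree-trans {σ} {σ₁} {σ₂} outside₁ outside₂ fr₁ fr₂) fr₃
    ; cost   = cost-seq t₁ t₂ t₃ (leaves E) (leaves F) (leaves E′) (size e) (size f) c₁ c₂ c₃
    } } } }
    where open Adjacent x (count e) (count f)
  build-ends α (e +[ b ] f) x {σ} =
    build-ends α e x then λ { {i , E , y} {σ₁} {t₁}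
      record { next = refl ; pseudo = refl ; states = st₁ ; bag = bag₁ ; frame = fr₁ ; cost = c₁ } →
    build-ends α f y then λ { {j , F , z} {σ₂} {t₂}
      record { next = refl ; pseudo = refl ; states = st₂ ; bag = bag₂ ; frame = fr₂ ; cost = c₂ } →
    evaluate-ends α b then λ { (refl , refl , refl) →
    returning record
    { next   = z≡
    ; pseudo = sym (pseudo-if α e b f x)
    ; states = λ where
        (inj₁ s) → trans (cong (σ₂ (trans-at α)) (number-inj₁ e f x s))
          (trans (fr₂ _ _ λ _ → inj₁ (number-upper e x s))
          (trans (st₁ s) (sym (mapOut-∘ (number-inj₁ e f x) (transition e s α)))))
        (inj₂ s) → trans (cong (σ₂ (trans-at α)) (number-inj₂ e f x s))
          (trans (st₂ s) (sym (mapOut-∘ (number-inj₂ e f x) (transition f s α))))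
    ; bag    = bagged (Bagged-transfer (λ j _ h → fr₂ _ j λ _ → inj₁ h) bag₁) bag₂
    ; frame  = agree-trans {σ} {σ₁} {σ₂} outside₁ outside₂ fr₁ fr₂
    ; cost   = cost-if t₁ t₂ (leaves E) (leaves F) (size e) (size f) (sizeᵇ b) c₁ c₂
    } } } }
    where open Adjacent x (count e) (count f)
  build-ends α (e ^⟨ b ⟩) x {σ} =
    build-ends α e x then λ { {i , E , y} {σ₁} {t₁}
      record { next = refl ; pseudo = refl ; states = st₁ ; bag = bag₁ ; frame = fr₁ ; cost = c₁ } →
    evaluate-ends α b then λ { (refl , refl , refl) →
    let j = if eval α b then i orElse reject else accept in
    continue-ends j bag₁ then λ { {E′} {σ₃} {t₃} (c₃ , new , fr₃ , bag₃) →
    returning record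
    { next   = refl
    ; pseudo = sym (pseudo-loop α e b x)
    ; states = λ s →
        trans (new _ (number-lower e x s) (number-upper e x s))
        (trans (cong₂ _orElse_ (st₁ s) (sym (pseudo-loop α e b x)))
               (sym (states-loop α e b x s)))
    ; bag    = bag₃
    ; frame  = agree-trans {σ} {σ₁} {σ₃} id id fr₁ fr₃
    ; cost   = cost-loop t₁ t₃ (leaves E) (leaves E′) (size e) (sizeᵇ b) c₁ c₃
    } } } }

  -- The programs keep their loop bodies in local definitions.  Here and below,
  -- such a body gets a name by unification with the program it belongs to.
  go₁ : Exp → ℕ → List (At k) → Prog ℕ
  go  : Exp → ℕ → List (At k) → ℕ → Prog ℕ

  buildAutomaton≡ : ∀ e s → buildAutomaton e s ≡ go₁ e s (atoms k)
  go₁-∷ : ∀ e s α αs → go₁ e s (α ∷ αs) ≡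
          (build α e (suc s) >>= λ (i , _ , z) → write (trans-at α) s i >> go e s αs z)

  go₁ = _
  go  = _
  buildAutomaton≡ e s with atoms k
  ... | αs = refl
  go₁-∷ e s α αs = refl

  numberᵀ : ∀ e → ℕ → State (Thompson e) → ℕ
  numberᵀ e s ι     = s
  numberᵀ e s ⟪ x ⟫ = number e (suc s) x

  Written : At k → Exp → ℕ → Store → Set
  Written α e s σ = ∀ x → σ (trans-at α) (numberᵀ e s x) ≡ mapOut (numberᵀ e s) (δ (Thompson e) x α)

  -- Preservation is built in: what has been written for one atom must survive the passes for the
  -- later ones.
  Numbered : Exp → ℕ → List (At k) → Store → Store → Set
  Numbered e s αs σ σ′ = (∀ α → α ∈ αs ⊎ Written α e s σ → Written α e s σ′) ×
                         (∀ b j → Outside s (suc s + count e) j → σ′ b j ≡ σ b j)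

  leaves-positive : ∀ E → 1 ≤ leaves E
  leaves-positive ∅       = ℕ.≤-refl
  leaves-positive ⟨ x ⟩   = ℕ.≤-refl
  leaves-positive (E ⊍ F) = ℕ.≤-trans (leaves-positive E) (ℕ.m≤m+n (leaves E) (leaves F))

  trans-at-injective : ∀ {α β} → trans-at α ≡ trans-at β → α ≡ β
  trans-at-injective refl = refl

  -- The rest of the program is an arbitrary `f`, so that the first atom, reached through `go₁`, and
  -- the later ones, reached through `go`, share one argument.
  block-ends : ∀ α e s {σ} {f : ℕ → Prog ℕ} {Q : ℕ → Store → ℕ → Set} →
    (∀ {σ′ t} → Numbered e s (α ∷ []) σ σ′ → t ≤ 3 * size e →
       Ends (f (suc s + count e)) σ′ λ v σ″ u → Q v σ″ (t + u)) →
    Ends (build α e (suc s) >>= λ (i , _ , z) → write (trans-at α) s i >> f z) σ Q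
  block-ends α e s {σ} {f} {Q} h =
    build-ends α e (suc s) then λ { {i , E , z} {σ₁} {t₁}
      record { next = refl ; pseudo = refl ; states = st ; bag = bag ; frame = fr ; cost = c } →
    let
      σ₂ = σ₁ [ trans-at α at s ]≔ i
      new : Written α e s σ₂
      new = λ where
        ι     → trans (written σ₁ (trans-at α) s i) (sym (mapOut-∘ (λ _ → refl) (initial e α)))
        ⟪ x ⟫ → trans (unwritten σ₁ (trans-at α) s i (trans-at α) (number e (suc s) x)
                          λ _ → ℕ.<⇒≢ (number-lower e (suc s) x))
                      (trans (st x) (sym (mapOut-∘ (λ _ → refl) (transition e x α))))
      old : ∀ β j → β ≢ α → σ₂ (trans-at β) j ≡ σ (trans-at β) j
      old β j β≢α = trans (unwritten σ₁ (trans-at α) s i (trans-at β) j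
                             λ eq → ⊥-elim (β≢α (sym (trans-at-injective eq))))
                          (fr (trans-at β) j λ eq → ⊥-elim (β≢α (trans-at-injective eq)))
      kept : ∀ β → β ∈ (α ∷ []) ⊎ Written β e s σ → Written β e s σ₂
      kept β = λ where
        (inj₁ (here refl)) → new
        (inj₂ w) → [ (λ { refl → new }) , (λ β≢α x → trans (old β _ β≢α) (w x)) ]′ (toSum (β ≟ᵃ α))
      outside : ∀ b j → Outside s (suc s + count e) j → σ₂ b j ≡ σ b j
      outside b j out = trans (unwritten σ₁ (trans-at α) s i b j λ _ → not-start out)
                              (fr b j λ _ → shrink out)
      -- The final bag is discarded, and one of its leaves pays for writing the start state.
      time : t₁ + 1 ≤ 3 * size e
      time = ℕ.≤-trans (ℕ.+-monoʳ-≤ t₁ (leaves-positive E)) c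
    in
    writing {Q = λ _ σ′ t → σ′ ≡ σ₂ × t ≡ 1} (refl , refl) then
      λ { (refl , refl) → unshift t₁ (h (kept , outside) time) } }
    where
    unshift : ∀ t {σ} → Ends (f (suc s + count e)) σ (λ v σ″ u → Q v σ″ (t + 1 + u)) →
              Ends (f (suc s + count e)) σ (λ v σ″ u → Q v σ″ (t + (1 + u)))
    unshift t p = weaken p λ {v} {σ″} {u} → subst (Q v σ″) (ℕ.+-assoc t 1 u)
    not-start : ∀ {j} → Outside s (suc s + count e) j → s ≢ j
    not-start (inj₁ j<s) refl = ℕ.<-irrefl refl j<s
    not-start (inj₂ hi≤) refl = ℕ.<⇒≱ (ℕ.m≤m+n (suc s) (count e)) hi≤
    shrink : ∀ {j} → Outside s (suc s + count e) j → Outside (suc s) (suc s + count e) j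
    shrink (inj₁ j<s) = inj₁ (ℕ.m≤n⇒m≤1+n j<s)
    shrink (inj₂ hi≤) = inj₂ hi≤

  numbered-∷ : ∀ {e s α αs σ σ′ σ″} → Numbered e s (α ∷ []) σ σ′ → Numbered e s αs σ′ σ″ →
               Numbered e s (α ∷ αs) σ σ″
  numbered-∷ (w , fr) (w′ , fr′) =
    (λ where
      α (inj₁ (here eq))  → w′ α (inj₂ (w α (inj₁ (here eq))))
      α (inj₁ (there α∈)) → w′ α (inj₁ α∈)
      α (inj₂ wα)         → w′ α (inj₂ (w α (inj₂ wα)))) ,
    λ b j out → trans (fr′ b j out) (fr b j out)

  go-ends : ∀ e s αs {σ} → Ends (go e s αs (suc s + count e)) σ λ z σ′ t →
    z ≡ suc s + count e × Numbered e s αs σ σ′ × t ≤ length αs * (3 * size e) + 1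
  go-ends e s []       = returning (refl , ((λ { α (inj₂ w) → w }) , λ _ _ _ → refl) , ℕ.≤-refl)
  go-ends e s (α ∷ αs) = block-ends α e s λ numbered t≤ →
    weaken (go-ends e s αs) λ (eq , numbered′ , u≤) →
      eq , numbered-∷ numbered numbered′ ,
      ℕ.≤-trans (ℕ.+-mono-≤ t≤ u≤) (ℕ.≤-reflexive (sym (ℕ.+-assoc (3 * size e) _ 1)))

  -- The list must contain an atom: on an empty list the answer would be `suc s`, without room for
  -- the states of `e`.
  go₁-ends : ∀ e s αs {α σ} → α ∈ αs → Ends (go₁ e s αs) σ λ z σ′ t →
    z ≡ suc s + count e × Numbered e s αs σ σ′ × t ≤ length αs * (3 * size e) + 1
  go₁-ends e s (α ∷ αs) _ = block-ends α e s λ numbered t≤ →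
    weaken (go-ends e s αs) λ (eq , numbered′ , u≤) →
      eq , numbered-∷ numbered numbered′ ,
      ℕ.≤-trans (ℕ.+-mono-≤ t≤ u≤) (ℕ.≤-reflexive (sym (ℕ.+-assoc (3 * size e) _ 1)))

  enumᵀ : ∀ e → State (Thompson e) ↔ Fin (suc (count e))
  enumᵀ e = ↔-sym Fin.1↔⊤ ⊎-Fin enum e

  buildAutomaton-ends : ∀ e s {σ} → Ends (buildAutomaton e s) σ λ z σ′ t →
    z ≡ suc s + count e × Numbered e s (atoms k) σ σ′ × t ≤ length (atoms k) * (3 * size e) + 1
  buildAutomaton-ends e s {σ} = subst
    (λ c → Ends c σ λ z σ′ t → z ≡ suc s + count e × Numbered e s (atoms k) σ σ′ ×
                               t ≤ length (atoms k) * (3 * size e) + 1)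
    (sym (buildAutomaton≡ e s))
    (go₁-ends e s (atoms k) (atoms-complete (Vec.replicate k true)))

  index-enumᵀ : ∀ e s x → s + index (enumᵀ e) x ≡ numberᵀ e s x
  index-enumᵀ e s ι     = ℕ.+-identityʳ s
  index-enumᵀ e s ⟪ x ⟫ = trans (cong (s +_) (index-inj₂ (↔-sym Fin.1↔⊤) (enum e) x)) (ℕ.+-suc s _)

  numᵀ : ∀ e₁ e₂ → (State (Thompson e₁) ⊎ State (Thompson e₂)) ↔ Fin (suc (count e₁) + suc (count e₂))
  numᵀ e₁ e₂ = enumᵀ e₁ ⊎-Fin enumᵀ e₂

  numᵀ-inj₁ : ∀ e₁ e₂ x → index (numᵀ e₁ e₂) (inj₁ x) ≡ numberᵀ e₁ 0 x
  numᵀ-inj₁ e₁ e₂ x = trans (index-inj₁ (enumᵀ e₁) (enumᵀ e₂) x) (index-enumᵀ e₁ 0 x)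

  numᵀ-inj₂ : ∀ e₁ e₂ x → index (numᵀ e₁ e₂) (inj₂ x) ≡ numberᵀ e₂ (suc (count e₁)) x
  numᵀ-inj₂ e₁ e₂ x = trans (index-inj₂ (enumᵀ e₁) (enumᵀ e₂) x) (index-enumᵀ e₂ (suc (count e₁)) x)

  numberᵀ-upper : ∀ e s x → numberᵀ e s x < suc s + count e
  numberᵀ-upper e s ι     = ℕ.m≤m+n (suc s) (count e)
  numberᵀ-upper e s ⟪ x ⟫ = number-upper e (suc s) x

  thompson-ends : ∀ e₁ e₂ {σ} → let num = numᵀ e₁ e₂ in
    Ends (thompson e₁ e₂) σ λ r σ′ t →
      r ≡ (index num (inj₁ ι) , index num (inj₂ ι) , suc (count e₁) + suc (count e₂)) ×
      Stores σ′ (Thompson e₁ ⊕ Thompson e₂) num ×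
      t ≤ length (atoms k) * (3 * size e₁) + 1 + (length (atoms k) * (3 * size e₂) + 1 + 1)
  thompson-ends e₁ e₂ =
    buildAutomaton-ends e₁ 0 then λ { {σ′ = σ₁} (refl , (w₁ , _) , t₁≤) →
    buildAutomaton-ends e₂ (suc (count e₁)) then λ { {σ′ = σ₂} (refl , (w₂ , fr₂) , t₂≤) →
    returning
      ( cong₂ _,_ (sym (numᵀ-inj₁ e₁ e₂ ι))
          (cong₂ _,_ (sym (numᵀ-inj₂ e₁ e₂ ι)) (sym (cong suc (ℕ.+-suc (count e₁) (count e₂)))))
      , (λ where
          (inj₁ x) α → trans (cong (σ₂ (trans-at α)) (numᵀ-inj₁ e₁ e₂ x))
            (trans (fr₂ _ _ (inj₁ (numberᵀ-upper e₁ 0 x)))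
            (trans (w₁ α (inj₁ (atoms-complete α)) x)
              (sym (mapOut-∘ (numᵀ-inj₁ e₁ e₂) (δ (Thompson e₁) x α)))))
          (inj₂ x) α → trans (cong (σ₂ (trans-at α)) (numᵀ-inj₂ e₁ e₂ x))
            (trans (w₂ α (inj₁ (atoms-complete α)) x)
              (sym (mapOut-∘ (numᵀ-inj₂ e₁ e₂) (δ (Thompson e₂) x α)))))
      , ℕ.+-mono-≤ t₁≤ (ℕ.+-monoˡ-≤ 1 t₂≤) ) } }

-- Backward search for live states: invariants

module NormalizationRun (𝒜 : Actions) (k : ℕ) where

  open GKAT 𝒜 k
  open Coalgebra
  open Runs 𝒜 k

  pruned : ∀ {X : Set} → (X → Bool) → Out X → Out X
  pruned L (inj₁ v)   = inj₁ v
  pruned L (step p y) = if L y then step p y else reject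

  propagateBody : ⊤ → Prog (⊤ ⊎ ⊤)
  propagate≡ : propagate ≡ loop propagateBody tt
  propagateBody = _
  propagate≡ = refl

  module Search (N : ℕ) (T : ℕ → G ℕ)
                (closed : ∀ {x α p y} → x < N → T x α ≡ step p y → y < N) where

    𝒯 : Coalgebra
    𝒯 = coalgebra ℕ T

    -- The work that lies ahead: a state contributes while it is unmarked and while it waits in the
    -- list. Marking moves its weight from the second summand to the first, and only removal from
    -- the list lowers the total.
    Ψ : (ℕ → ℕ) → Store → ℕ
    Ψ w σ = sum (map w (σ work 0)) + ∑ N (λ y → if σ live y then 0 else w y)

    record Marked (x : ℕ) (σ σ′ : Store) : Set where
      field
        live-old   : ∀ {y} → σ′ live y ≡ true → y ∈ σ work 0 ⊎ σ live y ≡ true ⊎ y ≡ x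
        live-kept  : ∀ {y} → σ live y ≡ true → σ′ live y ≡ true
        live-new   : σ′ live x ≡ true
        work-old   : ∀ {y} → y ∈ σ′ work 0 → y ∈ σ work 0 ⊎ y ≡ x
        work-kept  : ∀ {y} → y ∈ σ work 0 → y ∈ σ′ work 0
        work-new   : ∀ {y} → σ′ live y ≡ true → σ live y ≡ true ⊎ y ∈ σ′ work 0
        Ψ-marked   : ∀ w → Ψ w σ′ ≤ Ψ w σ
        preds-same : ∀ y → σ′ preds y ≡ σ preds y
        trans-same : ∀ α y → σ′ (trans-at α) y ≡ σ (trans-at α) y
    open Marked

    mark-ends : ∀ x σ → x < N → Ends (mark x) σ λ _ σ′ t → Marked x σ σ′ × t ≤ 4
    mark-ends x σ x<N with σ live x in eq
    ... | true = read-then eq (returning (record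
      { live-old   = inj₂ ∘ inj₁
      ; live-kept  = id
      ; live-new   = eq
      ; work-old   = inj₁
      ; work-kept  = id
      ; work-new   = inj₁
      ; Ψ-marked   = λ w → ℕ.≤-refl
      ; preds-same = λ _ → refl
      ; trans-same = λ _ _ → refl
      } , s≤s (s≤s z≤n)))
    ... | false = read-then eq (write-then (read-then refl (ends ⇓write (record
      { live-old   = λ {y} h → [ (λ x≡y → inj₂ (inj₂ (sym x≡y))) ,
                                 (λ x≢y → inj₂ (inj₁ (trans (sym (unwritten σ live x true live y λ _ → x≢y)) h))) ]′
                               (toSum (x ≟ y))
      ; live-kept  = λ {y} h → [ (λ { refl → written σ live x true }) ,
                                 (λ x≢y → trans (unwritten σ live x true live y λ _ → x≢y) h) ]′
                               (toSum (x ≟ y))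
      ; live-new   = written σ live x true
      ; work-old   = λ { (here refl) → inj₂ refl ; (there h) → inj₁ h }
      ; work-kept  = there
      ; work-new   = λ {y} h → [ (λ { refl → inj₂ (here refl) }) ,
                                 (λ x≢y → inj₁ (trans (sym (unwritten σ live x true live y λ _ → x≢y)) h)) ]′
                               (toSum (x ≟ y))
      ; Ψ-marked   = λ w → let moved = ∑-update N {λ y → if σ₁ live y then 0 else w y} {unmarked w}
                                         x {w x} {0} x<N (same w) (ℕ.≤-reflexive (at w))
                           in ℕ.≤-trans (ℕ.≤-reflexive (rotate (w x) (sum (map w (σ work 0))) _))
                                (ℕ.+-monoʳ-≤ (sum (map w (σ work 0)))
                                  (ℕ.≤-trans moved (ℕ.≤-reflexive (ℕ.+-identityʳ _))))
      ; preds-same = λ _ → refl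
      ; trans-same = λ _ _ → refl
      } , s≤s (s≤s (s≤s (s≤s z≤n)))))))
      where
      σ₁ = σ [ live at x ]≔ true
      unmarked : (ℕ → ℕ) → ℕ → ℕ
      unmarked w y = if σ live y then 0 else w y
      same : ∀ w y → y < N → y ≢ x → (if σ₁ live y then 0 else w y) ≤ unmarked w y
      same w y _ y≢x = ℕ.≤-reflexive
        (cong (if_then 0 else w y) (unwritten σ live x true live y λ _ → y≢x ∘ sym))
      at : ∀ w → (if σ₁ live x then 0 else w x) + w x ≡ unmarked w x + 0
      at w rewrite written σ live x true | eq = sym (ℕ.+-identityʳ _)
      rotate : ∀ a b c → a + b + c ≡ b + (c + a)
      rotate = solve-∀

    -- The pairs still to be treated: rows are visited downwards, so these are all rows below `m`,
    -- and of row `m` the atoms in `αs`.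
    Rem : ℕ → List (At k) → ℕ → At k → Set
    Rem m αs x α = x < m ⊎ x ≡ m × α ∈ αs

    -- Being quantified over all weights, Ψ-bound says that the work list has no
    -- duplicates and contains only live states.
    record Scanned (rem : ℕ → At k → Set) (c : ℕ) (σ : Store) : Set where
      field
        trans-T   : ∀ α x → σ (trans-at α) x ≡ T x α
        sound     : ∀ {x} → x < N → σ live x ≡ true → Live 𝒯 x
        queued    : ∀ {x} → x < N → σ live x ≡ true → x ∈ σ work 0
        worked    : ∀ {y} → y ∈ σ work 0 → y < N × σ live y ≡ true
        preds-sound    : ∀ {x y} → y < N → x ∈ σ preds y → x < N × Edge 𝒯 x y
        preds-complete : ∀ {x α p y} → x < N → T x α ≡ step p y → rem x α ⊎ x ∈ σ preds y
        accepting      : ∀ {x α} → x < N → T x α ≡ accept → rem x α ⊎ σ live x ≡ true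
        Ψ-bound   : ∀ w → Ψ w σ ≤ ∑ N w
        preds-size : ∑ N (λ y → length (σ preds y)) ≤ c
    open Scanned

    -- The bookkeeping of one visited pair: an obligation excused as pending either stays pending or
    -- is the one discharged by `now`, while those already met persist by `later`.
    advance : ∀ {rem rem′ : ℕ → At k → Set} {A B : Set} {m α x β} →
      (∀ {x β} → rem x β → rem′ x β ⊎ x ≡ m × β ≡ α) →
      (x ≡ m → β ≡ α → B) → (A → B) → rem x β ⊎ A → rem′ x β ⊎ B
    advance split now later (inj₂ a) = inj₂ (later a)
    advance split now later (inj₁ r) with split r
    ... | inj₁ r′          = inj₁ r′
    ... | inj₂ (x≡m , β≡α) = inj₂ (now x≡m β≡α)

    scan-ends : ∀ {rem rem′ c σ} m α → m < N →
      (∀ {x β} → rem x β → rem′ x β ⊎ x ≡ m × β ≡ α) → Scanned rem c σ →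
      Ends (read (trans-at α) m >>= scan m) σ λ _ σ′ t → Scanned rem′ (suc c) σ′ × t ≤ 5
    scan-ends {rem} {rem′} {c} {σ} m α m<N split I with T m α in eq
    ... | reject = read-then (trans (trans-T I α m) eq) (returning (record
      { trans-T   = trans-T I
      ; sound     = sound I
      ; queued    = queued I
      ; worked    = worked I
      ; preds-sound    = preds-sound I
      ; preds-complete = λ x<N e →
          advance split (λ { refl refl → ⊥-elim (reject≢step (trans (sym eq) e)) }) id (preds-complete I x<N e)
      ; accepting      = λ x<N e →
          advance split (λ { refl refl → ⊥-elim (accept≢reject (trans (sym e) eq)) }) id (accepting I x<N e)
      ; Ψ-bound   = Ψ-bound I
      ; preds-size = ℕ.m≤n⇒m≤1+n (preds-size I)
      } , s≤s (s≤s z≤n)))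
    ... | accept = read-then (trans (trans-T I α m) eq) (weaken (mark-ends m σ m<N) λ {_} {σ′} (M , t≤) → record
      { trans-T   = λ β x → trans (trans-same M β x) (trans-T I β x)
      ; sound     = λ x<N h →
          [ (λ x∈ → sound I x<N (proj₂ (worked I x∈)))
          , [ sound I x<N , (λ { refl → m , ε , α , eq }) ]′ ]′ (live-old M h)
      ; queued    = λ x<N h → [ (λ l → work-kept M (queued I x<N l)) , id ]′ (work-new M h)
      ; worked    = λ y∈ → [ (λ y∈′ → let y<N , l = worked I y∈′ in y<N , live-kept M l) ,
                             (λ { refl → m<N , live-new M }) ]′ (work-old M y∈)
      ; preds-sound    = λ {x} {y} y<N x∈ → preds-sound I y<N (subst (x ∈_) (preds-same M y) x∈)
      ; preds-complete = λ {x} {_} {_} {y} x<N e →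
          advance split (λ { refl refl → ⊥-elim (accept≢step (trans (sym eq) e)) })
            (subst (x ∈_) (sym (preds-same M y))) (preds-complete I x<N e)
      ; accepting      = λ x<N e →
          advance split (λ { refl refl → live-new M }) (live-kept M) (accepting I x<N e)
      ; Ψ-bound   = λ w → ℕ.≤-trans (Ψ-marked M w) (Ψ-bound I w)
      ; preds-size = ℕ.m≤n⇒m≤1+n
          (ℕ.≤-trans (ℕ.≤-reflexive (∑-cong N λ y _ → cong length (preds-same M y))) (preds-size I))
      } , s≤s t≤)
    ... | step p z = read-then (trans (trans-T I α m) eq) (read-then refl (ends ⇓write (record
      { trans-T   = trans-T I
      ; sound     = sound I
      ; queued    = queued I
      ; worked    = worked I
      ; preds-sound    = λ {x} {y} y<N x∈ → pred-of x y x∈ (preds-sound I y<N)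
      ; preds-complete = λ {x} {_} {_} {y} x<N e →
          advance split (λ { refl refl → new (trans (sym eq) e) }) (old x y) (preds-complete I x<N e)
      ; accepting      = λ x<N e →
          advance split (λ { refl refl → ⊥-elim (accept≢step (trans (sym e) eq)) }) id (accepting I x<N e)
      ; Ψ-bound   = Ψ-bound I
      ; preds-size = ℕ.≤-trans (ℕ.≤-reflexive (sym (ℕ.+-identityʳ _))) (ℕ.≤-trans
                      (∑-update N z {0} {1} (closed m<N eq)
                        (λ y _ y≢z → ℕ.≤-reflexive (cong length (unwritten σ preds z xs preds y λ _ → y≢z ∘ sym)))
                        (ℕ.≤-reflexive (trans (ℕ.+-identityʳ _)
                          (trans (cong length (written σ preds z xs)) (ℕ.+-comm 1 _)))))
                      (ℕ.≤-trans (ℕ.≤-reflexive (ℕ.+-comm _ 1)) (s≤s (preds-size I))))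
      } , s≤s (s≤s (s≤s z≤n)))))
      where
      xs = m ∷ σ preds z
      σ₁ = σ [ preds at z ]≔ xs
      pred-of : ∀ x y → x ∈ σ₁ preds y → (x ∈ σ preds y → x < N × Edge 𝒯 x y) → x < N × Edge 𝒯 x y
      pred-of x y x∈ h with z ≟ y
      ... | no z≢y = h (subst (x ∈_) (unwritten σ preds z xs preds y λ _ → z≢y) x∈)
      ... | yes refl with subst (x ∈_) (written σ preds z xs) x∈
      ...   | here refl = m<N , α , p , eq
      ...   | there x∈′ = h x∈′
      old : ∀ x y → x ∈ σ preds y → x ∈ σ₁ preds y
      old x y x∈ with z ≟ y
      ... | yes refl = subst (x ∈_) (sym (written σ preds z xs)) (there x∈)
      ... | no z≢y   = subst (x ∈_) (sym (unwritten σ preds z xs preds y λ _ → z≢y)) x∈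
      new : ∀ {q y} → step p z ≡ step q y → m ∈ σ₁ preds y
      new refl = subst (m ∈_) (sym (written σ preds z xs)) (here refl)

-- Running the normalization: scanning, propagation, cutting

module NormalizationEnds (𝒜 : Actions) (k : ℕ) (N : ℕ) (T : ℕ → GKAT.G 𝒜 k ℕ)
  (closed : ∀ {x α p y} → x < N → T x α ≡ inj₂ (p , y) → y < N) where

  open GKAT 𝒜 k
  open Coalgebra
  open Runs 𝒜 k
  open NormalizationRun 𝒜 k
  open Search N T closed
  open Marked
  open Scanned

  K : ℕ
  K = length (atoms k)

  split-Rem : ∀ m α αs {x β} → Rem m (α ∷ αs) x β → Rem m αs x β ⊎ x ≡ m × β ≡ α
  split-Rem m α αs (inj₁ x<m)                = inj₁ (inj₁ x<m)
  split-Rem m α αs (inj₂ (x≡m , here β≡α))   = inj₂ (x≡m , β≡α)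
  split-Rem m α αs (inj₂ (x≡m , there β∈αs)) = inj₁ (inj₂ (x≡m , β∈αs))

  Rem-row : ∀ {m x β} → Rem (suc m) [] x β → Rem m (atoms k) x β
  Rem-row {m} {x} {β} (inj₁ x<1+m) with x ≟ m
  ... | yes refl = inj₂ (refl , atoms-complete β)
  ... | no x≢m   = inj₁ (ℕ.≤∧≢⇒< (ℕ.≤-pred x<1+m) x≢m)

  ¬Rem : ∀ {x β} → ¬ Rem 0 [] x β
  ¬Rem (inj₁ ())
  ¬Rem (inj₂ (_ , ()))

  Scanned-mono : ∀ {rem rem′ c c′ σ} → (∀ {x β} → rem x β → rem′ x β) → c ≤ c′ →
                 Scanned rem c σ → Scanned rem′ c′ σ
  Scanned-mono f c≤c′ I = record
    { trans-T = trans-T I ; sound = sound I ; queued = queued I ; worked = worked I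
    ; preds-sound = preds-sound I
    ; preds-complete = λ x<N e → [ inj₁ ∘ f , inj₂ ]′ (preds-complete I x<N e)
    ; accepting = λ x<N e → [ inj₁ ∘ f , inj₂ ]′ (accepting I x<N e)
    ; Ψ-bound = Ψ-bound I
    ; preds-size = ℕ.≤-trans (preds-size I) c≤c′
    }

  scanAll-ends : ∀ {σ} → Scanned (Rem N []) 0 σ →
    Ends (forBelow N λ x → forAtoms λ α → read (trans-at α) x >>= scan x) σ λ _ σ′ t →
      Scanned (Rem 0 []) (N * K) σ′ × t ≤ suc (N * suc (K * 5))
  scanAll-ends I₀ = weaken
    (forBelow-ends Outer (suc (K * 5)) N row (0 , I₀ , refl))
    λ { ((c , I , eq) , t≤) → Scanned-mono id (ℕ.≤-reflexive (trans (sym (ℕ.+-identityʳ c)) eq)) I , t≤ }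
    where
    -- `c` counts the pairs scanned so far. Each adds at most one entry to the predecessor lists,
    -- whence their total length of at most `N * K` in the end.
    Outer : ℕ → Store → Set
    Outer n σ = ∃[ c ] Scanned (Rem n []) c σ × c + n * K ≡ N * K
    Inner : ℕ → List (At k) → Store → Set
    Inner m αs σ = ∃[ c ] Scanned (Rem m αs) c σ × c + length αs + m * K ≡ N * K

    row : ∀ m {σ} → m < N → Outer (suc m) σ →
          Ends (forAtoms λ α → read (trans-at α) m >>= scan m) σ λ _ σ′ t →
            Outer m σ′ × t ≤ suc (K * 5)
    row m m<N (c , I , eq) = weaken
      (forEach-ends (Inner m) 5
        (λ { α αs (c , I , eq) → weaken (scan-ends m α m<N (split-Rem m α αs) I) λ (I′ , t≤) →
             (suc c , I′ , trans (cong (_+ m * K) (sym (ℕ.+-suc c (length αs)))) eq) , t≤ })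
        (atoms k) (c , Scanned-mono Rem-row ℕ.≤-refl I , trans (ℕ.+-assoc c K (m * K)) eq))
      λ { ((c′ , I′ , eq′) , t≤) →
          (c′ , I′ , trans (cong (_+ m * K) (sym (ℕ.+-identityʳ c′))) eq′) , t≤ }

  Initialized : ℕ → Store → Set
  Initialized n σ = (∀ α x → σ (trans-at α) x ≡ T x α) × σ work 0 ≡ [] ×
                    (∀ x → n ≤ x → x < N → σ live x ≡ false × σ preds x ≡ [])

  init-ends : ∀ {σ} → Initialized N σ →
    Ends (forBelow N λ x → write live x false >> write preds x []) σ λ _ σ′ t →
      Initialized 0 σ′ × t ≤ suc (N * 2)
  init-ends = forBelow-ends Initialized 2 N λ m {σ} _ (tr , w , done) →
    write-then (ends ⇓write ((tr , w , λ x m≤x x<N →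
      cell σ m x (λ m≢x → done x (ℕ.≤∧≢⇒< m≤x m≢x) x<N)) , ℕ.≤-refl))
    where
    cell : ∀ σ m x → (m ≢ x → σ live x ≡ false × σ preds x ≡ []) →
      let σ₁ = σ [ live at m ]≔ false ; σ₂ = σ₁ [ preds at m ]≔ [] in
      σ₂ live x ≡ false × σ₂ preds x ≡ []
    cell σ m x old with m ≟ x
    ... | yes refl = written σ live m false , written (σ [ live at m ]≔ false) preds m []
    ... | no m≢x = let l , p = old m≢x in
      trans (unwritten σ live m false live x λ _ → m≢x) l ,
      trans (unwritten (σ [ live at m ]≔ false) preds m [] preds x λ _ → m≢x) p

  initialized⇒scanned : ∀ {σ} → Initialized 0 σ → Scanned (Rem N []) 0 σ
  initialized⇒scanned {σ} (tr , w , blank) = record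
    { trans-T = tr
    ; sound  = λ x<N h → ⊥-elim (dead x<N h)
    ; queued = λ x<N h → ⊥-elim (dead x<N h)
    ; worked = λ y∈ → ⊥-elim (empty w y∈)
    ; preds-sound = λ y<N x∈ → ⊥-elim (empty (proj₂ (blank _ z≤n y<N)) x∈)
    ; preds-complete = λ x<N _ → inj₁ (inj₁ x<N)
    ; accepting = λ x<N _ → inj₁ (inj₁ x<N)
    ; Ψ-bound = λ v → ℕ.≤-trans (ℕ.≤-reflexive (cong (λ l → sum (map v l) + ∑ N λ y → if σ live y then 0 else v y) w))
        (∑-mono N λ y y<N → ℕ.≤-reflexive (cong (if_then 0 else v y) (proj₁ (blank y z≤n y<N))))
    ; preds-size = ℕ.≤-trans (∑-mono N λ y y<N → ℕ.≤-reflexive (cong length (proj₂ (blank y z≤n y<N))))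
        (ℕ.≤-reflexive (trans (∑-const N 0) (ℕ.*-zeroʳ N)))
    }
    where
    dead : ∀ {x} → x < N → ¬ σ live x ≡ true
    dead x<N h with () ← trans (sym h) (proj₁ (blank _ z≤n x<N))
    empty : ∀ {l : List ℕ} {y} → l ≡ [] → ¬ y ∈ l
    empty refl ()

  -- `pending` names the predecessors of the state just popped that await marking; between two
  -- iterations of the loop it is empty.
  record Propagating (pr : ℕ → List ℕ) (pending : ℕ → ℕ → Set) (σ : Store) : Set where
    field
      p-trans     : ∀ α x → σ (trans-at α) x ≡ T x α
      p-preds     : ∀ y → σ preds y ≡ pr y
      p-sound     : ∀ {x} → x < N → σ live x ≡ true → Live 𝒯 x
      p-worked    : ∀ {y} → y ∈ σ work 0 → y < N × σ live y ≡ true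
      p-accepting : ∀ {x α} → x < N → T x α ≡ accept → σ live x ≡ true
      p-closed    : ∀ {y} → y < N → σ live y ≡ true →
                    y ∈ σ work 0 ⊎ (∀ x → x ∈ pr y → σ live x ≡ true ⊎ pending x y)
  open Propagating

  module _ (pr : ℕ → List ℕ) (pr-sound : ∀ {x y} → y < N → x ∈ pr y → x < N × Edge 𝒯 x y) where

    -- One unit for popping `y` and one for each predecessor visited on that occasion.
    weight : ℕ → ℕ
    weight y = suc (length (pr y))

    None : ℕ → ℕ → Set
    None _ _ = ⊥

    extend-live : ∀ {x y} → Edge 𝒯 x y → Live 𝒯 y → Live 𝒯 x
    extend-live e (z , path , acc) = z , e ◅ path , acc

    marks-ends : ∀ y → y < N → Live 𝒯 y → ∀ xs m {σ} → (∀ {x} → x ∈ xs → x ∈ pr y) →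
      Propagating pr (λ x z → z ≡ y × x ∈ xs) σ → Ψ weight σ ≤ m →
      Ends (forEach xs mark) σ λ _ σ′ t →
        (Propagating pr None σ′ × Ψ weight σ′ ≤ m) × t ≤ suc (length xs * 4)
    marks-ends y y<N liveY xs m xs⊆ I Ψ≤ = weaken
      (forEach-ends (λ zs σ → (∀ {x} → x ∈ zs → x ∈ pr y) ×
          Propagating pr (λ x z → z ≡ y × x ∈ zs) σ × Ψ weight σ ≤ m) 4
        (λ { x zs {σ} (zs⊆ , I , Ψ≤) →
           let x<N , edge = pr-sound y<N (zs⊆ (here refl)) in
           weaken (mark-ends x σ x<N) λ {_} {σ′} (M , t≤) →
           ( (zs⊆ ∘ there)
           , record
             { p-trans     = λ α z → trans (trans-same M α z) (p-trans I α z)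
             ; p-preds     = λ z → trans (preds-same M z) (p-preds I z)
             ; p-sound     = λ z<N h → [ (λ z∈ → p-sound I z<N (proj₂ (p-worked I z∈)))
                                       , [ p-sound I z<N , (λ { refl → extend-live edge liveY }) ]′ ]′ (live-old M h)
             ; p-worked    = λ z∈ → [ (λ z∈′ → let z<N , l = p-worked I z∈′ in z<N , live-kept M l)
                                    , (λ { refl → x<N , live-new M }) ]′ (work-old M z∈)
             ; p-accepting = λ z<N e → live-kept M (p-accepting I z<N e)
             ; p-closed    = λ {z} z<N h → [ (λ l → [ inj₁ ∘ work-kept M
                                                , (λ c → inj₂ λ u u∈ → later M (c u u∈)) ]′ (p-closed I z<N l))
                                           , inj₁ ]′ (work-new M h)
             }
           , ℕ.≤-trans (Ψ-marked M weight) Ψ≤) , t≤ })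
        xs (xs⊆ , I , Ψ≤))
      λ { ((_ , I′ , Ψ≤′) , t≤) → (no-pending I′ , Ψ≤′) , t≤ }
      where
      later : ∀ {x zs σ σ′ u z} → Marked x σ σ′ →
              σ live u ≡ true ⊎ z ≡ y × u ∈ (x ∷ zs) → σ′ live u ≡ true ⊎ z ≡ y × u ∈ zs
      later M (inj₁ l)                   = inj₁ (live-kept M l)
      later M (inj₂ (_ , here refl))     = inj₁ (live-new M)
      later M (inj₂ (z≡y , there u∈zs)) = inj₂ (z≡y , u∈zs)

      no-pending : ∀ {σ} → Propagating pr (λ x z → z ≡ y × x ∈ []) σ → Propagating pr None σ
      no-pending I = record
        { p-trans = p-trans I ; p-preds = p-preds I ; p-sound = p-sound I ; p-worked = p-worked I
        ; p-accepting = p-accepting I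
        ; p-closed = λ z<N h →
            [ inj₁ , (λ c → inj₂ λ u u∈ → [ inj₁ , (λ { (_ , ()) }) ]′ (c u u∈)) ]′ (p-closed I z<N h)
        }

    private
      cost-pop : ∀ l t u m m′ → m′ + suc l ≤ m → t ≤ suc (l * 4) → u ≤ 9 * m′ + 3 →
                 suc (suc (suc (suc (t + 1))) + u) ≤ 9 * m + 3
      cost-pop l t u m m′ h₁ h₂ h₃ = by-sum (5 * l + 3)
        (ℕ.+-mono-≤ (scale 9 h₁) (ℕ.+-mono-≤ h₂ h₃))
        (solve (l ∷ t ∷ u ∷ m ∷ m′ ∷ []))

    -- Weights are positive, so every pop lowers `Ψ weight`, and marking the predecessors does not
    -- raise it again. The same quantity thus gives termination and time.
    propagate-ends : ∀ fuel σ → Ψ weight σ ≤ fuel → Propagating pr None σ →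
      Ends (loop propagateBody tt) σ λ _ σ′ t →
        Propagating pr None σ′ × σ′ work 0 ≡ [] × t ≤ 9 * Ψ weight σ + 3
    propagate-ends fuel σ Ψ≤ I with σ work 0 in eq
    ... | [] = exiting (read-then eq (returning (refl , I , eq , ℕ.m≤n+m 3 _)))
    propagate-ends zero σ () I | y ∷ w
    propagate-ends (suc fuel) σ Ψ≤ I | y ∷ w =
      repeating (read-then eq (write-then (read-then (p-preds I y)
        (marks-ends y (proj₁ y-ok) (p-sound I (proj₁ y-ok) (proj₂ y-ok)) (pr y) Ψ₁ id I₁ ℕ.≤-refl then
          λ { {_} {σ₂} {t} ((I₂ , Ψ≤′) , t≤) → returning (refl ,
            weaken (propagate-ends fuel σ₂ (ℕ.≤-trans Ψ≤′ Ψ₁≤) I₂)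
              λ { {_} {_} {u} (I₃ , empty , u≤) → I₃ , empty ,
                cost-pop (length (pr y)) t u _ (Ψ weight σ₂)
                  (ℕ.≤-trans (ℕ.+-monoˡ-≤ _ Ψ≤′) popped) t≤ u≤ }) }))))
      where
      σ₁ = σ [ work at 0 ]≔ w
      Ψ₁ = Ψ weight σ₁
      y-ok : y < N × σ live y ≡ true
      y-ok = p-worked I (subst (y ∈_) (sym eq) (here refl))
      rotate : ∀ a b c → a + b + c ≡ c + a + b
      rotate = solve-∀
      popped : Ψ₁ + weight y ≤ weight y + sum (map weight w) + ∑ N (λ y → if σ live y then 0 else weight y)
      popped = ℕ.≤-reflexive (rotate (sum (map weight w)) (∑ N (λ y → if σ live y then 0 else weight y)) (weight y))
      Ψ₁≤ : Ψ₁ ≤ fuel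
      Ψ₁≤ = ℕ.≤-pred (ℕ.≤-trans (ℕ.≤-reflexive (ℕ.+-comm 1 Ψ₁))
              (ℕ.≤-trans (ℕ.+-monoʳ-≤ Ψ₁ (s≤s z≤n)) (ℕ.≤-trans popped Ψ≤)))
      I₁ : Propagating pr (λ x z → z ≡ y × x ∈ pr y) σ₁
      I₁ = record
        { p-trans = p-trans I ; p-preds = p-preds I ; p-sound = p-sound I
        ; p-worked = λ z∈ → p-worked I (subst (_ ∈_) (sym eq) (there z∈))
        ; p-accepting = p-accepting I
        ; p-closed = λ {z} z<N h → [ (λ z∈ → shift (subst (z ∈_) eq z∈))
                                   , (λ c → inj₂ λ u u∈ → [ inj₁ , (λ ()) ]′ (c u u∈)) ]′ (p-closed I z<N h)
        }
        where
        shift : ∀ {z} → z ∈ (y ∷ w) → z ∈ w ⊎ (∀ x → x ∈ pr z → σ live x ≡ true ⊎ z ≡ y × x ∈ pr y)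
        shift (here refl) = inj₂ λ _ x∈ → inj₂ (refl , x∈)
        shift (there z∈)  = inj₁ z∈

  -- Induction on a path to an accepting state: its end is marked by the scan, and once the work
  -- list is empty `p-closed` passes the mark from each state to its predecessors.
  live-complete : ∀ {pr σ} → (∀ {x y α p} → x < N → T x α ≡ step p y → x ∈ pr y) →
    Propagating pr (λ _ _ → ⊥) σ → σ work 0 ≡ [] → ∀ {x} → x < N → Live 𝒯 x → σ live x ≡ true
  live-complete {pr} {σ} complete I empty = λ x<N (z , path , acc) → go x<N path acc
    where
    go : ∀ {x z} → x < N → Star (Edge 𝒯) x z → Accepting 𝒯 z → σ live x ≡ true
    go x<N ε (α , acc) = p-accepting I x<N acc
    go x<N ((α , p , e) ◅ path) acc with p-closed I (closed x<N e) (go (closed x<N e) path acc)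
    ... | inj₁ y∈ with () ← subst (_ ∈_) empty y∈
    ... | inj₂ c with c _ (complete x<N e)
    ...   | inj₁ l = l

  -- The marks `L` are fixed throughout, so cutting an entry never influences how another one is
  -- cut.
  CutState : (ℕ → Bool) → (ℕ → At k → Set) → Store → Set
  CutState L rem σ = (∀ y → σ live y ≡ L y) ×
    (∀ x α → x < N → rem x α × σ (trans-at α) x ≡ T x α ⊎ σ (trans-at α) x ≡ pruned L (T x α))

  module _ (L : ℕ → Bool) where

    cut-ends : ∀ {rem rem′ σ} m α → (∀ {x β} → rem x β → rem′ x β ⊎ x ≡ m × β ≡ α) → m < N →
      CutState L rem σ →
      Ends (read (trans-at α) m >>= cut α m) σ λ _ σ′ t → CutState L rem′ σ′ × t ≤ 3
    cut-ends {rem} {rem′} {σ} m α split m<N (lv , tr) with σ (trans-at α) m in eq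
    ... | inj₁ v = read-then eq (returning ((lv , same) , s≤s (s≤s z≤n)))
      where
      here-cut : σ (trans-at α) m ≡ pruned L (T m α)
      here-cut with tr m α m<N
      ... | inj₁ (_ , e) = trans eq (cong (pruned L) (trans (sym eq) e))
      ... | inj₂ e = e
      same : ∀ x β → x < N → _
      same x β x<N with tr x β x<N
      ... | inj₂ e = inj₂ e
      ... | inj₁ (r , e) with split r
      ...   | inj₁ r′            = inj₁ (r′ , e)
      ...   | inj₂ (refl , refl) = inj₂ here-cut
    ... | step p y with L y in Ly
    ...   | true = read-then eq (read-then (trans (lv y) Ly) (returning ((lv , same) , ℕ.≤-refl)))
      where
      here-cut : σ (trans-at α) m ≡ pruned L (T m α)
      here-cut with tr m α m<N
      ... | inj₁ (_ , e) = trans eq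
        (trans (cong (if_then step p y else reject) (sym Ly)) (cong (pruned L) (trans (sym eq) e)))
      ... | inj₂ e = e
      same : ∀ x β → x < N → _
      same x β x<N with tr x β x<N
      ... | inj₂ e = inj₂ e
      ... | inj₁ (r , e) with split r
      ...   | inj₁ r′            = inj₁ (r′ , e)
      ...   | inj₂ (refl , refl) = inj₂ here-cut
    ...   | false = read-then eq (read-then (trans (lv y) Ly) (ends ⇓write ((lv , same) , ℕ.≤-refl)))
      where
      σ₁ = σ [ trans-at α at m ]≔ reject
      here-cut : reject ≡ pruned L (T m α)
      here-cut with tr m α m<N
      ... | inj₁ (_ , e) = trans (cong (if_then step p y else reject) (sym Ly)) (cong (pruned L) (trans (sym eq) e))
      -- An entry that has been pruned before cannot be a step into the unmarked state `y`, so only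
      -- a rejecting entry is consistent here.
      ... | inj₂ e with T m α
      ...   | inj₁ v with () ← trans (sym eq) e
      ...   | step q z with L z in Lz
      ...     | false = refl
      ...     | true with refl ← trans (sym eq) e with () ← trans (sym Ly) Lz
      same : ∀ x β → x < N → rem′ x β × σ₁ (trans-at β) x ≡ T x β ⊎ σ₁ (trans-at β) x ≡ pruned L (T x β)
      same x β x<N = cases (toSum (m ≟ x)) (toSum (α ≟ᵃ β))
        where
        other : (x ≡ m → β ≢ α) → rem′ x β × σ (trans-at β) x ≡ T x β ⊎ σ (trans-at β) x ≡ pruned L (T x β)
        other ne with tr x β x<N
        ... | inj₂ e = inj₂ e
        ... | inj₁ (r , e) = inj₁ ([ id , (λ (a , b) → ⊥-elim (ne a b)) ]′ (split r) , e)
        unchanged : (trans-at α ≡ trans-at β → m ≢ x) → (x ≡ m → β ≢ α) → _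
        unchanged ne = subst (λ o → rem′ x β × o ≡ T x β ⊎ o ≡ pruned L (T x β))
          (sym (unwritten σ (trans-at α) m reject (trans-at β) x ne)) ∘ other
        cases : m ≡ x ⊎ m ≢ x → α ≡ β ⊎ α ≢ β → _
        cases (inj₁ refl) (inj₁ refl) = inj₂ (trans (written σ (trans-at α) m reject) here-cut)
        cases (inj₂ m≢x)  _           = unchanged (λ _ → m≢x) λ x≡m _ → m≢x (sym x≡m)
        cases (inj₁ _)    (inj₂ α≢β)  = unchanged (λ { refl → ⊥-elim (α≢β refl) }) λ _ β≡α → α≢β (sym β≡α)

    CutState-mono : ∀ {rem rem′ σ} → (∀ {x β} → rem x β → rem′ x β) → CutState L rem σ → CutState L rem′ σ
    CutState-mono f (lv , tr) = lv , λ x α x<N → [ (λ (r , e) → inj₁ (f r , e)) , inj₂ ]′ (tr x α x<N)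

    cutAll-ends : ∀ {σ} → CutState L (Rem N []) σ →
      Ends (forBelow N λ x → forAtoms λ α → read (trans-at α) x >>= cut α x) σ λ _ σ′ t →
        CutState L (Rem 0 []) σ′ × t ≤ suc (N * suc (K * 3))
    cutAll-ends = forBelow-ends (λ n → CutState L (Rem n [])) (suc (K * 3)) N λ m {σ} m<N I →
      forEach-ends (λ αs → CutState L (Rem m αs)) 3
        (λ α αs I → cut-ends m α (split-Rem m α αs) m<N I) (atoms k) (CutState-mono {σ = σ} Rem-row I)

  normalize-bound : ℕ
  normalize-bound = suc (suc (N * 2) + (suc (N * suc (K * 5)) + (9 * (N + N * K) + 3 + suc (N * suc (K * 3)))))

  normalize-ends : ∀ {σ} → (∀ α x → σ (trans-at α) x ≡ T x α) →
    Ends (normalize N) σ λ _ σ′ t →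
      (∀ {x} → x < N → σ′ live x ≡ true ⇔ Live 𝒯 x) ×
      (∀ {x} → x < N → ∀ α → σ′ (trans-at α) x ≡ pruned (σ′ live) (T x α)) ×
      t ≤ normalize-bound
  normalize-ends {σ} tr =
    write-then (init-ends (tr , refl , λ x N≤x x<N → ⊥-elim (ℕ.<⇒≱ x<N N≤x)) then λ (I₁ , t₁≤) →
    scanAll-ends (initialized⇒scanned I₁) then λ { {_} {σ₂} (I₂ , t₂≤) →
    let
      pr = σ₂ preds
      I₃ : Propagating pr (λ _ _ → ⊥) σ₂
      I₃ = record
        { p-trans = trans-T I₂ ; p-preds = λ _ → refl ; p-sound = sound I₂ ; p-worked = worked I₂
        ; p-accepting = λ x<N e → [ (λ r → ⊥-elim (¬Rem r)) , id ]′ (accepting I₂ x<N e)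
        ; p-closed = λ y<N h → inj₁ (queued I₂ y<N h)
        }
      -- The weights of all states add up to `N` plus the total length of the predecessor lists.
      total : Ψ (weight pr (preds-sound I₂)) σ₂ ≤ N + N * K
      total = ℕ.≤-trans (Ψ-bound I₂ _) (ℕ.≤-trans (ℕ.≤-reflexive (∑-suc N (λ y → length (pr y))))
                (ℕ.+-monoʳ-≤ N (preds-size I₂)))
    in
    propagate-ends pr (preds-sound I₂) _ σ₂ ℕ.≤-refl I₃ then λ { {_} {σ₃} (I₄ , empty , t₃≤) →
    weaken (cutAll-ends (σ₃ live) {σ₃} ((λ _ → refl) , λ x α x<N → inj₁ (inj₁ x<N , p-trans I₄ α x)))
      λ { {_} {σ₄} ((lv , pruned-ok) , t₄≤) →
        (λ {x} x<N → mk⇔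
          (λ h → p-sound I₄ x<N (trans (sym (lv x)) h))
          (λ h → trans (lv x) (live-complete
            (λ x<N e → [ (λ r → ⊥-elim (¬Rem r)) , id ]′ (preds-complete I₂ x<N e)) I₄ empty x<N h)))
        , (λ {x} x<N α → [ (λ (r , _) → ⊥-elim (¬Rem r))
                         , (λ e → trans e (pruned-cong (λ y → sym (lv y)) (T x α))) ]′ (pruned-ok x α x<N))
        , s≤s (ℕ.+-mono-≤ t₁≤ (ℕ.+-mono-≤ t₂≤ (ℕ.+-mono-≤
            (ℕ.≤-trans t₃≤ (ℕ.+-monoˡ-≤ 3 (scale 9 total))) t₄≤))) } } })
    where
    ∑-suc : ∀ n f → ∑ n (λ y → suc (f y)) ≡ n + ∑ n f
    ∑-suc zero    f = refl
    ∑-suc (suc n) f = cong suc (trans (cong (f n +_) (∑-suc n f)) (exchange (f n) n (∑ n f)))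
      where
      exchange : ∀ a b c → a + (b + c) ≡ b + (a + c)
      exchange = solve-∀
    pruned-cong : ∀ {L L′ : ℕ → Bool} → (∀ y → L y ≡ L′ y) → ∀ o → pruned L o ≡ pruned L′ o
    pruned-cong h (inj₁ v)   = refl
    pruned-cong h (step p y) = cong (if_then step p y else reject) (h y)

-- Union-find: forest invariant and amortized cost of `find`

module UnionFind (𝒜 : Actions) (k : ℕ) (N a : ℕ) (N<A : suc N < ackermann a 1) where

  open GKAT 𝒜 k
  open Runs 𝒜 k

  pot : Store → ℕ → ℕ
  pot σ x = if σ parent x ≡ᵇ x then a * suc (σ rank x)
            else φ a (suc (σ rank x)) (suc (σ rank (σ parent x)))

  Φ : Store → ℕ
  Φ σ = ∑ N (pot σ)

  rootCount : Store → ℕ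
  rootCount σ = ∑ N λ x → if σ parent x ≡ᵇ x then 1 else 0

  pot-root : ∀ σ x → σ parent x ≡ x → pot σ x ≡ a * suc (σ rank x)
  pot-root σ x eq rewrite ≡ᵇ-yes eq = refl

  pot-child : ∀ σ x {y} → σ parent x ≡ y → y ≢ x → pot σ x ≡ φ a (suc (σ rank x)) (suc (σ rank y))
  pot-child σ x refl ne rewrite ≡ᵇ-no ne = refl

  -- rep x is the root of the tree of x, and j counts the calls of link so far.
  record Forest (rep : ℕ → ℕ) (j : ℕ) (σ : Store) : Set where
    field
      parent<    : ∀ {x} → x < N → σ parent x < N
      rank-up    : ∀ {x} → x < N → σ parent x ≢ x → σ rank x < σ rank (σ parent x)
      rep<       : ∀ {x} → x < N → rep x < N
      rep-root   : ∀ {x} → x < N → σ parent (rep x) ≡ rep x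
      rep-parent : ∀ {x} → x < N → rep (σ parent x) ≡ rep x
      root-rep   : ∀ {x} → x < N → σ parent x ≡ x → rep x ≡ x
      rank-rep   : ∀ {x} → x < N → σ rank x ≤ σ rank (rep x)
      rank≤      : ∀ {x} → x < N → σ rank x ≤ j
      links      : j + rootCount σ ≤ N
  open Forest

  j≤N : ∀ {rep j σ} → Forest rep j σ → j ≤ N
  j≤N {j = j} F = ℕ.≤-trans (ℕ.m≤m+n j _) (links F)

  data Path (p : ℕ → ℕ) : ℕ → ℕ → ℕ → Set where
    root : ∀ {r} → p r ≡ r → Path p r r 0
    up   : ∀ {z r l} → p z ≢ z → Path p (p z) r l → Path p z r (suc l)

  -- Ranks strictly increase towards the root and never exceed `j`, so `j` minus the rank of `z` is
  -- enough fuel.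
  path : ∀ {rep j σ} → Forest rep j σ → ∀ fuel z → z < N → j ≤ σ rank z + fuel →
         ∃[ l ] Path (σ parent) z (rep z) l
  path {rep} {j} {σ} F fuel z z<N h with σ parent z ≟ z
  ... | yes p≡z = 0 , subst (λ r → Path (σ parent) z r 0) (sym (root-rep F z<N p≡z)) (root p≡z)
  path {rep} {j} {σ} F zero z z<N h | no p≢z = ⊥-elim (ℕ.<⇒≱ (rank-up F z<N p≢z)
    (ℕ.≤-trans (rank≤ F (parent< F z<N)) (ℕ.≤-trans h (ℕ.≤-reflexive (ℕ.+-identityʳ _)))))
  path {rep} {j} {σ} F (suc fuel) z z<N h | no p≢z =
    let l , π = path F fuel (σ parent z) (parent< F z<N)
                  (ℕ.≤-trans h (ℕ.≤-trans (ℕ.≤-reflexive (ℕ.+-suc _ fuel)) (ℕ.+-monoˡ-≤ fuel (rank-up F z<N p≢z))))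
    in suc l , up p≢z (subst (λ r → Path (σ parent) (σ parent z) r l) (rep-parent F z<N) π)

  climb : ℕ → Prog (ℕ ⊎ ℕ)
  climb z = read parent z >>= λ y → return (if y ≡ᵇ z then inj₂ z else inj₁ y)

  compress : ℕ → ℕ → Prog (ℕ ⊎ ⊤)
  compress r z = if z ≡ᵇ r then return (inj₂ tt) else
    (read parent z >>= λ y → write parent z r >> return (inj₁ y))

  climb-ends : ∀ {σ z r l} → Path (σ parent) z r l →
               Ends (loop climb z) σ λ v σ′ t → v ≡ r × σ′ ≡ σ × t ≡ 3 * suc l
  climb-ends {z = z} (root eq) = exiting (read-then eq
    (returning (cong (if_then inj₂ z else inj₁ z) (≡ᵇ-yes {z} refl) , refl , refl , refl)))
  climb-ends {σ} {z} (up {l = l} ne π) = repeating (read-then refl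
    (returning (cong (if_then inj₂ z else inj₁ (σ parent z)) (≡ᵇ-no ne) ,
      weaken (climb-ends π) λ { (v≡ , σ≡ , refl) → v≡ , σ≡ , sym (ℕ.*-suc 3 (suc l)) })))

  Untouched : Store → Store → Set
  Untouched σ σ′ = (∀ α i → σ′ (trans-at α) i ≡ σ (trans-at α) i) × (∀ i → σ′ queue i ≡ σ queue i)

  untouched-trans : ∀ {σ σ′ σ″} → Untouched σ σ′ → Untouched σ′ σ″ → Untouched σ σ″
  untouched-trans (t , q) (t′ , q′) =
    (λ α i → trans (t′ α i) (t α i)) , λ i → trans (q′ i) (q i)

  -- A single step of path compression. Only the parent of `z` changes, to the root of its tree, so
  -- representatives, roots and ranks stay as they are.
  module Reparent {rep : ℕ → ℕ} {j : ℕ} {σ : Store} (F : Forest rep j σ)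
                  {z : ℕ} (z<N : z < N) (z-child : σ parent z ≢ z)
                  {r : ℕ} (rep-z : rep z ≡ r) where
    y : ℕ
    y = σ parent z
    σ₁ : Store
    σ₁ = σ [ parent at z ]≔ r

    r<N : r < N
    r<N = subst (_< N) rep-z (rep< F z<N)

    r-root : σ parent r ≡ r
    r-root = subst (λ x → σ parent x ≡ x) rep-z (rep-root F z<N)

    r≢z : r ≢ z
    r≢z refl = z-child r-root

    rep-y : rep y ≡ r
    rep-y = trans (rep-parent F z<N) rep-z

    y≤r : σ rank y ≤ σ rank r
    y≤r = subst (λ r → σ rank y ≤ σ rank r) rep-y (rank-rep F (parent< F z<N))

    at : σ₁ parent z ≡ r
    at = written σ parent z r

    off : ∀ {x} → x ≢ z → σ₁ parent x ≡ σ parent x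
    off x≢z = unwritten σ parent z r parent _ λ _ → x≢z ∘ sym

    forest : Forest rep j σ₁
    forest = record
      { parent<    = λ {x} x<N → [ (λ { refl → subst (_< N) (sym at) r<N })
                                 , (λ x≢z → subst (_< N) (sym (off x≢z)) (parent< F x<N)) ]′ (toSum (x ≟ z))
      ; rank-up    = λ {x} x<N ne →
          [ (λ { refl → subst (λ y → σ rank z < σ rank y) (sym at) (ℕ.≤-trans (rank-up F z<N z-child) y≤r) })
          , (λ x≢z → subst (λ y → σ rank x < σ rank y) (sym (off x≢z)) (rank-up F x<N (ne ∘ trans (off x≢z))))
          ]′ (toSum (x ≟ z))
      ; rep<       = rep< F
      ; rep-root   = λ x<N →
          trans (off λ eq → z-child (subst (λ x → σ parent x ≡ x) eq (rep-root F x<N))) (rep-root F x<N)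
      ; rep-parent = λ {x} x<N →
          [ (λ { refl → trans (cong rep at) (trans (root-rep F r<N r-root) (sym rep-z)) })
          , (λ x≢z → trans (cong rep (off x≢z)) (rep-parent F x<N)) ]′ (toSum (x ≟ z))
      ; root-rep   = λ {x} x<N eq →
          [ (λ { refl → ⊥-elim (r≢z (trans (sym at) eq)) })
          , (λ x≢z → root-rep F x<N (trans (sym (off x≢z)) eq)) ]′ (toSum (x ≟ z))
      ; rank-rep   = rank-rep F
      ; rank≤      = rank≤ F
      ; links      = ℕ.≤-trans (ℕ.+-monoʳ-≤ j (∑-mono N λ x _ →
          [ (λ { refl → ℕ.≤-trans (ℕ.≤-reflexive (cong (if_then 1 else 0) (≡ᵇ-no (r≢z ∘ trans (sym at))))) z≤n })
          , (λ x≢z → ℕ.≤-reflexive (cong (λ y → if y ≡ᵇ x then 1 else 0) (off x≢z))) ]′ (toSum (x ≟ z)))) (links F)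
      }

    ρ : ℕ → ℕ
    ρ x = suc (σ rank x)

    -- `φ-step` for the node `z`, lifted to the whole sum. The two `coLevel` terms remain and cancel
    -- against those of the neighbouring nodes of the path.
    paid : Φ σ₁ + (1 + coLevel a (ρ z) (ρ r)) ≤ Φ σ + coLevel a (ρ y) (ρ r)
    paid = ∑-update N z z<N
      (λ x _ x≢z → ℕ.≤-reflexive (cong (λ y → if y ≡ᵇ x then a * suc (σ rank x) else φ a (ρ x) (ρ y)) (off x≢z)))
      (ℕ.≤-trans (ℕ.≤-reflexive (trans (cong (_+ (1 + coLevel a (ρ z) (ρ r))) (pot-child σ₁ z at r≢z))
                                       (sym (ℕ.+-assoc (φ a (ρ z) (ρ r)) 1 _))))
        (ℕ.≤-trans (φ-step a (s≤s z≤n) (s≤s (rank-up F z<N z-child)) (s≤s y≤r)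
                     (ℕ.≤-trans (s≤s (s≤s (ℕ.≤-trans (rank≤ F r<N) (j≤N F)))) N<A))
          (ℕ.≤-reflexive (cong (_+ coLevel a (ρ y) (ρ r)) (sym (pot-child σ z refl z-child))))))

  telescope : ∀ Φ Φ₁ Φ′ l cz cy → Φ₁ + (1 + cz) ≤ Φ + cy → Φ′ + l + cy ≤ Φ₁ + a → Φ′ + suc l + cz ≤ Φ + a
  telescope Φ Φ₁ Φ′ l cz cy h h′ = by-sum 0 (ℕ.+-mono-≤ h h′) (arith a Φ Φ₁ Φ′ l cz cy)
    where
    arith : ∀ a Φ Φ₁ Φ′ l cz cy →
      Φ′ + suc l + cz + (Φ + cy + (Φ₁ + a)) + 0 ≡ Φ + a + (Φ₁ + (1 + cz) + (Φ′ + l + cy))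
    arith = solve-∀

  -- The path is taken with respect to the parents `p` before compression. Nodes already redirected
  -- have rank below that of `z`, so from `z` on upwards the store still agrees with `p`.
  compress-ends : ∀ {rep j p r l σ} z → Forest rep j σ → z < N → rep z ≡ r → Path p z r l →
    (∀ {x} → σ rank z ≤ σ rank x → σ parent x ≡ p x) →
    Ends (loop (compress r) z) σ λ _ σ′ t →
      Forest rep j σ′ × Untouched σ σ′ × t ≤ 4 * suc l ×
      Φ σ′ + l + coLevel a (suc (σ rank z)) (suc (σ rank r)) ≤ Φ σ + a
  compress-ends {r = r} {σ = σ} .r F r<N rep-r (root eq) agree = exiting
    (if-true (≡ᵇ-yes {r} refl) (returning (refl , F , ((λ _ _ → refl) , λ _ → refl) , s≤s (s≤s z≤n) ,
      ℕ.+-mono-≤ (ℕ.≤-reflexive (ℕ.+-identityʳ _)) (coLevel-bound a _ (suc (σ rank r))))))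
  compress-ends {rep} {j} {p} {r} {suc l} {σ} z F z<N rep-z (up ne π) agree = repeating
    (if-false (≡ᵇ-no (r≢z ∘ sym)) (read-then refl (write-then (returning (refl ,
      weaken (compress-ends y forest (parent< F z<N) rep-y (subst (λ x → Path p x r l) (sym p≡) π) agree′)
        λ {v} {σ″} (F″ , same , t≤ , Φ≤) →
          F″ , same , ℕ.≤-trans (ℕ.+-monoʳ-≤ 4 t≤) (ℕ.≤-reflexive (sym (ℕ.*-suc 4 (suc l)))) ,
          telescope (Φ σ) (Φ σ₁) (Φ σ″) l (coLevel a (ρ z) (ρ r)) (coLevel a (ρ y) (ρ r)) paid Φ≤)))))
    where
    p≡ : σ parent z ≡ p z
    p≡ = agree ℕ.≤-refl
    open Reparent F z<N (ne ∘ trans (sym p≡)) rep-z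
    agree′ : ∀ {x} → σ rank y ≤ σ rank x → σ₁ parent x ≡ p x
    agree′ {x} y≤x = trans (off λ { refl → ℕ.<⇒≱ z<y y≤x }) (agree (ℕ.≤-trans (ℕ.<⇒≤ z<y) y≤x))
      where z<y = rank-up F z<N (ne ∘ trans (sym p≡))

  -- Climbing takes 3 steps per node and compressing at most 4, so one unit of potential has to buy
  -- 7 steps.
  find-cost : ∀ Φ Φ′ l c t₁ t₂ → t₁ ≡ 3 * suc l → t₂ ≤ 4 * suc l → Φ′ + l + c ≤ Φ + a →
              t₁ + (t₂ + 1) + 7 * Φ′ ≤ 7 * Φ + (7 * a + 8)
  find-cost Φ Φ′ l c t₁ t₂ refl h h′ = by-sum (7 * c) (ℕ.+-mono-≤ h (scale 7 h′)) (arith a Φ Φ′ l c t₂)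
    where
    arith : ∀ a Φ Φ′ l c t₂ → 3 * suc l + (t₂ + 1) + 7 * Φ′ + (4 * suc l + 7 * (Φ + a)) + 7 * c ≡
            7 * Φ + (7 * a + 8) + (t₂ + 7 * (Φ′ + l + c))
    arith = solve-∀

  find-ends : ∀ {rep j σ} x → Forest rep j σ → x < N → Ends (find x) σ λ v σ′ t →
    v ≡ rep x × Forest rep j σ′ × Untouched σ σ′ × t + 7 * Φ σ′ ≤ 7 * Φ σ + (7 * a + 8)
  find-ends {rep} {j} {σ} x F x<N =
    let l , π = path F j x x<N (ℕ.m≤n+m j _) in
    climb-ends π then λ { {t = t₁} (refl , refl , t₁≡) →
    compress-ends x F x<N refl π (λ _ → refl) then λ { {σ′ = σ′} {t₂} (F′ , same , t₂≤ , Φ≤) →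
    returning (refl , F′ , same , find-cost (Φ σ) (Φ σ′) l _ t₁ t₂ t₁≡ t₂≤ Φ≤) } }

-- Union-find: union by rank

module Union (𝒜 : Actions) (k : ℕ) (N a : ℕ) (N<A : suc N < ackermann a 1) where

  open GKAT 𝒜 k
  open Runs 𝒜 k
  open UnionFind 𝒜 k N a N<A
  open Forest

  joined : (ℕ → ℕ) → ℕ → ℕ → ℕ → ℕ
  joined rep c d x = if rep x ≡ᵇ c then d else rep x

  joined-child : ∀ {rep c d x} → rep x ≡ c → joined rep c d x ≡ d
  joined-child eq rewrite ≡ᵇ-yes eq = refl

  joined-other : ∀ {rep c d x} → rep x ≢ c → joined rep c d x ≡ rep x
  joined-other ne rewrite ≡ᵇ-no ne = refl

  -- Common to the three branches of `link`: `c` is the root that receives a parent, `d` the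
  -- surviving root, whose rank rises by at most one.
  module Attach {rep : ℕ → ℕ} {j : ℕ} {σ σ′ : Store} (F : Forest rep j σ) {c d : ℕ}
    (c<N : c < N) (d<N : d < N) (c≢d : c ≢ d) (c-root : σ parent c ≡ c) (d-root : σ parent d ≡ d)
    (parent-c : σ′ parent c ≡ d) (parent-off : ∀ {x} → x ≢ c → σ′ parent x ≡ σ parent x)
    (rank-off : ∀ {x} → x ≢ d → σ′ rank x ≡ σ rank x)
    (rank-lower : σ rank d ≤ σ′ rank d) (rank-upper : σ′ rank d ≤ suc (σ rank d))
    (c<d : σ rank c < σ′ rank d) where

    rep′ : ℕ → ℕ
    rep′ = joined rep c d

    child : ∀ {x} → rep x ≡ c → rep′ x ≡ d
    child {x} = joined-child {rep} {c} {d} {x}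

    other : ∀ {x} → rep x ≢ c → rep′ x ≡ rep x
    other {x} = joined-other {rep} {c} {d} {x}

    rank-mono : ∀ x → σ rank x ≤ σ′ rank x
    rank-mono x with x ≟ d
    ... | yes refl = rank-lower
    ... | no x≢d   = ℕ.≤-reflexive (sym (rank-off x≢d))

    rep-c : rep c ≡ c
    rep-c = root-rep F c<N c-root

    rep-d : rep d ≡ d
    rep-d = root-rep F d<N d-root

    rep′-c : rep′ c ≡ d
    rep′-c = child rep-c

    rep′-d : rep′ d ≡ d
    rep′-d = trans (other λ eq → c≢d (trans (sym eq) rep-d)) rep-d

    rep′-cong : ∀ {x y} → rep x ≡ rep y → rep′ x ≡ rep′ y
    rep′-cong eq = cong (λ r → if r ≡ᵇ c then d else r) eq

    joins : ∀ {x y} → rep x ≡ c → rep y ≡ d → rep′ x ≡ rep′ y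
    joins {x} {y} x≡ y≡ = trans (child x≡) (trans (sym rep′-d) (rep′-cong {d} {y} (trans rep-d (sym y≡))))

    joins-only : ∀ {x y} → rep′ x ≡ rep′ y → rep x ≡ rep y ⊎ rep x ≡ c × rep y ≡ d ⊎ rep x ≡ d × rep y ≡ c
    joins-only {x} {y} eq with rep x ≟ c | rep y ≟ c
    ... | yes p | yes q = inj₁ (trans p (sym q))
    ... | yes p | no ¬q = inj₂ (inj₁ (p , trans (sym (other ¬q)) (trans (sym eq) (child p))))
    ... | no ¬p | yes q = inj₂ (inj₂ (trans (sym (other ¬p)) (trans eq (child q)) , q))
    ... | no ¬p | no ¬q = inj₁ (trans (sym (other ¬p)) (trans eq (other ¬q)))

    forest : Forest rep′ (suc j) σ′
    forest = record
      { parent<    = λ {x} x<N → [ (λ { refl → subst (_< N) (sym parent-c) d<N })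
                                 , (λ x≢c → subst (_< N) (sym (parent-off x≢c)) (parent< F x<N)) ]′ (toSum (x ≟ c))
      ; rank-up    = λ {x} x<N ne →
          [ (λ { refl → subst (λ y → σ′ rank c < σ′ rank y) (sym parent-c)
                          (subst (_< σ′ rank d) (sym (rank-off c≢d)) c<d) })
          , (λ x≢c → let ne′ = ne ∘ trans (parent-off x≢c) in
              subst (λ y → σ′ rank x < σ′ rank y) (sym (parent-off x≢c))
                (subst (_< σ′ rank (σ parent x)) (sym (rank-off λ { refl → ne′ d-root }))
                  (ℕ.≤-trans (rank-up F x<N ne′) (rank-mono _)))) ]′ (toSum (x ≟ c))
      ; rep<       = λ {x} x<N → [ (λ eq → subst (_< N) (sym (child eq)) d<N)
                                 , (λ ne → subst (_< N) (sym (other ne)) (rep< F x<N)) ]′ (toSum (rep x ≟ c))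
      ; rep-root   = λ {x} x<N →
          [ (λ eq → subst (λ r → σ′ parent r ≡ r) (sym (child eq)) (trans (parent-off (c≢d ∘ sym)) d-root))
          , (λ ne → subst (λ r → σ′ parent r ≡ r) (sym (other ne)) (trans (parent-off ne) (rep-root F x<N)))
          ]′ (toSum (rep x ≟ c))
      ; rep-parent = λ {x} x<N →
          [ (λ { refl → trans (cong rep′ parent-c) (trans rep′-d (sym rep′-c)) })
          , (λ x≢c → trans (cong rep′ (parent-off x≢c)) (rep′-cong {σ parent x} {x} (rep-parent F x<N)))
          ]′ (toSum (x ≟ c))
      ; root-rep   = λ {x} x<N eq →
          [ (λ { refl → ⊥-elim (c≢d (trans (sym eq) parent-c)) })
          , (λ x≢c → let rep-x = root-rep F x<N (trans (sym (parent-off x≢c)) eq) in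
              trans (other (x≢c ∘ trans (sym rep-x))) rep-x) ]′ (toSum (x ≟ c))
      ; rank-rep   = λ {x} x<N →
          [ (λ { refl → ℕ.≤-reflexive (cong (σ′ rank) (sym rep′-d)) })
          , (λ x≢d → ℕ.≤-trans (ℕ.≤-reflexive (rank-off x≢d)) (ℕ.≤-trans (rank-rep F x<N)
              ([ (λ eq → ℕ.≤-trans (ℕ.≤-reflexive (cong (σ rank) eq)) (ℕ.≤-trans (ℕ.<⇒≤ c<d)
                           (ℕ.≤-reflexive (cong (σ′ rank) (sym (child eq))))))
               , (λ ne → ℕ.≤-trans (rank-mono _) (ℕ.≤-reflexive (cong (σ′ rank) (sym (other ne)))))
               ]′ (toSum (rep x ≟ c))))) ]′ (toSum (x ≟ d))
      ; rank≤      = λ {x} x<N →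
          [ (λ { refl → ℕ.≤-trans rank-upper (s≤s (rank≤ F d<N)) })
          , (λ x≢d → ℕ.≤-trans (ℕ.≤-reflexive (rank-off x≢d)) (ℕ.m≤n⇒m≤1+n (rank≤ F x<N))) ]′ (toSum (x ≟ d))
      ; links      = ℕ.≤-trans (ℕ.≤-trans (ℕ.≤-reflexive (sym (ℕ.+-suc j _))) (ℕ.+-monoʳ-≤ j fewer)) (links F)
      }
      where
      -- `c` ceases to be a root. This is what bounds the number of links, and through `rank≤` every
      -- rank, by `N`.
      fewer : suc (rootCount σ′) ≤ rootCount σ
      fewer = ℕ.≤-trans (ℕ.≤-reflexive (ℕ.+-comm 1 _)) (ℕ.≤-trans
        (∑-update N c {1} {0} c<N
          (λ x _ x≢c → ℕ.≤-reflexive (cong (λ y → if y ≡ᵇ x then 1 else 0) (parent-off x≢c)))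
          (ℕ.≤-reflexive (trans (cong (λ b → (if b then 1 else 0) + 1) (≡ᵇ-no (c≢d ∘ sym ∘ trans (sym parent-c))))
                                (sym (cong (λ b → (if b then 1 else 0) + 0) (≡ᵇ-yes c-root))))))
        (ℕ.≤-reflexive (ℕ.+-identityʳ _)))

    -- Only the surviving root can gain, and at most `a`, for one unit of rank. The node `c`
    -- exchanges its root potential for a value of `φ` below it, and for the others at most the rank
    -- of the parent grows.
    potential : Φ σ′ ≤ Φ σ + a
    potential = ℕ.≤-trans (ℕ.≤-reflexive (sym (ℕ.+-identityʳ _)))
      (∑-update N d {0} {a} d<N others (ℕ.≤-trans (ℕ.≤-reflexive (ℕ.+-identityʳ _)) at-d))
      where
      at-d : pot σ′ d ≤ pot σ d + a
      at-d rewrite pot-root σ′ d (trans (parent-off (c≢d ∘ sym)) d-root) | pot-root σ d d-root =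
        ℕ.≤-trans (scale a (s≤s rank-upper))
          (ℕ.≤-reflexive (trans (ℕ.*-suc a (suc (σ rank d))) (ℕ.+-comm a _)))
      others : ∀ x → x < N → x ≢ d → pot σ′ x ≤ pot σ x
      others x x<N x≢d with x ≟ c
      ... | yes refl rewrite pot-child σ′ c parent-c (c≢d ∘ sym) | pot-root σ c c-root | rank-off c≢d =
        φ-bound a (suc (σ rank c)) _
      ... | no x≢c with σ parent x ≟ x
      ...   | yes eq rewrite pot-root σ′ x (trans (parent-off x≢c) eq) | pot-root σ x eq | rank-off x≢d = ℕ.≤-refl
      ...   | no ne rewrite pot-child σ′ x (parent-off x≢c) ne | pot-child σ x refl ne | rank-off x≢d =
        φ-antitone a (suc (σ rank x)) (s≤s (rank-mono (σ parent x)))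

  record Linked (rep : ℕ → ℕ) (j r s : ℕ) (σ σ′ : Store) : Set where
    field
      newRep     : ℕ → ℕ
      newForest  : Forest newRep (suc j) σ′
      untouched  : Untouched σ σ′
      newΦ       : Φ σ′ ≤ Φ σ + a
      rep-kept   : ∀ {x y} → rep x ≡ rep y → newRep x ≡ newRep y
      rep-joined : ∀ {x y} → rep x ≡ r → rep y ≡ s → newRep x ≡ newRep y
      rep-only   : ∀ {x y} → newRep x ≡ newRep y →
                   rep x ≡ rep y ⊎ rep x ≡ r × rep y ≡ s ⊎ rep x ≡ s × rep y ≡ r

  attachRanked : ℕ → ℕ → ℕ → ℕ → Prog ⊤
  link≡ : ∀ r s → link r s ≡ (read rank r >>= λ i → read rank s >>= λ j → attachRanked r s i j)
  attachRanked = _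
  link≡ r s = refl

  attach-< : ∀ r s i j → i < j → attachRanked r s i j ≡ write parent r s
  attach-< r s i j i<j with ℕ.<-cmp i j
  ... | tri< _ _ _   = refl
  ... | tri≈ i≮j _ _ = ⊥-elim (i≮j i<j)
  ... | tri> i≮j _ _ = ⊥-elim (i≮j i<j)

  attach-> : ∀ r s i j → j < i → attachRanked r s i j ≡ write parent s r
  attach-> r s i j j<i with ℕ.<-cmp i j
  ... | tri> _ _ _   = refl
  ... | tri≈ _ _ j≮i = ⊥-elim (j≮i j<i)
  ... | tri< _ _ j≮i = ⊥-elim (j≮i j<i)

  attach-≈ : ∀ r s i j → i ≡ j → attachRanked r s i j ≡ (write parent r s >> write rank s (suc j))
  attach-≈ r s i j i≡j with ℕ.<-cmp i j
  ... | tri≈ _ _ _   = refl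
  ... | tri< _ i≢j _ = ⊥-elim (i≢j i≡j)
  ... | tri> _ i≢j _ = ⊥-elim (i≢j i≡j)

  link-ends : ∀ {rep j σ r s} → Forest rep j σ → r < N → s < N → r ≢ s →
    σ parent r ≡ r → σ parent s ≡ s →
    Ends (link r s) σ λ _ σ′ t → Linked rep j r s σ σ′ × t ≤ 4
  link-ends {rep} {j} {σ} {r} {s} F r<N s<N r≢s r-root s-root =
    read-then refl (read-then refl (attached (ℕ.<-cmp (σ rank r) (σ rank s))))
    where
    Post : ⊤ → Store → ℕ → Set
    Post _ σ′ t = Linked rep j r s σ σ′ × suc (suc t) ≤ 4
    attached : _ → Ends (attachRanked r s (σ rank r) (σ rank s)) σ Post
    attached (tri< r<s _ _) = subst (λ c → Ends c σ Post) (sym (attach-< r s _ _ r<s))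
      (ends ⇓write (record
        { newRep = rep′ ; newForest = forest ; untouched = (λ _ _ → refl) , λ _ → refl ; newΦ = potential
        ; rep-kept = λ {x} {y} → rep′-cong {x} {y} ; rep-joined = λ {x} {y} → joins {x} {y}
        ; rep-only = λ {x} {y} → joins-only {x} {y}
        } , s≤s (s≤s (s≤s z≤n))))
      where open Attach {σ′ = σ [ parent at r ]≔ s} F r<N s<N r≢s r-root s-root
                   (written σ parent r s) (λ x≢r → unwritten σ parent r s parent _ λ _ → x≢r ∘ sym)
                   (λ _ → refl) ℕ.≤-refl (ℕ.n≤1+n _) r<s
    attached (tri> _ _ s<r) = subst (λ c → Ends c σ Post) (sym (attach-> r s _ _ s<r))
      (ends ⇓write (record
        { newRep = rep′ ; newForest = forest ; untouched = (λ _ _ → refl) , λ _ → refl ; newΦ = potential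
        ; rep-kept = λ {x} {y} → rep′-cong {x} {y} ; rep-joined = λ {x} {y} x≡ y≡ → sym (joins {y} {x} y≡ x≡)
        ; rep-only = λ {x} {y} eq → [ inj₁ , [ inj₂ ∘ inj₂ , inj₂ ∘ inj₁ ]′ ]′ (joins-only {x} {y} eq)
        } , s≤s (s≤s (s≤s z≤n))))
      where open Attach {σ′ = σ [ parent at s ]≔ r} F s<N r<N (r≢s ∘ sym) s-root r-root
                   (written σ parent s r) (λ x≢s → unwritten σ parent s r parent _ λ _ → x≢s ∘ sym)
                   (λ _ → refl) ℕ.≤-refl (ℕ.n≤1+n _) s<r
    attached (tri≈ _ r≡s _) = subst (λ c → Ends c σ Post) (sym (attach-≈ r s _ _ r≡s))
      (write-then (ends ⇓write (record
        { newRep = rep′ ; newForest = forest ; untouched = (λ _ _ → refl) , λ _ → refl ; newΦ = potential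
        ; rep-kept = λ {x} {y} → rep′-cong {x} {y} ; rep-joined = λ {x} {y} → joins {x} {y}
        ; rep-only = λ {x} {y} → joins-only {x} {y}
        } , ℕ.≤-refl)))
      where
      σ₁ = σ [ parent at r ]≔ s
      bumped : (σ₁ [ rank at s ]≔ suc (σ rank s)) rank s ≡ suc (σ rank s)
      bumped = written σ₁ rank s (suc (σ rank s))
      open Attach {σ′ = σ₁ [ rank at s ]≔ suc (σ rank s)} F r<N s<N r≢s r-root s-root
             (written σ parent r s) (λ x≢r → unwritten σ parent r s parent _ λ _ → x≢r ∘ sym)
             (λ x≢s → unwritten σ₁ rank s (suc (σ rank s)) rank _ λ _ → x≢s ∘ sym)
             (ℕ.≤-trans (ℕ.n≤1+n _) (ℕ.≤-reflexive (sym bumped))) (ℕ.≤-reflexive bumped)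
             (ℕ.≤-trans (ℕ.≤-reflexive (cong suc r≡s)) (ℕ.≤-reflexive (sym bumped)))

-- Hopcroft-Karp: queue, classes and cost

module HopcroftKarpRun (𝒜 : Actions) (k : ℕ) (N a : ℕ) (N<A : suc N < ackermann a 1)
  (T : ℕ → GKAT.G 𝒜 k ℕ) (closed : ∀ {x α p y} → x < N → T x α ≡ inj₂ (p , y) → y < N) where

  open Actions 𝒜
  open GKAT 𝒜 k
  open Runs 𝒜 k
  open UnionFind 𝒜 k N a N<A
  open Union 𝒜 k N a N<A
  open Forest
  open Linked

  K : ℕ
  K = length (atoms k)

  OutRel : (ℕ → ℕ → Set) → Out ℕ → Out ℕ → Set
  OutRel E (inj₁ v)   (inj₁ w)   = v ≡ w
  OutRel E (step p x) (step q y) = p ≡ q × E x y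
  OutRel E _          _          = ⊥

  module _ {E : ℕ → ℕ → Set} (≈ : IsEquivalence E) where
    private module ≈ = IsEquivalence ≈

    OutRel-sym : ∀ o o′ → OutRel E o o′ → OutRel E o′ o
    OutRel-sym (inj₁ v)   (inj₁ w)   eq       = sym eq
    OutRel-sym (step p x) (step q y) (eq , e) = sym eq , ≈.sym e

    OutRel-refl : ∀ o → OutRel E o o
    OutRel-refl (inj₁ v)   = refl
    OutRel-refl (step p x) = refl , ≈.refl

    OutRel-trans : ∀ o o′ o″ → OutRel E o o′ → OutRel E o′ o″ → OutRel E o o″
    OutRel-trans (inj₁ u)   (inj₁ v)   (inj₁ w)   eq       eq′        = trans eq eq′
    OutRel-trans (step p x) (step q y) (step r z) (eq , e) (eq′ , e′) = trans eq eq′ , ≈.trans e e′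

  -- Both automata sit side by side in memory, so a bisimulation is here a relation on the states of
  -- one automaton.
  Bisim : (ℕ → ℕ → Set) → Set
  Bisim B = ∀ x y → B x y → ∀ α → OutRel B (T x α) (T y α)

  Segment : Store → ℕ → ℕ → (ℕ → ℕ → Set) → Set
  Segment σ head tail E = ∀ i → head ≤ i → i < tail → E (proj₁ (σ queue i)) (proj₂ (σ queue i))

  -- `matching` serves the answer true and `necessary` the answer false; both are stated for
  -- arbitrary relations because the classes keep changing after the comparison.
  record Pushed (αs : List (At k)) (x y tail : ℕ) (σ σ′ : Store) (tail′ : ℕ) : Set₁ where
    field
      tail≤tail′ : tail ≤ tail′
      tail′≤     : tail′ ≤ tail + length αs
      old        : ∀ i → i < tail → σ′ queue i ≡ σ queue i
      matching   : ∀ E → Segment σ′ tail tail′ E → ∀ {α} → α ∈ αs → OutRel E (T x α) (T y α)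
      in-range   : x < N → y < N → Segment σ′ tail tail′ (λ u v → u < N × v < N)
      necessary  : ∀ B → Bisim B → B x y → Segment σ′ tail tail′ B
  open Pushed

  record Kept (σ σ′ : Store) : Set where
    field
      forest-kept : ∀ {rep j} → Forest rep j σ → Forest rep j σ′
      Φ-kept      : Φ σ′ ≡ Φ σ
      trans-kept  : ∀ α i → σ′ (trans-at α) i ≡ σ (trans-at α) i
  open Kept

  Compared : List (At k) → (x y tail : ℕ) → Store → Maybe ℕ → Store → Set₁
  Compared αs x y tail σ nothing      σ′ = ∀ B → Bisim B → ¬ B x y
  Compared αs x y tail σ (just tail′) σ′ = Pushed αs x y tail σ σ′ tail′ × Kept σ σ′

  push-kept : ∀ {σ σ′ i v} → Kept (σ [ queue at i ]≔ v) σ′ → Kept σ σ′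
  push-kept κ = record
    { forest-kept = λ F → forest-kept κ (record
      { parent< = parent< F ; rank-up = rank-up F ; rep< = rep< F ; rep-root = rep-root F
      ; rep-parent = rep-parent F ; root-rep = root-rep F ; rank-rep = rank-rep F
      ; rank≤ = rank≤ F ; links = links F })
    ; Φ-kept = Φ-kept κ
    ; trans-kept = trans-kept κ
    }

  mismatch : ∀ x y α → (∀ B → ¬ OutRel B (T x α) (T y α)) → ∀ B → Bisim B → ¬ B x y
  mismatch x y α ne B bisim b = ne B (bisim x y b α)

  -- Each atom costs two reads and at most one write to the queue.
  more : ∀ d (αs : List (At k)) {t} → d ≤ 3 → t ≤ 3 * length αs + 1 → d + t ≤ 3 * suc (length αs) + 1
  more d αs d≤ t≤ = ℕ.≤-trans (ℕ.+-mono-≤ d≤ t≤) (ℕ.≤-reflexive (arith (length αs)))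
    where
    arith : ∀ l → 3 + (3 * l + 1) ≡ 3 * suc l + 1
    arith = solve-∀

  three-steps : ∀ (αs : List (At k)) → 3 ≤ 3 * suc (length αs) + 1
  three-steps αs = ℕ.≤-trans (scale 3 (s≤s z≤n)) (ℕ.m≤m+n _ 1)

  compare-ends : ∀ αs x y tail {σ} → (∀ α i → σ (trans-at α) i ≡ T i α) →
    Ends (compare αs x y tail) σ λ m σ′ t → Compared αs x y tail σ m σ′ × t ≤ 3 * length αs + 1
  compare-ends [] x y tail tr = returning ((record
    { tail≤tail′ = ℕ.≤-refl
    ; tail′≤     = ℕ.≤-reflexive (sym (ℕ.+-identityʳ tail))
    ; old        = λ _ _ → refl
    ; matching   = λ _ _ ()
    ; in-range   = λ _ _ i l h → ⊥-elim (ℕ.<⇒≱ h l)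
    ; necessary  = λ _ _ _ i l h → ⊥-elim (ℕ.<⇒≱ h l)
    } , record { forest-kept = id ; Φ-kept = refl ; trans-kept = λ _ _ → refl }) , ℕ.≤-refl)
  compare-ends (α ∷ αs) x y tail {σ} tr with T x α in eqx | T y α in eqy
  ... | inj₁ v | step q y′ = read-then (trans (tr α x) eqx) (read-then (trans (tr α y) eqy)
        (returning ((mismatch x y α λ B r → subst₂ (OutRel B) eqx eqy r) , three-steps αs)))
  ... | step p x′ | inj₁ w = read-then (trans (tr α x) eqx) (read-then (trans (tr α y) eqy)
        (returning ((mismatch x y α λ B r → subst₂ (OutRel B) eqx eqy r) , three-steps αs)))
  ... | inj₁ v | inj₁ w = read-then (trans (tr α x) eqx) (read-then (trans (tr α y) eqy) (same (v Bool.≟ w)))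
    where
    Post : Maybe ℕ → Store → ℕ → Set₁
    Post m σ′ t = Compared (α ∷ αs) x y tail σ m σ′ × suc (suc t) ≤ 3 * length (α ∷ αs) + 1
    extend : ∀ {t} → v ≡ w → ∀ m σ′ → Compared αs x y tail σ m σ′ × t ≤ 3 * length αs + 1 → Post m σ′ t
    extend v≡w nothing       σ′ (ne , t≤) = ne , more 2 αs (ℕ.n≤1+n 2) t≤
    extend v≡w (just tail′) σ′ ((P , κ) , t≤) = (record
      { tail≤tail′ = tail≤tail′ P
      ; tail′≤     = ℕ.≤-trans (tail′≤ P) (ℕ.+-monoʳ-≤ tail (ℕ.n≤1+n _))
      ; old        = old P
      ; matching   = λ { E seg (here refl) → subst₂ (OutRel E) (sym eqx) (sym eqy) v≡w
                       ; E seg (there α∈)  → matching P E seg α∈ }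
      ; in-range   = in-range P
      ; necessary  = necessary P
      } , κ) , more 2 αs (ℕ.n≤1+n 2) t≤
    same : (d : Dec (v ≡ w)) → Ends (if does d then compare αs x y tail else return nothing) σ Post
    same (yes v≡w) = weaken (compare-ends αs x y tail tr) λ {m} {σ′} → extend v≡w m σ′
    same (no v≢w)  = returning ((mismatch x y α λ B r → v≢w (subst₂ (OutRel B) eqx eqy r)) , three-steps αs)
  ... | step p x′ | step q y′ = read-then (trans (tr α x) eqx) (read-then (trans (tr α y) eqy) (same (p ≟ₚ q)))
    where
    σ₁ = σ [ queue at tail ]≔ (x′ , y′)
    Post : Maybe ℕ → Store → ℕ → Set₁
    Post m σ′ t = Compared (α ∷ αs) x y tail σ m σ′ × suc (suc t) ≤ 3 * length (α ∷ αs) + 1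
    extend : ∀ {t} → p ≡ q → ∀ m σ′ → Compared αs x y (suc tail) σ₁ m σ′ × t ≤ 3 * length αs + 1 → Post m σ′ (suc t)
    extend p≡q nothing       σ′ (ne , t≤) = ne , more 3 αs ℕ.≤-refl t≤
    extend p≡q (just tail′) σ′ ((P , κ) , t≤) = (record
      { tail≤tail′ = ℕ.≤-trans (ℕ.n≤1+n _) (tail≤tail′ P)
      ; tail′≤     = ℕ.≤-trans (tail′≤ P) (ℕ.≤-reflexive (sym (ℕ.+-suc tail (length αs))))
      ; old        = λ i i<tail → trans (old P i (ℕ.m≤n⇒m≤1+n i<tail))
                       (unwritten σ queue tail (x′ , y′) queue i λ _ → ℕ.<⇒≢ i<tail ∘ sym)
      ; matching   = λ { E seg (here refl) → subst₂ (OutRel E) (sym eqx) (sym eqy)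
                           (p≡q , subst (λ v → E (proj₁ v) (proj₂ v)) at-tail (seg tail ℕ.≤-refl (tail≤tail′ P)))
                       ; E seg (there α∈)  → matching P E (λ i l h → seg i (ℕ.≤-trans (ℕ.n≤1+n _) l) h) α∈ }
      ; in-range   = λ x<N y<N → grow (λ u v → u < N × v < N) (closed x<N eqx , closed y<N eqy) (in-range P x<N y<N)
      ; necessary  = λ B bisim b → grow B (proj₂ (subst₂ (OutRel B) eqx eqy (bisim x y b α))) (necessary P B bisim b)
      } , push-kept κ) , more 3 αs ℕ.≤-refl t≤
      where
      at-tail : σ′ queue tail ≡ (x′ , y′)
      at-tail = trans (old P tail ℕ.≤-refl) (written σ queue tail (x′ , y′))
      grow : ∀ E → E x′ y′ → Segment σ′ (suc tail) tail′ E → Segment σ′ tail tail′ E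
      grow E e seg i l h with tail ≟ i
      ... | yes refl  = subst (λ v → E (proj₁ v) (proj₂ v)) (sym at-tail) e
      ... | no tail≢i = seg i (ℕ.≤∧≢⇒< l tail≢i) h
    same : (d : Dec (p ≡ q)) → Ends (if does d then (write queue tail (x′ , y′) >> compare αs x y (suc tail))
                                     else return nothing) σ Post
    same (yes p≡q) = write-then (weaken (compare-ends αs x y (suc tail) tr) λ {m} {σ′} → extend p≡q m σ′)
    same (no p≢q)  = returning ((mismatch x y α λ B r → p≢q (proj₁ (subst₂ (OutRel B) eqx eqy r))) , three-steps αs)

  module Loop (s₁ s₂ : ℕ) where

    hkBody : ℕ × ℕ → Prog ((ℕ × ℕ) ⊎ Bool)
    hopcroftKarp≡ : hopcroftKarp s₁ s₂ N ≡
      (forBelow N (λ x → write parent x x >> write rank x 0) >>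
       (write queue 0 (s₁ , s₂) >> loop hkBody (0 , 1)))
    hkBody = _
    hopcroftKarp≡ = refl

    -- Bounds the number of pairs ever enqueued: the start pair, and at most `K` pairs for each of
    -- at most `N` unions.
    M : ℕ
    M = 1 + N * K

    -- The amortized cost of an iteration that ends in a union: two finds at `7 * a + 8` each, the
    -- comparison at `3 * K + 1`, the link at 4 steps plus 7 times the gain `a` in potential, and
    -- one step each for the loop, the read of the queue and the `return`.
    D : ℕ
    D = 21 * a + 3 * K + 24

    -- Both halves of progress hold modulo every equivalence that contains the
    -- classes of the forest and the queue; once the queue is empty, the classes
    -- themselves form such an equivalence.
    record Running (rep : ℕ → ℕ) (j head tail : ℕ) (σ : Store) : Set₁ where
      field
        forest    : Forest rep j σ
        tr        : ∀ α x → σ (trans-at α) x ≡ T x α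
        head≤tail : head ≤ tail
        tail≤     : tail ≤ 1 + j * K
        in-bounds : Segment σ head tail λ u v → u < N × v < N
        progress  : ∀ E → IsEquivalence E →
          (∀ {x y} → x < N → y < N → rep x ≡ rep y → E x y) → Segment σ head tail E →
          E s₁ s₂ × (∀ {x y} → x < N → y < N → rep x ≡ rep y → ∀ α → OutRel E (T x α) (T y α))
        required  : ∀ B → Bisim B → B s₁ s₂ → Segment σ head tail B
    open Running

    Result : Bool → Set₁
    Result true  = Lift (Level.suc 0ℓ) (Σ[ rep ∈ (ℕ → ℕ) ] rep s₁ ≡ rep s₂ ×
      (∀ {x y} → x < N → y < N → rep x ≡ rep y → ∀ α → OutRel (λ u v → rep u ≡ rep v) (T x α) (T y α)))
    Result false = ∀ B → Bisim B → ¬ B s₁ s₂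

    tail≤M : ∀ {rep j head tail σ} → Running rep j head tail σ → tail ≤ M
    tail≤M R = ℕ.≤-trans (tail≤ R) (s≤s (ℕ.*-monoˡ-≤ K (j≤N (forest R))))

    cost-skip : ∀ Φ Φ₁ Φ₂ f₁ f₂ u rest →
      f₁ + 7 * Φ₁ ≤ 7 * Φ + (7 * a + 8) → f₂ + 7 * Φ₂ ≤ 7 * Φ₁ + (7 * a + 8) →
      u ≤ D * rest + 7 * Φ₂ + 2 → suc (suc (f₁ + (f₂ + 1)) + u) ≤ D * suc rest + 7 * Φ + 2
    cost-skip Φ Φ₁ Φ₂ f₁ f₂ u rest h₁ h₂ h₃ = by-sum (7 * a + 3 * K + 5)
      (ℕ.+-mono-≤ h₁ (ℕ.+-mono-≤ h₂ h₃)) (arith a K Φ Φ₁ Φ₂ f₁ f₂ u rest)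
      where
      arith : ∀ a K Φ Φ₁ Φ₂ f₁ f₂ u rest →
        suc (suc (f₁ + (f₂ + 1)) + u) +
        (7 * Φ + (7 * a + 8) + (7 * Φ₁ + (7 * a + 8) + ((21 * a + 3 * K + 24) * rest + 7 * Φ₂ + 2))) +
        (7 * a + 3 * K + 5) ≡
        (21 * a + 3 * K + 24) * suc rest + 7 * Φ + 2 + (f₁ + 7 * Φ₁ + (f₂ + 7 * Φ₂ + u))
      arith = solve-∀

    cost-fail : ∀ Φ Φ₁ Φ₂ f₁ f₂ c rest →
      f₁ + 7 * Φ₁ ≤ 7 * Φ + (7 * a + 8) → f₂ + 7 * Φ₂ ≤ 7 * Φ₁ + (7 * a + 8) → c ≤ 3 * K + 1 →
      suc (suc (f₁ + (f₂ + (c + 1)))) ≤ D * suc rest + 7 * Φ + 2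
    cost-fail Φ Φ₁ Φ₂ f₁ f₂ c rest h₁ h₂ h₃ =
      by-sum (7 * a + 6 + D * rest + 7 * Φ₂) (ℕ.+-mono-≤ h₁ (ℕ.+-mono-≤ h₂ h₃)) (arith a K Φ Φ₁ Φ₂ f₁ f₂ c rest)
      where
      arith : ∀ a K Φ Φ₁ Φ₂ f₁ f₂ c rest →
        suc (suc (f₁ + (f₂ + (c + 1)))) +
        (7 * Φ + (7 * a + 8) + (7 * Φ₁ + (7 * a + 8) + (3 * K + 1))) +
        (7 * a + 6 + (21 * a + 3 * K + 24) * rest + 7 * Φ₂) ≡
        (21 * a + 3 * K + 24) * suc rest + 7 * Φ + 2 + (f₁ + 7 * Φ₁ + (f₂ + 7 * Φ₂ + c))
      arith = solve-∀

    cost-link : ∀ Φ Φ₁ Φ₂ Φ₃ f₁ f₂ c l u rest →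
      f₁ + 7 * Φ₁ ≤ 7 * Φ + (7 * a + 8) → f₂ + 7 * Φ₂ ≤ 7 * Φ₁ + (7 * a + 8) → c ≤ 3 * K + 1 → l ≤ 4 →
      Φ₃ ≤ Φ₂ + a → u ≤ D * rest + 7 * Φ₃ + 2 →
      suc (suc (f₁ + (f₂ + (c + (l + 1)))) + u) ≤ D * suc rest + 7 * Φ + 2
    cost-link Φ Φ₁ Φ₂ Φ₃ f₁ f₂ c l u rest h₁ h₂ h₃ h₄ h₅ h₆ =
      by-sum 0 (ℕ.+-mono-≤ h₁ (ℕ.+-mono-≤ h₂ (ℕ.+-mono-≤ h₃ (ℕ.+-mono-≤ h₄ (ℕ.+-mono-≤ (scale 7 h₅) h₆)))))
        (arith a K Φ Φ₁ Φ₂ Φ₃ f₁ f₂ c l u rest)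
      where
      arith : ∀ a K Φ Φ₁ Φ₂ Φ₃ f₁ f₂ c l u rest →
        suc (suc (f₁ + (f₂ + (c + (l + 1)))) + u) +
        (7 * Φ + (7 * a + 8) + (7 * Φ₁ + (7 * a + 8) + (3 * K + 1 + (4 +
          (7 * (Φ₂ + a) + ((21 * a + 3 * K + 24) * rest + 7 * Φ₃ + 2)))))) + 0 ≡
        (21 * a + 3 * K + 24) * suc rest + 7 * Φ + 2 + (f₁ + 7 * Φ₁ + (f₂ + 7 * Φ₂ + (c + (l + (7 * Φ₃ + u)))))
      arith = solve-∀

    segment-cons : ∀ {σ head tail} (E : ℕ → ℕ → Set) → E (proj₁ (σ queue head)) (proj₂ (σ queue head)) →
                   Segment σ (suc head) tail E → Segment σ head tail E
    segment-cons {head = head} E e seg i l h with head ≟ i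
    ... | yes refl   = e
    ... | no head≢i = seg i (ℕ.≤∧≢⇒< l head≢i) h

    -- `rest` is what remains of the `M` queue positions. Every iteration consumes one, so it is the
    -- measure for termination and also the factor of `D`.
    loop-ends : ∀ rest {rep j head tail σ} → head + rest ≡ M → Running rep j head tail σ →
      Ends (loop hkBody (head , tail)) σ λ v _ t → Result v × t ≤ D * rest + 7 * Φ σ + 2
    loop-ends rest {rep} {j} {head} {tail} {σ} eq R = start rest eq (head ≟ tail)
      where
      x y : ℕ
      x = proj₁ (σ queue head)
      y = proj₂ (σ queue head)

      start : ∀ rest → head + rest ≡ M → Dec (head ≡ tail) →
        Ends (loop hkBody (head , tail)) σ λ v _ t → Result v × t ≤ D * rest + 7 * Φ σ + 2
      start rest eq (yes refl) = exiting
        (if-true (≡ᵇ-yes {head} refl) (returning (refl , lift (rep , done) , ℕ.m≤n+m 2 _)))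
        where
        done = progress R (λ u v → rep u ≡ rep v) (record { refl = refl ; sym = sym ; trans = trans })
                 (λ _ _ → id) (λ i l h → ⊥-elim (ℕ.<⇒≱ h l))
      start zero eq (no head≢tail) = ⊥-elim (ℕ.<⇒≱ (ℕ.≤∧≢⇒< (head≤tail R) head≢tail)
        (ℕ.≤-trans (tail≤M R) (ℕ.≤-reflexive (trans (sym eq) (ℕ.+-identityʳ head)))))
      start (suc rest) eq (no head≢tail) = looping (if-false (≡ᵇ-no head≢tail) (read-then refl
        (find-ends x (forest R) x<N then λ { {_} {σ₁} {f₁} (refl , F₁ , same₁ , c₁) →
         find-ends y F₁ y<N then λ { {_} {σ₂} {f₂} (refl , F₂ , same₂ , c₂) →
         let
           trans₂ : ∀ α i → σ₂ (trans-at α) i ≡ T i α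
           trans₂ α i = trans (proj₁ (untouched-trans {σ} {σ₁} {σ₂} same₁ same₂) α i) (tr R α i)
           queue₂ : ∀ i → σ₂ queue i ≡ σ queue i
           queue₂ = proj₂ (untouched-trans {σ} {σ₁} {σ₂} same₁ same₂)
         in
         [ (λ rx≡ry → if-true (≡ᵇ-yes rx≡ry) (returning
             (weaken (loop-ends rest next-eq (skipped rx≡ry F₂ trans₂ queue₂)) λ { {_} {_} {u} (res , u≤) →
                res , cost-skip (Φ σ) (Φ σ₁) (Φ σ₂) f₁ f₂ u rest c₁ c₂ u≤ })))
         , (λ rx≢ry → if-false (≡ᵇ-no rx≢ry) (compare-ends (atoms k) x y tail trans₂ then λ {
             {nothing} {_} {c} (ne , c≤) → returning
               ((λ B bisim b → ne B bisim (required R B bisim b head ℕ.≤-refl head<tail)) ,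
                cost-fail (Φ σ) (Φ σ₁) (Φ σ₂) f₁ f₂ c rest c₁ c₂ c≤)
             ; {just tail′} {σ₃} {c} ((P , κ) , c≤) →
               link-ends (forest-kept κ F₂) (rep< F₂ x<N) (rep< F₂ y<N) rx≢ry
                         (rep-root (forest-kept κ F₂) x<N) (rep-root (forest-kept κ F₂) y<N) then
               λ { {_} {σ₄} {l} (L , l≤) →
               returning (weaken
                 (loop-ends rest next-eq (linked P L (λ α i → trans (trans-kept κ α i) (trans₂ α i)) queue₂))
                 λ { {_} {_} {u} (res , u≤) → res ,
                   cost-link (Φ σ) (Φ σ₁) (Φ σ₂) (Φ σ₄) f₁ f₂ c l u rest c₁ c₂ c≤ l≤
                     (ℕ.≤-trans (newΦ L) (ℕ.≤-reflexive (cong (_+ a) (Φ-kept κ)))) u≤ }) } }))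
         ]′ (toSum (rep x ≟ rep y)) } })))
        where
        head<tail : head < tail
        head<tail = ℕ.≤∧≢⇒< (head≤tail R) head≢tail
        x<N : x < N
        x<N = proj₁ (in-bounds R head ℕ.≤-refl head<tail)
        y<N : y < N
        y<N = proj₂ (in-bounds R head ℕ.≤-refl head<tail)

        Bxy : ∀ B → Bisim B → B s₁ s₂ → B x y
        Bxy B bisim b = required R B bisim b head ℕ.≤-refl head<tail

        next-eq : suc head + rest ≡ M
        next-eq = trans (sym (ℕ.+-suc head rest)) eq

        skipped : ∀ {σ₂} → rep x ≡ rep y → Forest rep j σ₂ → (∀ α i → σ₂ (trans-at α) i ≡ T i α) →
                  (∀ i → σ₂ queue i ≡ σ queue i) → Running rep j (suc head) tail σ₂
        skipped {σ₂} rx≡ry F₂ trans₂ queue₂ = record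
          { forest    = F₂
          ; tr        = trans₂
          ; head≤tail = head<tail
          ; tail≤     = tail≤ R
          ; in-bounds = λ i l h → to (λ u v → u < N × v < N) i (in-bounds R i (ℕ.<⇒≤ l) h)
          ; progress  = λ E ≈ ker seg → progress R E ≈ ker
              (segment-cons {σ} {head} {tail} E (ker x<N y<N rx≡ry) λ i l h → from E i (seg i l h))
          ; required  = λ B bisim b i l h → to B i (required R B bisim b i (ℕ.<⇒≤ l) h)
          }
          where
          to : ∀ (E : ℕ → ℕ → Set) i → E (proj₁ (σ queue i)) (proj₂ (σ queue i)) →
               E (proj₁ (σ₂ queue i)) (proj₂ (σ₂ queue i))
          to E i = subst (λ v → E (proj₁ v) (proj₂ v)) (sym (queue₂ i))
          from : ∀ (E : ℕ → ℕ → Set) i → E (proj₁ (σ₂ queue i)) (proj₂ (σ₂ queue i)) →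
                 E (proj₁ (σ queue i)) (proj₂ (σ queue i))
          from E i = subst (λ v → E (proj₁ v) (proj₂ v)) (queue₂ i)

        linked : ∀ {σ₂ σ₃ σ₄ tail′} → Pushed (atoms k) x y tail σ₂ σ₃ tail′ →
          (L : Linked rep j (rep x) (rep y) σ₃ σ₄) → (∀ α i → σ₃ (trans-at α) i ≡ T i α) →
          (∀ i → σ₂ queue i ≡ σ queue i) → Running (newRep L) (suc j) (suc head) tail′ σ₄
        linked {σ₂} {σ₃} {σ₄} {tail′} P L trans₃ queue₂ = record
          { forest    = newForest L
          ; tr        = λ α i → trans (proj₁ (untouched L) α i) (trans₃ α i)
          ; head≤tail = ℕ.≤-trans head<tail (tail≤tail′ P)
          ; tail≤     = ℕ.≤-trans (tail′≤ P) (ℕ.≤-trans (ℕ.+-monoˡ-≤ K (tail≤ R))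
                          (ℕ.≤-reflexive (cong suc (ℕ.+-comm (j * K) K))))
          ; in-bounds = λ i → append (λ u v → u < N × v < N) (in-bounds R) (in-range P x<N y<N) i
          ; progress  = λ E ≈ ker seg →
              let
                was = progress R E ≈ (λ u<N v<N e → ker u<N v<N (rep-kept L e))
                        (segment-cons {σ} {head} {tail} E (ker x<N y<N (rep-joined L refl refl))
                          λ i l h → subst (λ v → E (proj₁ v) (proj₂ v)) (old₄ i h)
                            (seg i l (ℕ.≤-trans h (tail≤tail′ P))))
                xy : ∀ α → OutRel E (T x α) (T y α)
                xy α = matching P E (λ i l h → subst (λ v → E (proj₁ v) (proj₂ v)) (proj₂ (untouched L) i)
                         (seg i (ℕ.≤-trans head<tail l) h)) (atoms-complete α)
              -- States identified only by this union are linked through `x` and `y`: their outputs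
              -- are chained by transitivity, with the successful comparison of `x` and `y` in the
              -- middle.
              in proj₁ was , λ {u} {v} u<N v<N e α →
                [ (λ e → proj₂ was u<N v<N e α)
                , [ (λ (eu , ev) → OutRel-trans ≈ (T u α) (T x α) (T v α) (proj₂ was u<N x<N eu α)
                      (OutRel-trans ≈ (T x α) (T y α) (T v α) (xy α) (proj₂ was y<N v<N (sym ev) α)))
                  , (λ (eu , ev) → OutRel-trans ≈ (T u α) (T y α) (T v α) (proj₂ was u<N y<N eu α)
                      (OutRel-trans ≈ (T y α) (T x α) (T v α) (OutRel-sym ≈ (T x α) (T y α) (xy α))
                        (proj₂ was x<N v<N (sym ev) α))) ]′ ]′ (rep-only L e)
          ; required  = λ B bisim b → append B (required R B bisim b) (necessary P B bisim (Bxy B bisim b))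
          }
          where
          old₄ : ∀ i → i < tail → σ₄ queue i ≡ σ queue i
          old₄ i h = trans (proj₂ (untouched L) i) (trans (old P i h) (queue₂ i))
          append : ∀ E → Segment σ head tail E → Segment σ₃ tail tail′ E → Segment σ₄ (suc head) tail′ E
          append E seg new i l h with suc i ≤? tail
          ... | yes i<tail = subst (λ v → E (proj₁ v) (proj₂ v)) (sym (old₄ i i<tail)) (seg i (ℕ.<⇒≤ l) i<tail)
          ... | no i≮tail  = subst (λ v → E (proj₁ v) (proj₂ v)) (sym (proj₂ (untouched L) i)) (new i (ℕ.≮⇒≥ i≮tail) h)

    hk-bound : ℕ
    hk-bound = suc (N * 2) + suc (D * M + 7 * (N * a) + 2)

    Fresh : ℕ → Store → Set
    Fresh n σ = (∀ α x → σ (trans-at α) x ≡ T x α) × (∀ x → n ≤ x → x < N → σ parent x ≡ x × σ rank x ≡ 0)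

    fresh-ends : ∀ {σ} → Fresh N σ →
      Ends (forBelow N λ x → write parent x x >> write rank x 0) σ λ _ σ′ t → Fresh 0 σ′ × t ≤ suc (N * 2)
    fresh-ends = forBelow-ends Fresh 2 N λ m {σ} _ (tr , done) →
      write-then (ends ⇓write ((tr , λ x m≤x x<N → cell σ m x λ m≢x → done x (ℕ.≤∧≢⇒< m≤x m≢x) x<N) , ℕ.≤-refl))
      where
      cell : ∀ σ m x → (m ≢ x → σ parent x ≡ x × σ rank x ≡ 0) →
        let σ₁ = σ [ parent at m ]≔ m ; σ₂ = σ₁ [ rank at m ]≔ 0 in σ₂ parent x ≡ x × σ₂ rank x ≡ 0
      cell σ m x old with m ≟ x
      ... | yes refl = written σ parent m m , written (σ [ parent at m ]≔ m) rank m 0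
      ... | no m≢x = let p , r = old m≢x in
        trans (unwritten σ parent m m parent x λ _ → m≢x) p ,
        trans (unwritten (σ [ parent at m ]≔ m) rank m 0 rank x λ _ → m≢x) r

    hopcroftKarp-ends : ∀ {σ} → (∀ α x → σ (trans-at α) x ≡ T x α) → s₁ < N → s₂ < N →
      Ends (hopcroftKarp s₁ s₂ N) σ λ v _ t → Result v × t ≤ hk-bound
    hopcroftKarp-ends {σ} tr₀ s₁<N s₂<N =
      fresh-ends {σ} (tr₀ , λ x l h → ⊥-elim (ℕ.<⇒≱ h l)) then λ { {_} {σ₁} ((tr₁ , fresh) , t≤) →
      let
        σ₂ = σ₁ [ queue at 0 ]≔ (s₁ , s₂)
        initial-forest : Forest id 0 σ₂
        initial-forest = record
          { parent<    = λ {x} x<N → subst (_< N) (sym (proj₁ (fresh x z≤n x<N))) x<N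
          ; rank-up    = λ {x} x<N ne → ⊥-elim (ne (proj₁ (fresh x z≤n x<N)))
          ; rep<       = id
          ; rep-root   = λ {x} x<N → proj₁ (fresh x z≤n x<N)
          ; rep-parent = λ {x} x<N → proj₁ (fresh x z≤n x<N)
          ; root-rep   = λ _ _ → refl
          ; rank-rep   = λ _ → ℕ.≤-refl
          ; rank≤      = λ {x} x<N → ℕ.≤-reflexive (proj₂ (fresh x z≤n x<N))
          ; links      = ℕ.≤-trans
              (∑-mono N λ x x<N → ℕ.≤-reflexive (cong (if_then 1 else 0) (≡ᵇ-yes (proj₁ (fresh x z≤n x<N)))))
                           (ℕ.≤-reflexive (trans (∑-const N 1) (ℕ.*-identityʳ N)))
          }
        only : ∀ (E : ℕ → ℕ → Set) → E s₁ s₂ → Segment σ₂ 0 1 E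
        only E e = λ { zero _ _ → subst (λ v → E (proj₁ v) (proj₂ v)) (sym (written σ₁ queue 0 (s₁ , s₂))) e
                     ; (suc i) _ (s≤s ()) }
        start : Running id 0 0 1 σ₂
        start = record
          { forest    = initial-forest
          ; tr        = tr₁
          ; head≤tail = z≤n
          ; tail≤     = ℕ.≤-refl
          ; in-bounds = only (λ u v → u < N × v < N) (s₁<N , s₂<N)
          ; progress  = λ E ≈ ker seg →
              subst (λ v → E (proj₁ v) (proj₂ v)) (written σ₁ queue 0 (s₁ , s₂)) (seg 0 z≤n ℕ.≤-refl) ,
              λ { {x} _ _ refl α → OutRel-refl ≈ (T x α) }
          ; required  = λ B _ b → only B b
          }
        -- All nodes start as roots of rank 0, that is, of shifted rank 1.
        Φ≤ : Φ σ₂ ≤ N * a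
        Φ≤ = ℕ.≤-trans (∑-mono N λ x x<N → ℕ.≤-reflexive (trans (pot-root σ₂ x (proj₁ (fresh x z≤n x<N)))
               (trans (cong (λ r → a * suc r) (proj₂ (fresh x z≤n x<N))) (ℕ.*-identityʳ a))))
               (ℕ.≤-reflexive (∑-const N a))
      in
      write-then (weaken (loop-ends M refl start) λ (res , u≤) →
        res , ℕ.+-mono-≤ t≤ (s≤s (ℕ.≤-trans u≤ (ℕ.+-monoˡ-≤ 2 (ℕ.+-monoʳ-≤ (D * M) (scale 7 Φ≤)))))) }

-- The language of the Thompson automaton

module Language (𝒜 : Actions) (k : ℕ) where

  open GKAT 𝒜 k
  open Coalgebra
  open Runs 𝒜 k
  open ThompsonRun 𝒜 k

  -- Acceptance starts from a pseudostate, so `initial e` has a language before any start state is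
  -- added, and a state `x` is covered as `d x`.
  Accepts : ∀ {X : Set} → (X → G X) → G X → Lang
  Accepts d h (atom α)    = h α ≡ accept
  Accepts d h (α , p ▷ w) = ∃[ x ] h α ≡ step p x × Accepts d (d x) w

  Accepts-cong : ∀ {X : Set} {d : X → G X} {h h′ : G X} → (∀ α → h α ≡ h′ α) →
                 ∀ w → Accepts d h w → Accepts d h′ w
  Accepts-cong eq (atom α)    e           = trans (sym (eq α)) e
  Accepts-cong eq (α , p ▷ w) (x , e , a) = x , trans (sym (eq α)) e , a

  mapOut-accept : ∀ {X Y : Set} {f : X → Y} o → mapOut f o ≡ accept → o ≡ accept
  mapOut-accept accept refl = refl

  mapOut-step : ∀ {X Y : Set} {f : X → Y} o {p y} → mapOut f o ≡ step p y →
                ∃[ x ] o ≡ step p x × f x ≡ y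
  mapOut-step (step p x) refl = x , refl , refl

  IsMorphism : ∀ {X Y : Set} → (X → G X) → (Y → G Y) → (X → Y) → Set
  IsMorphism d d′ f = ∀ x α → d′ (f x) α ≡ mapOut f (d x α)

  module _ {X Y : Set} {d : X → G X} {d′ : Y → G Y} {f : X → Y} (mor : IsMorphism d d′ f) where

    -- Applied to the injections into a coproduct, to the addition of a start state and to the
    -- numbering of states.
    Accepts-map : ∀ w {h} → Accepts d h w → Accepts d′ (mapOut f ∘ h) w
    Accepts-map (atom α)    e = cong (mapOut f) e
    Accepts-map (α , p ▷ w) (x , e , a) =
      f x , cong (mapOut f) e , Accepts-cong (λ β → sym (mor x β)) w (Accepts-map w a)

    Accepts-unmap : ∀ w {h} → Accepts d′ (mapOut f ∘ h) w → Accepts d h w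
    Accepts-unmap (atom α)    {h} e = mapOut-accept (h α) e
    Accepts-unmap (α , p ▷ w) {h} (y , e , a) with mapOut-step (h α) e
    ... | x , e′ , refl = x , e′ , Accepts-unmap w (Accepts-cong (mor x) w a)

  -- The graph of the fusion product as an inductive relation, which replaces reasoning about
  -- partiality by induction.
  data Fuse : GS → GS → GS → Set where
    fuse-atom : ∀ {w} → Fuse (atom (first w)) w w
    fuse-step : ∀ {α p u v w} → Fuse u v w → Fuse (α , p ▷ u) v (α , p ▷ w)

  ⋄⇒Fuse : ∀ u v {w} → u ⋄ v ≡ just w → Fuse u v w
  ⋄⇒Fuse (atom α) v eq with α ≟ᵃ first v
  ⋄⇒Fuse (atom α) v refl | yes refl = fuse-atom
  ⋄⇒Fuse (α , p ▷ u) v eq with u ⋄ v in eq′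
  ⋄⇒Fuse (α , p ▷ u) v refl | just w = fuse-step (⋄⇒Fuse u v eq′)

  Fuse⇒⋄ : ∀ {u v w} → Fuse u v w → u ⋄ v ≡ just w
  Fuse⇒⋄ {v = v} fuse-atom rewrite dec-true (first v ≟ᵃ first v) refl = refl
  Fuse⇒⋄ (fuse-step f) rewrite Fuse⇒⋄ f = refl

  Fuse-first : ∀ {u v w} → Fuse u v w → first w ≡ first u
  Fuse-first fuse-atom     = refl
  Fuse-first (fuse-step f) = refl

  Fuse-assocʳ : ∀ {x y z v w} → Fuse x y z → Fuse z v w → ∃[ m ] Fuse y v m × Fuse x m w
  Fuse-assocʳ {w = w} fuse-atom g = w , g , subst (λ α → Fuse (atom α) w w) (Fuse-first g) fuse-atom
  Fuse-assocʳ (fuse-step f) (fuse-step g) with Fuse-assocʳ f g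
  ... | m , h , h′ = m , h , fuse-step h′

  Fuse-assocˡ : ∀ {x y v m w} → Fuse y v m → Fuse x m w → ∃[ z ] Fuse x y z × Fuse z v w
  Fuse-assocˡ {y = y} g fuse-atom = y , subst (λ α → Fuse (atom α) y y) (sym (Fuse-first g)) fuse-atom , g
  Fuse-assocˡ g (fuse-step f) with Fuse-assocˡ g f
  ... | z , h , h′ = _ , fuse-step h , fuse-step h′

  ⋄ᴸ-intro : ∀ {L K : Lang} {u v w} → L u → K v → Fuse u v w → (L ⋄ᴸ K) w
  ⋄ᴸ-intro l r f = _ , _ , l , r , Fuse⇒⋄ f

  ⋄ᴸ-elim : ∀ {L K : Lang} {w} → (L ⋄ᴸ K) w → ∃[ u ] ∃[ v ] L u × K v × Fuse u v w
  ⋄ᴸ-elim (u , v , l , r , eq) = u , v , l , r , ⋄⇒Fuse u v eq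

  restrict : ∀ {B : At k → Set} {L : Lang} {w} → B (first w) → L w → (Atomic B ⋄ᴸ L) w
  restrict b l = ⋄ᴸ-intro (atomic b) l fuse-atom

  unrestrict : ∀ {B : At k → Set} {L : Lang} {w} → (Atomic B ⋄ᴸ L) w → B (first w) × L w
  unrestrict {B} {L} p = let _ , _ , b , l , f = ⋄ᴸ-elim {Atomic B} {L} p in from b l f
    where
    from : ∀ {u v w} → Atomic B u → L v → Fuse u v w → B (first w) × L w
    from (atomic b) l fuse-atom = b , l

  -- Shared by `·` and by loops. For `e · f` the continuation `g` comes from `f`; for a loop `f` is
  -- the identity and `g` is the pseudostate of the loop itself.
  module Sequential {X Z : Set} {d : X → G X} {d′ : Z → G Z} {f : X → Z} (g : G Z)
    (cont : ∀ x α → d′ (f x) α ≡ mapOut f (d x α) orElse g α) where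

    _⊳ : G X → G Z
    (h ⊳) α = mapOut f (h α) orElse g α

    split : ∀ w {h} → Accepts d′ (h ⊳) w → ∃[ u ] ∃[ v ] Accepts d h u × Accepts d′ g v × Fuse u v w
    split (atom α) {h} e with orElse≡accept (mapOut f (h α)) (g α) e
    ... | e₁ , e₂ = atom α , atom α , mapOut-accept (h α) e₁ , e₂ , fuse-atom
    split (α , p ▷ w) {h} (z , e , a) with h α in eq
    ... | accept = atom α , (α , p ▷ w) , eq , (z , e , a) , fuse-atom
    split (α , p ▷ w) {h} (z , () , a) | reject
    split (α , p ▷ w) {h} (.(f x) , refl , a) | step p x with split w (Accepts-cong (cont x) w a)
    ... | u , v , au , av , fuse = (α , p ▷ u) , v , (x , eq , au) , av , fuse-step fuse

    fuse : ∀ {u v w h} → Accepts d h u → Accepts d′ g v → Fuse u v w → Accepts d′ (h ⊳) w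
    fuse {v = v} {h = h} e av fuse-atom = at v (first v) refl e av
      where
      at : ∀ v α → first v ≡ α → h α ≡ accept → Accepts d′ g v → Accepts d′ (h ⊳) v
      at (atom α)    α refl e av            rewrite e = av
      at (α , p ▷ v) α refl e (z , e′ , av) = z , trans (cong (λ o → mapOut f o orElse g α) e) e′ , av
    fuse {h = h} (x , e , au) av (fuse-step {α} {p} {w = w} fu) =
      f x , cong (λ o → mapOut f o orElse g α) e ,
      Accepts-cong (λ β → sym (cont x β)) w (fuse au av fu)

  -- Iteration nested to the right, whereas `power` nests to the left: the automaton reads the first
  -- round first. Associativity of fusion translates between the two.
  data Iterates (B : At k → Set) (L : Lang) : Lang where
    done : ∀ {α} → ¬ B α → Iterates B L (atom α)
    more : ∀ {u v w} → B (first u) → L u → Iterates B L v → Fuse u v w → Iterates B L w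

  module _ {L : Lang} where

    power-∷ : ∀ n {u v w} → L u → power L n v → Fuse u v w → power L (suc n) w
    power-∷ zero {u} l (atomic _) f with unit f
      where
      unit : ∀ {u α w} → Fuse u (atom α) w → u ≡ w
      unit fuse-atom     = refl
      unit (fuse-step f) = cong (_ , _ ▷_) (unit f)
    ... | refl = ⋄ᴸ-intro {Atomic _} {L} (atomic _) l fuse-atom
    power-∷ (suc n) l p f with ⋄ᴸ-elim {power L n} {L} p
    ... | x , y , px , ly , g with Fuse-assocˡ g f
    ...   | z , h , h′ = ⋄ᴸ-intro {power L (suc n)} {L} (power-∷ n l px h) ly h′

  iterates⇒iteration : ∀ {B : At k → Set} {L : Lang} {w} → Iterates B L w → guardedIteration B L w
  iterates⇒iteration (done ¬b) = 0 , ⋄ᴸ-intro (atomic _) (atomic ¬b) fuse-atom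
  iterates⇒iteration {B} {L} (more {u} b l it f) =
    let n , p               = iterates⇒iteration it
        x , y , px , ¬b , g = ⋄ᴸ-elim {power (Atomic B ⋄ᴸ L) n} {Atomic (∁ B)} p
        z , h , h′          = Fuse-assocˡ g f
    in suc n , ⋄ᴸ-intro {power (Atomic B ⋄ᴸ L) (suc n)} {Atomic (∁ B)}
         (power-∷ {Atomic B ⋄ᴸ L} n (restrict {B} {L} {u} b l) px h) ¬b h′

  iteration⇒iterates : ∀ {B : At k → Set} {L : Lang} {w} → guardedIteration B L w → Iterates B L w
  iteration⇒iterates {B} {L} (n , p) with ⋄ᴸ-elim p
  ... | x , y , px , atomic ¬b , f = prepend n px (done ¬b) f
    where
    prepend : ∀ n {u v w} → power (Atomic B ⋄ᴸ L) n u → Iterates B L v → Fuse u v w → Iterates B L w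
    prepend zero    (atomic _) it fuse-atom = it
    prepend (suc n) p it f =
      let x , y , px , bl , g = ⋄ᴸ-elim {power (Atomic B ⋄ᴸ L) n} {Atomic B ⋄ᴸ L} p
          m , h , h′          = Fuse-assocʳ g f
          b , l               = unrestrict {B} {L} bl
      in prepend n px (more {B} {L} b l it h) h′

  glength : GS → ℕ
  glength (atom α)    = 0
  glength (α , p ▷ w) = suc (glength w)

  Fuse-length : ∀ {u v w} → Fuse u v w → glength v ≤ glength w
  Fuse-length fuse-atom     = ℕ.≤-refl
  Fuse-length (fuse-step f) = ℕ.m≤n⇒m≤1+n (Fuse-length f)

  ≤at-true : ∀ {α : At k} {b} → eval α b ≡ true → α ≤at b
  ≤at-true {α} {b} = eval⇒≤at α b

  ≤at-false : ∀ {α : At k} {b} → eval α b ≡ false → ¬ α ≤at b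
  ≤at-false {α} {b} eq h with () ← trans (sym eq) (≤at⇒eval α b h)

  initial-yes : ∀ e b f {α} → eval α b ≡ true → initial (e +[ b ] f) α ≡ mapOut inj₁ (initial e α)
  initial-yes e b f {α} eq = if-cong {x = mapOut inj₁ (initial e α)} (trans (does-≤at α b) eq)

  initial-no : ∀ e b f {α} → eval α b ≡ false → initial (e +[ b ] f) α ≡ mapOut inj₂ (initial f α)
  initial-no e b f {α} eq = if-cong {x = mapOut inj₁ (initial e α)} (trans (does-≤at α b) eq)

  initial-loop : ∀ e b α → initial (e ^⟨ b ⟩) α ≡ (if eval α b then initial e α orElse reject else accept)
  initial-loop e b α = if-cong (does-≤at α b)

  mapOut-id : ∀ {X : Set} (o : Out X) → mapOut id o ≡ o
  mapOut-id (inj₁ v)   = refl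
  mapOut-id (step p x) = refl

  Accepts-at : ∀ {X : Set} {d : X → G X} {h h′ : G X} w → h (first w) ≡ h′ (first w) →
               Accepts d h w → Accepts d h′ w
  Accepts-at (atom α)    eq e           = trans (sym eq) e
  Accepts-at (α , p ▷ w) eq (x , e , a) = x , trans (sym eq) e , a

  sound    : ∀ e w → Accepts (transition e) (initial e) w → ⟦ e ⟧ w
  complete : ∀ e w → ⟦ e ⟧ w → Accepts (transition e) (initial e) w

  module Loop (e : Exp) (b : BExp k) where
    d  = transition e
    d′ = transition (e ^⟨ b ⟩)
    g  = initial (e ^⟨ b ⟩)

    open Sequential {d = d} {d′} {id} g
      (λ s α → trans (transition-loop α e b s) (cong (_orElse g α) (sym (mapOut-id (d s α)))))

    inside : ∀ {α} → eval α b ≡ true → g α ≡ initial e α orElse reject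
    inside {α} eq = trans (initial-loop e b α) (cong (if_then initial e α orElse reject else accept) eq)

    outside : ∀ {α} → eval α b ≡ false → g α ≡ accept
    outside {α} eq = trans (initial-loop e b α) (cong (if_then initial e α orElse reject else accept) eq)

    -- A round that would accept at once is turned into rejection by `orElse reject`, so every round
    -- the automaton performs consumes an action, and the length of the word bounds the number of
    -- rounds.
    unfold : ∀ n w → glength w ≤ n → Accepts d′ g w → Iterates ⟦ b ⟧ᵇ ⟦ e ⟧ w
    unfold-step : ∀ n α p w → suc (glength w) ≤ n → ∀ s → Accepts d′ (d′ s) w → eval α b ≡ true →
                  ∀ o → initial e α ≡ o → o orElse reject ≡ step p s → Iterates ⟦ b ⟧ᵇ ⟦ e ⟧ (α , p ▷ w)

    unfold n (atom α) _ a = cases (eval α b) refl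
      where
      cases : ∀ v → eval α b ≡ v → Iterates ⟦ b ⟧ᵇ ⟦ e ⟧ (atom α)
      cases false eq = done (≤at-false {b = b} eq)
      cases true  eq with () ← proj₂ (orElse≡accept (initial e α) reject (trans (sym (inside eq)) a))
    unfold n (α , p ▷ w) h (s , eg , a) = cases (eval α b) refl
      where
      cases : ∀ v → eval α b ≡ v → Iterates ⟦ b ⟧ᵇ ⟦ e ⟧ (α , p ▷ w)
      cases false eq with () ← trans (sym eg) (outside eq)
      cases true  eq = unfold-step n α p w h s a eq (initial e α) refl (trans (sym (inside eq)) eg)

    unfold-step (suc n) α p w _ s a eq accept _ ()
    unfold-step (suc n) α p w _ s a eq reject _ ()
    unfold-step (suc n) α p w (s≤s h) s a eq (step p s) ei refl =
      let u , v , au , av , f = split w (Accepts-cong (λ β → trans (transition-loop β e b s)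
                                  (cong (_orElse g β) (sym (mapOut-id (d s β))))) w a)
      in more (≤at-true {b = b} eq) (sound e (α , p ▷ u) (s , ei , au))
              (unfold n v (ℕ.≤-trans (Fuse-length f) h) av) (fuse-step f)

    fold : ∀ {w} → Iterates ⟦ b ⟧ᵇ ⟦ e ⟧ w → Accepts d′ g w
    fold (done {α} ¬b) = cases (eval α b) refl
      where
      cases : ∀ v → eval α b ≡ v → g α ≡ accept
      cases true  eq = ⊥-elim (¬b (≤at-true {b = b} eq))
      cases false eq = outside eq
    -- A round consisting of a single atom does not change the word. The automaton has no such
    -- rounds, and it is skipped.
    fold (more _ _ it fuse-atom) = fold it
    fold (more {α , p ▷ u} inb l it (fuse-step {w = w} f)) =
      let s , ei , au = complete e (α , p ▷ u) l
      in s , trans (inside (≤at⇒eval α b inb)) (cong (_orElse reject) ei) ,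
         Accepts-cong (λ β → sym (trans (transition-loop β e b s) (cong (_orElse g β) (sym (mapOut-id (d s β)))))) w
           (fuse au (fold it) f)

  module Seq (e f : Exp) where
    open Sequential {d = transition e} {transition (e · f)} {inj₁} (mapOut inj₂ ∘ initial f)
      (λ s α → transition-seq₁ α e f s) public

    right : IsMorphism (transition f) (transition (e · f)) inj₂
    right s α = transition-seq₂ α e f s

  sound (act p) (α , q ▷ atom β) (tt , refl , refl) = anyAction α β
  sound (act p) (α , q ▷ (β , r ▷ w)) (tt , refl , _ , () , _)
  sound (test b) (atom α) e = cases (eval α b) refl
    where
    cases : ∀ v → eval α b ≡ v → Atomic ⟦ b ⟧ᵇ (atom α)
    cases true  eq = atomic (≤at-true {b = b} eq)
    cases false eq with () ← trans (sym e) (cong inj₁ (trans (does-≤at α b) eq))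
  sound (e · f) w a with Seq.split e f w a
  ... | u , v , au , av , fu = ⋄ᴸ-intro (sound e u au) (sound f v (Accepts-unmap (Seq.right e f) v av)) fu
  sound (e +[ b ] f) w a = cases (eval (first w) b) refl
    where
    cases : ∀ v → eval (first w) b ≡ v → guardedUnion ⟦ b ⟧ᵇ ⟦ e ⟧ ⟦ f ⟧ w
    cases true  eq = inj₁ (restrict {⟦ b ⟧ᵇ} {⟦ e ⟧} (≤at-true {b = b} eq)
      (sound e w (Accepts-unmap (λ _ _ → refl) w (Accepts-at w (initial-yes e b f eq) a))))
    cases false eq = inj₂ (restrict {∁ ⟦ b ⟧ᵇ} {⟦ f ⟧} (≤at-false {b = b} eq)
      (sound f w (Accepts-unmap (λ _ _ → refl) w (Accepts-at w (initial-no e b f eq) a))))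
  sound (e ^⟨ b ⟩) w a = iterates⇒iteration (Loop.unfold e b (glength w) w ℕ.≤-refl a)

  complete (act p) _ (anyAction α β) = tt , refl , refl
  complete (test b) _ (atomic {α} h) = cong inj₁ (trans (does-≤at α b) (≤at⇒eval α b h))
  complete (e · f) w p with ⋄ᴸ-elim {⟦ e ⟧} {⟦ f ⟧} p
  ... | u , v , pu , pv , fu = Seq.fuse e f (complete e u pu) (Accepts-map (Seq.right e f) v (complete f v pv)) fu
  complete (e +[ b ] f) w (inj₁ p) =
    let h , l = unrestrict {⟦ b ⟧ᵇ} {⟦ e ⟧} p
    in Accepts-at w (sym (initial-yes e b f (≤at⇒eval _ b h))) (Accepts-map (λ _ _ → refl) w (complete e w l))
  complete (e +[ b ] f) w (inj₂ p) = cases (eval (first w) b) refl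
    where
    cases : ∀ v → eval (first w) b ≡ v → Accepts (transition (e +[ b ] f)) (initial (e +[ b ] f)) w
    cases true  eq = ⊥-elim (proj₁ (unrestrict {∁ ⟦ b ⟧ᵇ} {⟦ f ⟧} p) (≤at-true {b = b} eq))
    cases false eq = Accepts-at w (sym (initial-no e b f eq))
      (Accepts-map (λ _ _ → refl) w (complete f w (proj₂ (unrestrict {∁ ⟦ b ⟧ᵇ} {⟦ f ⟧} p))))
  complete (e ^⟨ b ⟩) w p = Loop.fold e b (iteration⇒iterates p)

-- Normalization, bisimilarity and equality of languages

module Normalized (𝒜 : Actions) (k : ℕ) where

  open GKAT 𝒜 k
  open Coalgebra
  open Runs 𝒜 k
  open NormalizationRun 𝒜 k using (pruned)
  open Language 𝒜 k

  _⊩_∋_ : (𝒳 : Coalgebra) → State 𝒳 → GS → Set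
  𝒳 ⊩ x ∋ w = Accepts (δ 𝒳) (δ 𝒳 x) w

  -- Together with `live⇒accepts` this identifies liveness with a nonempty language, so facts about
  -- morphisms and languages apply to it.
  accepts⇒live : ∀ 𝒳 {x} w → 𝒳 ⊩ x ∋ w → Live 𝒳 x
  accepts⇒live 𝒳 {x} (atom α) e = x , ε , α , e
  accepts⇒live 𝒳 (α , p ▷ w) (y , e , a) with accepts⇒live 𝒳 w a
  ... | z , path , acc = z , (α , p , e) ◅ path , acc

  live⇒accepts : ∀ 𝒳 {x} → Live 𝒳 x → ∃[ w ] 𝒳 ⊩ x ∋ w
  live⇒accepts 𝒳 (z , ε , α , e) = atom α , e
  live⇒accepts 𝒳 (z , (α , p , e) ◅ path , acc) with live⇒accepts 𝒳 (z , path , acc)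
  ... | w , a = (α , p ▷ w) , _ , e , a

  module _ (𝒳 𝒴 : Coalgebra) (f : State 𝒳 → State 𝒴) (mor : IsMorphism (δ 𝒳) (δ 𝒴) f) where

    Live-map : ∀ {x} → Live 𝒳 x → Live 𝒴 (f x)
    Live-map {x} l with live⇒accepts 𝒳 l
    ... | w , a = accepts⇒live 𝒴 w (Accepts-cong (λ α → sym (mor x α)) w (Accepts-map mor w a))

    Live-unmap : ∀ {x} → Live 𝒴 (f x) → Live 𝒳 x
    Live-unmap {x} l with live⇒accepts 𝒴 l
    ... | w , a = accepts⇒live 𝒳 w (Accepts-unmap mor w (Accepts-cong (mor x) w a))

  pruned-accept : ∀ {X : Set} {L : X → Bool} o → pruned L o ≡ accept → o ≡ accept
  pruned-accept (inj₁ v) eq = eq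
  pruned-accept {L = L} (step p x) eq with L x
  pruned-accept (step p x) () | true
  pruned-accept (step p x) () | false

  pruned-step : ∀ {X : Set} {L : X → Bool} o {p x} → pruned L o ≡ step p x → o ≡ step p x × L x ≡ true
  pruned-step {L = L} (step p x) eq with L x in Lx
  pruned-step (step p x) refl | true = refl , Lx

  pruned-keep : ∀ {X : Set} {L : X → Bool} {p x} → L x ≡ true → pruned L (step p x) ≡ step p x
  pruned-keep {p = p} {x} eq = cong (if_then step p x else reject) eq

  pruned-map : ∀ {X Y : Set} {L : Y → Bool} {L′ : X → Bool} {f : X → Y} → (∀ x → L (f x) ≡ L′ x) →
               ∀ o → pruned L (mapOut f o) ≡ mapOut f (pruned L′ o)
  pruned-map eq (inj₁ v) = refl
  pruned-map {L′ = L′} {f} eq (step p x) rewrite eq x with L′ x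
  ... | true  = refl
  ... | false = refl

  Productive : Coalgebra → Set
  Productive 𝒳 = ∀ x α {p y} → δ 𝒳 x α ≡ step p y → ∃[ w ] 𝒳 ⊩ y ∋ w

  module _ (𝒳 : Coalgebra) (live? : Decidable (Live 𝒳)) where

    𝒳̂ : Coalgebra
    𝒳̂ = normalization 𝒳 live?

    normalization-δ : ∀ x α → δ 𝒳̂ x α ≡ pruned (does ∘ live?) (δ 𝒳 x α)
    normalization-δ x α with δ 𝒳 x α
    ... | inj₁ v   = refl
    ... | step p y = refl

    normalization-accepts : ∀ w {x} → 𝒳̂ ⊩ x ∋ w → 𝒳 ⊩ x ∋ w
    normalization-accepts (atom α) {x} e = pruned-accept (δ 𝒳 x α) (trans (sym (normalization-δ x α)) e)
    normalization-accepts (α , p ▷ w) {x} (y , e , a) =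
      y , proj₁ (pruned-step (δ 𝒳 x α) (trans (sym (normalization-δ x α)) e)) , normalization-accepts w a

    accepts-normalization : ∀ w {x} → 𝒳 ⊩ x ∋ w → 𝒳̂ ⊩ x ∋ w
    accepts-normalization (atom α) {x} e = trans (normalization-δ x α) (cong (pruned (does ∘ live?)) e)
    accepts-normalization (α , p ▷ w) {x} (y , e , a) = y ,
      trans (normalization-δ x α) (trans (cong (pruned (does ∘ live?)) e)
        (pruned-keep {L = does ∘ live?} (dec-true (live? y) (accepts⇒live 𝒳 w a)))) ,
      accepts-normalization w a

    normalization-productive : Productive 𝒳̂
    normalization-productive x α {p} {y} e
      with pruned-step (δ 𝒳 x α) (trans (sym (normalization-δ x α)) e)
    ... | _ , y-live with live? y
    ...   | yes l = let w , a = live⇒accepts 𝒳 l in w , accepts-normalization w a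

  module _ {𝒳 𝒴 : Coalgebra} where

    step-injective : ∀ {X : Set} {o : Out X} {p q x y} → o ≡ step p x → o ≡ step q y → p ≡ q × x ≡ y
    step-injective refl refl = refl , refl

    module _ {R : State 𝒳 → State 𝒴 → Set} (bisim : IsBisimulation 𝒳 𝒴 R) where
      open IsBisimulation bisim

      bisimulation⇒⊆ : ∀ w {x y} → R x y → 𝒳 ⊩ x ∋ w → 𝒴 ⊩ y ∋ w
      bisimulation⇒⊆ (atom α)    r e            = output r α e
      bisimulation⇒⊆ (α , p ▷ w) r (x′ , e , a) =
        let y′ , e′ , r′ = next r α e in y′ , e′ , bisimulation⇒⊆ w r′ a

      -- The clauses of a bisimulation lead from `𝒳` to `𝒴` only. Since transitions are functions,
      -- the output of `x` determines the kind of output of `y`, and the converse inclusion follows.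
      bisimulation⇒⊇ : ∀ w {x y} → R x y → 𝒴 ⊩ y ∋ w → 𝒳 ⊩ x ∋ w
      bisimulation⇒⊇ (atom α) {x} r e with δ 𝒳 x α in ex
      ... | inj₁ v   = cong inj₁ (inj₁-injective (trans (sym (output r α ex)) e))
      ... | step p z with () ← trans (sym e) (proj₁ (proj₂ (next r α ex)))
      bisimulation⇒⊇ (α , p ▷ w) {x} r (y′ , e , a) with δ 𝒳 x α in ex
      ... | inj₁ v   with () ← trans (sym e) (output r α ex)
      ... | step q z with next r α ex
      ...   | y″ , e″ , r′ with step-injective e e″
      ...     | refl , refl = z , refl , bisimulation⇒⊇ w r′ a

    SameLanguage : State 𝒳 → State 𝒴 → Set
    SameLanguage x y = (∀ w → 𝒳 ⊩ x ∋ w → 𝒴 ⊩ y ∋ w) × (∀ w → 𝒴 ⊩ y ∋ w → 𝒳 ⊩ x ∋ w)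

    sameLanguage-bisimulation : Productive 𝒳 → Productive 𝒴 → IsBisimulation 𝒳 𝒴 SameLanguage
    sameLanguage-bisimulation prodX prodY = record { output = output′ ; next = next′ }
      where
      output′ : ∀ {x y} → SameLanguage x y → ∀ α {v} → δ 𝒳 x α ≡ inj₁ v → δ 𝒴 y α ≡ inj₁ v
      output′ (to , _) α {true} e = to (atom α) e
      output′ {y = y} (_ , from) α {false} e with δ 𝒴 y α in ey
      ... | reject   = refl
      ... | accept   with () ← trans (sym e) (from (atom α) ey)
      -- Productivity excludes this case: some word passes through the step, and `x`, which rejects
      -- at `α`, would have to accept it.
      ... | step p z with prodY y α ey
      ...   | w , a with from (α , p ▷ w) (z , ey , a)
      ...     | _ , e′ , _ with () ← trans (sym e) e′

      next′ : ∀ {x y} → SameLanguage x y → ∀ α {p x′} → δ 𝒳 x α ≡ step p x′ →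
              ∃[ y′ ] δ 𝒴 y α ≡ step p y′ × SameLanguage x′ y′
      next′ {x} (to , from) α {p} {x′} e with prodX x α e
      ... | w , a with to (α , p ▷ w) (x′ , e , a)
      ...   | y′ , e′ , a′ = y′ , e′ ,
        (λ w a → let y″ , e″ , a″ = to (α , p ▷ w) (x′ , e , a)
                 in subst (λ y → 𝒴 ⊩ y ∋ w) (proj₂ (step-injective e″ e′)) a″) ,
        (λ w a → let x″ , e″ , a″ = from (α , p ▷ w) (y′ , e′ , a)
                 in subst (λ x → 𝒳 ⊩ x ∋ w) (proj₂ (step-injective e″ e)) a″)

  module _ (e : Exp) where

    start-accepts : ∀ w → Thompson e ⊩ ι ∋ w → ⟦ e ⟧ w
    start-accepts w a = sound e w (Accepts-unmap (λ _ _ → refl) w a)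

    accepts-start : ∀ w → ⟦ e ⟧ w → Thompson e ⊩ ι ∋ w
    accepts-start w l = Accepts-map (λ _ _ → refl) w (complete e w l)

  module _ (e₁ e₂ : Exp) (live₁? : Decidable (Live (Thompson e₁))) (live₂? : Decidable (Live (Thompson e₂))) where

    𝒳̂₁ 𝒳̂₂ : Coalgebra
    𝒳̂₁ = normalization (Thompson e₁) live₁?
    𝒳̂₂ = normalization (Thompson e₂) live₂?

    bisimilar⇒equal : Bisimilar 𝒳̂₁ 𝒳̂₂ ι ι → ⟦ e₁ ⟧ ≐ ⟦ e₂ ⟧
    bisimilar⇒equal (R , bisim , r) =
      (λ {w} l → start-accepts e₂ w (normalization-accepts (Thompson e₂) live₂? w {ι}
        (bisimulation⇒⊆ {𝒳̂₁} {𝒳̂₂} bisim w r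
          (accepts-normalization (Thompson e₁) live₁? w {ι} (accepts-start e₁ w l))))) ,
      (λ {w} l → start-accepts e₁ w (normalization-accepts (Thompson e₁) live₁? w {ι}
        (bisimulation⇒⊇ {𝒳̂₁} {𝒳̂₂} bisim w r
          (accepts-normalization (Thompson e₂) live₂? w {ι} (accepts-start e₂ w l)))))

    equal⇒bisimilar : ⟦ e₁ ⟧ ≐ ⟦ e₂ ⟧ → Bisimilar 𝒳̂₁ 𝒳̂₂ ι ι
    equal⇒bisimilar (to , from) = SameLanguage {𝒳̂₁} {𝒳̂₂} ,
      sameLanguage-bisimulation (normalization-productive (Thompson e₁) live₁?)
                                (normalization-productive (Thompson e₂) live₂?) ,
      (λ w a → accepts-normalization (Thompson e₂) live₂? w {ι} (accepts-start e₂ w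
        (to (start-accepts e₁ w (normalization-accepts (Thompson e₁) live₁? w {ι} a))))) ,
      (λ w a → accepts-normalization (Thompson e₁) live₁? w {ι} (accepts-start e₁ w
        (from (start-accepts e₂ w (normalization-accepts (Thompson e₂) live₂? w {ι} a)))))

-- The total running time

constant : ℕ → ℕ
constant K = 3 * K + 3 + (34 * K + 33) + (8 + (129 + 3 * K) * (1 + 2 * K) + 70)

-- Each of the three phases is bounded by a multiple of `n * A`. In the third, 129 is 21 · 5 + 24,
-- from `a ≤ 5 * A`; the factor `1 + 2 * K` bounds the enqueued pairs per unit of `n`; and 70 is 7 ·
-- 2 · 5, for the initial potential.
total-time : ∀ K N a n A t₁ t₂ t₃ → N ≤ 2 * n → a ≤ 5 * A → 1 ≤ A → 1 ≤ n →
  t₁ ≤ K * (3 * n) + 3 →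
  t₂ ≤ suc (suc (N * 2) + (suc (N * suc (K * 5)) + (9 * (N + N * K) + 3 + suc (N * suc (K * 3))))) →
  t₃ ≤ suc (N * 2) + suc ((21 * a + 3 * K + 24) * (1 + N * K) + 7 * (N * a) + 2) →
  t₁ + (t₂ + t₃) ≤ constant K * (n * A)
total-time K N a n A t₁ t₂ t₃ N≤ a≤ 1≤A 1≤n h₁ h₂ h₃ = ℕ.≤-trans
  (ℕ.+-mono-≤ part₁ (ℕ.+-mono-≤ part₂ part₃))
  (ℕ.≤-reflexive (sum-up K P))
  where
  P : ℕ
  P = n * A
  n≤P : n ≤ P
  n≤P = ℕ.≤-trans (ℕ.≤-reflexive (sym (ℕ.*-identityʳ n))) (scale n 1≤A)
  1≤P : 1 ≤ P
  1≤P = ℕ.≤-trans 1≤n n≤P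
  N≤2P : N ≤ 2 * P
  N≤2P = ℕ.≤-trans N≤ (scale 2 n≤P)

  sum-up : ∀ K P → (3 * K + 3) * P + ((34 * K + 33) * P + (8 + (129 + 3 * K) * (1 + 2 * K) + 70) * P) ≡
                   (3 * K + 3 + (34 * K + 33) + (8 + (129 + 3 * K) * (1 + 2 * K) + 70)) * P
  sum-up = solve-∀

  part₁ : t₁ ≤ (3 * K + 3) * P
  part₁ = ℕ.≤-trans h₁ (by-sum 0 (ℕ.+-mono-≤ (scale (3 * K) n≤P) (scale 3 1≤P)) (arith K n P))
    where
    arith : ∀ K n P → K * (3 * n) + 3 + (3 * K * P + 3 * P) + 0 ≡ (3 * K + 3) * P + (3 * K * n + 3 * 1)
    arith = solve-∀

  part₂ : t₂ ≤ (34 * K + 33) * P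
  part₂ = ℕ.≤-trans h₂ (by-sum 0 (ℕ.+-mono-≤ (scale (13 + 17 * K) N≤2P) (scale 7 1≤P)) (arith K N P))
    where
    arith : ∀ K N P →
      suc (suc (N * 2) + (suc (N * suc (K * 5)) + (9 * (N + N * K) + 3 + suc (N * suc (K * 3))))) +
      ((13 + 17 * K) * (2 * P) + 7 * P) + 0 ≡ (34 * K + 33) * P + ((13 + 17 * K) * N + 7 * 1)
    arith = solve-∀

  D≤ : 21 * a + 3 * K + 24 ≤ (129 + 3 * K) * A
  D≤ = by-sum 0 (ℕ.+-mono-≤ (scale 21 a≤) (scale (3 * K + 24) 1≤A)) (arith K a A)
    where
    arith : ∀ K a A → 21 * a + 3 * K + 24 + (21 * (5 * A) + (3 * K + 24) * A) + 0 ≡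
                      (129 + 3 * K) * A + (21 * a + (3 * K + 24) * 1)
    arith = solve-∀

  M≤ : 1 + N * K ≤ n * (1 + 2 * K)
  M≤ = by-sum 0 (ℕ.+-mono-≤ 1≤n (scale K N≤)) (arith K N n)
    where
    arith : ∀ K N n → 1 + N * K + (n + K * (2 * n)) + 0 ≡ n * (1 + 2 * K) + (1 + K * N)
    arith = solve-∀

  part₃ : t₃ ≤ (8 + (129 + 3 * K) * (1 + 2 * K) + 70) * P
  part₃ = ℕ.≤-trans h₃ (by-sum 0
    (ℕ.+-mono-≤ (scale 2 N≤2P) (ℕ.+-mono-≤ (ℕ.*-mono-≤ D≤ M≤)
      (ℕ.+-mono-≤ (scale 7 (ℕ.*-mono-≤ N≤ a≤)) (scale 4 1≤P))))
    (arith K N a n A ((21 * a + 3 * K + 24) * (1 + N * K))))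
    where
    arith : ∀ K N a n A X → suc (N * 2) + suc (X + 7 * (N * a) + 2) +
      (2 * (2 * (n * A)) + ((129 + 3 * K) * A * (n * (1 + 2 * K)) + (7 * (2 * n * (5 * A)) + 4 * (n * A)))) + 0 ≡
      (8 + (129 + 3 * K) * (1 + 2 * K) + 70) * (n * A) + (2 * N + (X + (7 * (N * a) + 4 * 1)))
    arith = solve-∀

-- Assembling the run

module Run (𝒜 : Actions) (k : ℕ) where

  open GKAT 𝒜 k
  open Coalgebra
  open Runs 𝒜 k
  open ThompsonRun 𝒜 k
  open BuildRun 𝒜 k
  open NormalizationRun 𝒜 k using (pruned)
  open Language 𝒜 k using (IsMorphism; mapOut-step)
  open Normalized 𝒜 k

  K : ℕ
  K = length (atoms k)

  module _ (e₁ e₂ : Exp) where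

    𝒳₁ 𝒳₂ : Coalgebra
    𝒳₁ = Thompson e₁
    𝒳₂ = Thompson e₂

    num : (State 𝒳₁ ⊎ State 𝒳₂) ↔ Fin (suc (count e₁) + suc (count e₂))
    num = numᵀ e₁ e₂

    N s₁ s₂ n : ℕ
    N  = suc (count e₁) + suc (count e₂)
    s₁ = index num (inj₁ ι)
    s₂ = index num (inj₂ ι)
    n  = size e₁ + size e₂

    index< : ∀ x → index num x < N
    index< x = Fin.toℕ<n (Inverse.to num x)

    index-onto : ∀ {i} → i < N → ∃[ x ] index num x ≡ i
    index-onto i<N = Inverse.from num (fromℕ< i<N) ,
      trans (cong toℕ (Inverse.strictlyInverseˡ num (fromℕ< i<N))) (Fin.toℕ-fromℕ< i<N)

    N≤2+n : N ≤ 2 + n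
    N≤2+n = ℕ.≤-trans (ℕ.≤-reflexive (cong suc (ℕ.+-suc (count e₁) (count e₂))))
      (ℕ.+-monoʳ-≤ 2 (ℕ.+-mono-≤ (count≤size e₁) (count≤size e₂)))

    -- Abstract, because ackermann (4 + j) 1 unfolds to a huge term.
    abstract
      a : ℕ
      a = 4 + inverseAckermann n

      a≡ : a ≡ 4 + inverseAckermann n
      a≡ = refl

      -- Going up one level raises `ackermann j 1` by at least one. Since `suc (suc N)` is at most
      -- `4 + n`, four levels above the inverse of `n` suffice.
      N<A : suc N < ackermann a 1
      N<A = ℕ.≤-trans (ℕ.+-monoʳ-≤ 2 N≤2+n)
        (grow (3 + j) (grow (2 + j) (grow (1 + j) (grow j (inverseAckermann-bound n)))))
        where
        j : ℕ
        j = inverseAckermann n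
        grow : ∀ {i} j → i ≤ ackermann j 1 → suc i ≤ ackermann (suc j) 1
        grow j h = ℕ.≤-trans (s≤s h) (ackermann-suc j)

    transitions : Store → ℕ → G ℕ
    transitions σ x α = σ (trans-at α) x

    Closed : Store → Set
    Closed σ = ∀ {x α p y} → x < N → transitions σ x α ≡ step p y → y < N

    stores-closed : ∀ {σ} → Stores σ (𝒳₁ ⊕ 𝒳₂) num → Closed σ
    stores-closed stores {x} {α} x<N e with index-onto x<N
    ... | s , refl with mapOut-step (δ (𝒳₁ ⊕ 𝒳₂) s α) (trans (sym (stores s α)) e)
    ...   | t , _ , refl = index< t

    module Normalize-ok {σ₁ σ₂ : Store} (stores₁ : Stores σ₁ (𝒳₁ ⊕ 𝒳₂) num)
      (live-ok : ∀ {x} → x < N → σ₂ live x ≡ true ⇔ Live (coalgebra ℕ (transitions σ₁)) x)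
      (pruned-ok : ∀ {x} → x < N → ∀ α → transitions σ₂ x α ≡ pruned (σ₂ live) (transitions σ₁ x α)) where

      T₁ T₂ : ℕ → G ℕ
      T₁ = transitions σ₁
      T₂ = transitions σ₂

      L : ℕ → Bool
      L = σ₂ live

      closed₂ : Closed σ₂
      closed₂ {x} {α} x<N e = stores-closed {σ₁} stores₁ x<N
        (proj₁ (pruned-step (T₁ x α) (trans (sym (pruned-ok x<N α)) e)))

      open HopcroftKarpRun 𝒜 k N a N<A T₂ closed₂ using (OutRel; Bisim; module Loop)
      open Loop s₁ s₂ using (Result)

      𝒯 : Coalgebra
      𝒯 = coalgebra ℕ T₁

      g₁ : State 𝒳₁ → ℕ
      g₁ = index num ∘ inj₁
      g₂ : State 𝒳₂ → ℕ
      g₂ = index num ∘ inj₂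

      g₁-morphism : IsMorphism (δ 𝒳₁) T₁ g₁
      g₁-morphism x α = trans (stores₁ (inj₁ x) α) (mapOut-∘ (λ _ → refl) (δ 𝒳₁ x α))

      g₂-morphism : IsMorphism (δ 𝒳₂) T₁ g₂
      g₂-morphism x α = trans (stores₁ (inj₂ x) α) (mapOut-∘ (λ _ → refl) (δ 𝒳₂ x α))

      module Marks (𝒳 : Coalgebra) (g : State 𝒳 → ℕ) (g< : ∀ x → g x < N) (mor : IsMorphism (δ 𝒳) T₁ g) where

        -- The decider is read off the marks in memory. The numbering, being a morphism, preserves
        -- and reflects liveness.
        live? : Decidable (Live 𝒳)
        live? x = map′ (λ l → Live-unmap 𝒳 𝒯 g mor (Equivalence.to marks l))
                       (λ l → Equivalence.from marks (Live-map 𝒳 𝒯 g mor l)) (L (g x) Bool.≟ true)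
          where marks = live-ok (g< x)

        does-live? : ∀ x → L (g x) ≡ does (live? x)
        does-live? x with L (g x)
        ... | true  = refl
        ... | false = refl

        𝒩 : Coalgebra
        𝒩 = normalization 𝒳 live?

        morphism : IsMorphism (δ 𝒩) T₂ g
        morphism x α = trans (pruned-ok (g< x) α)
          (trans (cong (pruned L) (mor x α))
          (trans (pruned-map does-live? (δ 𝒳 x α)) (cong (mapOut g) (sym (normalization-δ 𝒳 live? x α)))))

      module M₁ = Marks 𝒳₁ g₁ (index< ∘ inj₁) g₁-morphism
      module M₂ = Marks 𝒳₂ g₂ (index< ∘ inj₂) g₂-morphism

      stores₂ : Stores σ₂ (M₁.𝒩 ⊕ M₂.𝒩) num
      stores₂ (inj₁ x) α = trans (M₁.morphism x α) (sym (mapOut-∘ (λ _ → refl) (δ M₁.𝒩 x α)))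
      stores₂ (inj₂ x) α = trans (M₂.morphism x α) (sym (mapOut-∘ (λ _ → refl) (δ M₂.𝒩 x α)))

      OutRel-output : ∀ {X Y : Set} {E f g} (o : Out X) (o′ : Out Y) {v} →
                      OutRel E (mapOut f o) (mapOut g o′) → o ≡ inj₁ v → o′ ≡ inj₁ v
      OutRel-output (inj₁ v) (inj₁ w) refl refl = refl

      OutRel-next : ∀ {X Y : Set} {E f g} (o : Out X) (o′ : Out Y) {p x} →
                    OutRel E (mapOut f o) (mapOut g o′) → o ≡ step p x → ∃[ y ] o′ ≡ step p y × E (f x) (g y)
      OutRel-next (step p x) (step q y) (refl , e) refl = y , refl , e

      -- The classes may also join states of the same automaton; their trace on pairs with one state
      -- from each is the bisimulation.
      true⇒bisimilar : Result true → Bisimilar M₁.𝒩 M₂.𝒩 ι ι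
      true⇒bisimilar (lift (rep , start , related)) = (λ x y → rep (g₁ x) ≡ rep (g₂ y)) , record
        { output = λ {x} {y} r α → OutRel-output (δ M₁.𝒩 x α) (δ M₂.𝒩 y α) (at x y r α)
        ; next   = λ {x} {y} r α → OutRel-next (δ M₁.𝒩 x α) (δ M₂.𝒩 y α) (at x y r α)
        } , start
        where
        at : ∀ x y → rep (g₁ x) ≡ rep (g₂ y) → ∀ α →
             OutRel (λ u v → rep u ≡ rep v) (mapOut g₁ (δ M₁.𝒩 x α)) (mapOut g₂ (δ M₂.𝒩 y α))
        at x y r α = subst₂ (OutRel _) (M₁.morphism x α) (M₂.morphism y α)
          (related (index< (inj₁ x)) (index< (inj₂ y)) r α)

      -- A bisimulation between the two automata is pushed forward along the numbering to one on the
      -- states in memory, where `Result false` refutes it at the start pair.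
      false⇒¬bisimilar : Result false → ¬ Bisimilar M₁.𝒩 M₂.𝒩 ι ι
      false⇒¬bisimilar none (R , bisim , r) = none B closed (ι , ι , refl , refl , r)
        where
        open IsBisimulation bisim
        B : ℕ → ℕ → Set
        B u v = ∃[ x ] ∃[ y ] u ≡ g₁ x × v ≡ g₂ y × R x y
        related : ∀ {x y} α o → R x y → δ M₁.𝒩 x α ≡ o → OutRel B (mapOut g₁ o) (mapOut g₂ (δ M₂.𝒩 y α))
        related α (inj₁ v)    r e rewrite output r α e = refl
        related α (step p x′) r e with next r α e
        ... | y′ , e′ , r′ rewrite e′ = refl , x′ , y′ , refl , refl , r′
        closed : Bisim B
        closed _ _ (x , y , refl , refl , r) α = subst₂ (OutRel B) (sym (M₁.morphism x α)) (sym (M₂.morphism y α))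
          (related α (δ M₁.𝒩 x α) r refl)

      result⇔bisimilar : ∀ v → Result v → v ≡ true ⇔ Bisimilar M₁.𝒩 M₂.𝒩 ι ι
      result⇔bisimilar true  out = mk⇔ (λ _ → true⇒bisimilar out) (λ _ → refl)
      result⇔bisimilar false out = mk⇔ (λ ()) (⊥-elim ∘ false⇒¬bisimilar out)

    -- The origin of the threshold 3: `ackermann 0 1` is 2, so up to 2 the inverse is 0 and no
    -- multiple of `n * 0` bounds a running time.
    positive : 3 ≤ n → 1 ≤ inverseAckermann n
    positive 3≤n with inverseAckermann n | inverseAckermann-bound n
    ... | zero  | n≤2 = ⊥-elim (ℕ.<⇒≱ 3≤n n≤2)
    ... | suc _ | _   = s≤s z≤n

    Decision : Store → Set₁
    Decision σ₀ = Σ[ run ∈ Execution e₁ e₂ σ₀ ]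
      (Execution.result run ≡ true ⇔ ⟦ e₁ ⟧ ≐ ⟦ e₂ ⟧) ×
      (3 ≤ n → Execution.time run ≤ constant K * (n * inverseAckermann n))

    open NormalizationEnds 𝒜 k N using (normalize-ends)
    open HopcroftKarpRun 𝒜 k N a N<A using (module Loop)

    run-decide : ∀ σ₀ → Decision σ₀
    run-decide σ₀ = after-thompson (thompson-ends e₁ e₂)
      where
      fast : ∀ {t₁ t₂ t₃} →
        t₁ ≤ K * (3 * size e₁) + 1 + (K * (3 * size e₂) + 1 + 1) → t₂ ≤ _ → t₃ ≤ _ → 3 ≤ n →
        t₁ + (t₂ + t₃) ≤ constant K * (n * inverseAckermann n)
      fast {t₁} {t₂} {t₃} t₁≤ t₂≤ t₃≤ 3≤n = total-time K N a n (inverseAckermann n) t₁ t₂ t₃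
        (ℕ.≤-trans N≤2+n (by-sum 0 2≤n (twice n)))
        (ℕ.≤-trans (ℕ.≤-reflexive a≡) (by-sum 0 (scale 4 (positive 3≤n)) (five (inverseAckermann n))))
        (positive 3≤n) (ℕ.≤-trans (s≤s z≤n) 3≤n)
        (ℕ.≤-trans t₁≤ (ℕ.≤-reflexive (thompson-time K (size e₁) (size e₂)))) t₂≤ t₃≤
        where
        2≤n : 2 ≤ n
        2≤n = ℕ.≤-trans (ℕ.n≤1+n 2) 3≤n
        twice : ∀ n → 2 + n + n + 0 ≡ 2 * n + 2
        twice = solve-∀
        five : ∀ A → 4 + A + 4 * A + 0 ≡ 5 * A + 4 * 1
        five = solve-∀
        thompson-time : ∀ K m n → K * (3 * m) + 1 + (K * (3 * n) + 1 + 1) ≡ K * (3 * (m + n)) + 3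
        thompson-time = solve-∀

      after-thompson : Ends (thompson e₁ e₂) σ₀ _ → Decision σ₀
      after-thompson (ends {store = σ₁} {t₁} run₁ (refl , stores₁ , t₁≤)) =
        after-normalize (normalize-ends (transitions σ₁) (stores-closed {σ₁} stores₁) λ _ _ → refl)
        where
        after-normalize : Ends (normalize N) σ₁ _ → Decision σ₀
        after-normalize (ends {store = σ₂} {t₂} run₂ (live-ok , pruned-ok , t₂≤)) =
          after-hopcroftKarp (Loop.hopcroftKarp-ends T₂ closed₂ s₁ s₂ (λ _ _ → refl)
            (index< (inj₁ ι)) (index< (inj₂ ι)))
          where
          open Normalize-ok {σ₁} {σ₂} stores₁ live-ok pruned-ok
          after-hopcroftKarp : Ends (hopcroftKarp s₁ s₂ N) σ₂ _ → Decision σ₀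
          after-hopcroftKarp (ends {v} {σ₃} {t₃} run₃ (outcome , t₃≤)) = record
            { live₁? = M₁.live? ; live₂? = M₂.live? ; N = N ; num = num
            ; σ₁ = σ₁ ; σ₂ = σ₂ ; σ₃ = σ₃ ; t₁ = t₁ ; t₂ = t₂ ; t₃ = t₃
            ; time = t₁ + (t₂ + t₃) ; result = v
            ; step₁ = run₁ ; thompson-ok = stores₁
            ; step₂ = run₂ ; normal-ok = stores₂
            ; step₃ = run₃ ; bisim-ok = iff
            ; decide-runs = ⇓bind run₁ (⇓bind run₂ run₃)
            } , mk⇔
              (λ eq → bisimilar⇒equal e₁ e₂ M₁.live? M₂.live? (Equivalence.to iff eq))
              (λ eq → Equivalence.from iff (equal⇒bisimilar e₁ e₂ M₁.live? M₂.live? eq)) ,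
            fast t₁≤ t₂≤ t₃≤
            where
            iff : v ≡ true ⇔ Bisimilar M₁.𝒩 M₂.𝒩 ι ι
            iff = result⇔bisimilar v outcome

open GKAT

theorem5p10 : (m : ℕ) → Σ[ c ∈ ℕ ] Σ[ n₀ ∈ ℕ ]
    ((𝒜 : Actions) (e₁ e₂ : Exp 𝒜 (suc m)) (σ₀ : Store 𝒜 (suc m)) →
    let n = size 𝒜 (suc m) e₁ + size 𝒜 (suc m) e₂ in
    Σ[ run ∈ Execution 𝒜 (suc m) e₁ e₂ σ₀ ]
    (Execution.result run ≡ true ⇔ ⟦_⟧ 𝒜 (suc m) e₁ ≐ ⟦_⟧ 𝒜 (suc m) e₂)
    × (n₀ ≤ n → Execution.time run ≤ c * (n * inverseAckermann n)))
theorem5p10 m = constant (length (atoms (suc m))) , 3 ,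
  λ 𝒜 e₁ e₂ σ₀ → Run.run-decide 𝒜 (suc m) e₁ e₂ σ₀
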